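{- Let $n\geq 10$ and let $(G,\{\rho_0,\rho_1,\rho_2\})$ be a string C-group of rank $3$ with $|G|=2^n$. Define the finitely presented groups (each generated by $\rho_0,\rho_1,\rho_2$): $G_1=\langle \rho_0,\rho_1,\rho_2 \mid \rho_0^2, \rho_1^2, \rho_2^2, (\rho_0\rho_1)^{4}, (\rho_1\rho_2)^{2^{n-3}}, (\rho_0\rho_2)^2, [(\rho_0\rho_1)^2,\rho_2] \rangle$, $G_2=\langle \rho_0,\rho_1,\rho_2 \mid \rho_0^2, \rho_1^2, \rho_2^2, (\rho_0\rho_1)^{4}, (\rho_1\rho_2)^{2^{n-3}}, (\rho_0\rho_2)^2, [(\rho_0\rho_1)^2,\rho_2](\rho_1\rho_2)^{2^{n-4}} \rangle$, $G_3=\langle \rho_0,\rho_1,\rho_2 \mid \rho_0^2, \rho_1^2, \rho_2^2, (\rho_0\rho_1)^{4}, (\rho_1\rho_2)^{2^{n-4}}, (\rho_0\rho_2)^2, [(\rho_0\rho_1)^2, (\rho_1\rho_2)^2]\rangle$, $G_4=\langle \rho_0,\rho_1,\rho_2 \mid \rho_0^2, \rho_1^2, \rho_2^2, (\rho_0\rho_1)^{4}, (\rho_1\rho_2)^{2^{n-4}}, (\rho_0\rho_2)^2, [(\rho_0\rho_1)^2, (\rho_1\rho_2)^2](\rho_1\rho_2)^{2^{n-5}} \rangle$, $G_5=\langle \rho_0,\rho_1,\rho_2 \mid \rho_0^2, \rho_1^2, \rho_2^2, (\rho_0\rho_1)^{4}, (\rho_1\rho_2)^{2^{n-5}}, (\rho_0\rho_2)^2,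 [\rho_0, (\rho_1\rho_2)^2]^2, [\rho_0, (\rho_1\rho_2)^4]\rangle$, $G_6=\langle \rho_0,\rho_1,\rho_2 \mid \rho_0^2, \rho_1^2, \rho_2^2, (\rho_0\rho_1)^{4}, (\rho_1\rho_2)^{2^{n-5}}, (\rho_0\rho_2)^2, [\rho_0, (\rho_1\rho_2)^2]^2 (\rho_1\rho_2)^{2^{n-6}}, [\rho_0, (\rho_1\rho_2)^4]\rangle$, $G_7=\langle \rho_0,\rho_1,\rho_2 \mid \rho_0^2, \rho_1^2, \rho_2^2, (\rho_0\rho_1)^{4}, (\rho_1\rho_2)^{2^{n-5}}, (\rho_0\rho_2)^2, [\rho_0, (\rho_1\rho_2)^2]^2, [\rho_0, (\rho_1\rho_2)^4](\rho_1\rho_2)^{2^{n-6}}\rangle$, $G_8=\langle \rho_0,\rho_1,\rho_2 \mid \rho_0^2, \rho_1^2, \rho_2^2, (\rho_0\rho_1)^{4}, (\rho_1\rho_2)^{2^{n-5}}, (\rho_0\rho_2)^2, [\rho_0, (\rho_1\rho_2)^2]^2(\rho_1\rho_2)^{2^{n-6}}, [\rho_0, (\rho_1\rho_2)^4](\rho_1\rho_2)^{2^{n-6}}\rangle$. Then: (1) $(G,\{\rho_0,\rho_1,\rho_2\})$ has type $\{4,2^{n-3}\}$ if and only if $G \cong G_1$ or $G\cong G_2$; (2) it has type $\{4,2^{n-4}\}$ if and only if $G \cong G_3$ or $G\cong G_4$; (3) it has type $\{4,2^{n-5}\}$ if and only if $G \cong G_5$, $G_6$, $G_7$ or $G_8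$.
   Context: A string C-group of rank $3$ is a pair $(G,\{\rho_0,\rho_1,\rho_2\})$ where $G$ is a group generated by the three involutions $\rho_0,\rho_1,\rho_2$ such that $\rho_0\rho_2=\rho_2\rho_0$ and, writing $G_I=\langle \rho_i : i\in I\rangle$ for $I\subseteq\{0,1,2\}$, $G_I\cap G_J=G_{I\cap J}$ for all $I,J\subseteq\{0,1,2\}$. Its (Schläfli) type is $\{p_1,p_2\}$ where $p_1$ is the order of $\rho_0\rho_1$ and $p_2$ the order of $\rho_1\rho_2$. The commutator is $[x,y]=x^{ -1}y^{ -1}xy$. Isomorphism $G\cong G_i$ is understood via the generators $\rho_0,\rho_1,\rho_2$ of $G$ corresponding to the generators of the presentation of $G_i$. -}

module Defs where

open import Level using (Level; _⊔_) renaming (zero to lzero)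
open import Algebra.Bundles using (Group)
open import Data.Nat using (ℕ; zero; suc; _<_; _∸_; _^_)
open import Data.Fin using (Fin) renaming (zero to f0; suc to fs)
open import Data.Fin.Subset using (Subset; _∈_; _∩_)
open import Data.Bool using (Bool; true; false; not)
open import Data.Product using (Σ; _×_; _,_; proj₁; ∃)
open import Data.List using (List; []; _∷_; _++_; reverse; map; concat; replicate)
open import Data.List.Relation.Unary.All using (All)
import Data.List.Membership.Propositional as LM
open import Relation.Binary.PropositionalEquality using (_≡_)
open import Relation.Nullary using (¬_)
open import Function.Bundles using (_⇔_)

-- Words in the free group on three generators ρ₀ ρ₁ ρ₂
-- A letter is (i , b): b = false means ρᵢ, b = true means ρᵢ⁻¹.

Letter : Set
Letter = Fin 3 × Bool

Word : Set
Word = List Letter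

invLetter : Letter → Letter
invLetter (i , b) = (i , not b)

gen : Fin 3 → Word
gen i = (i , false) ∷ []

winv : Word → Word
winv w = reverse (map invLetter w)

wpow : Word → ℕ → Word
wpow w zero = []
wpow w (suc k) = w ++ wpow w k

wcomm : Word → Word → Word
wcomm x y = winv x ++ winv y ++ x ++ y

-- The congruence on words defined by a list of relators R:
-- the least congruence (w.r.t. concatenation) containing free
-- cancellation and r ~ [] for every relator r ∈ R.  The quotient
-- Word/~ is the finitely presented group ⟨ρ₀,ρ₁,ρ₂ ∣ R⟩.

data _⊢_~_ (R : List Word) : Word → Word → Set where
  ~refl   : ∀ {u} → R ⊢ u ~ u
  ~sym    : ∀ {u v} → R ⊢ u ~ v → R ⊢ v ~ u
  ~trans  : ∀ {u v w} → R ⊢ u ~ v → R ⊢ v ~ w → R ⊢ u ~ w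
  ~app    : ∀ {u u′ v v′} → R ⊢ u ~ u′ → R ⊢ v ~ v′ → R ⊢ (u ++ v) ~ (u′ ++ v′)
  ~cancel : ∀ (l : Letter) → R ⊢ (l ∷ invLetter l ∷ []) ~ []
  ~rel    : ∀ {r} → r LM.∈ R → R ⊢ r ~ []

module _ {c ℓ : Level} (G : Group c ℓ) where
  open Group G

  gpow : Carrier → ℕ → Carrier
  gpow x zero = ε
  gpow x (suc k) = x ∙ gpow x k

  HasOrder : Carrier → ℕ → Set ℓ
  HasOrder x k = (0 < k) × (gpow x k ≈ ε) × (∀ m → 0 < m → m < k → ¬ (gpow x m ≈ ε))

  HasCard : ℕ → Set (c ⊔ ℓ)
  HasCard m = Σ (Fin m → Carrier) λ f →
                (∀ i j → f i ≈ f j → i ≡ j) × (∀ g → ∃ λ i → f i ≈ g)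

  module _ (ρ : Fin 3 → Carrier) where

    evalLetter : Letter → Carrier
    evalLetter (i , false) = ρ i
    evalLetter (i , true) = ρ i ⁻¹

    eval : Word → Carrier
    eval [] = ε
    eval (l ∷ w) = evalLetter l ∙ eval w

    InSub : Subset 3 → Carrier → Set ℓ
    InSub I g = Σ Word λ w → All (λ l → proj₁ l ∈ I) w × (eval w ≈ g)

    IsStringCGroup : Set (c ⊔ ℓ)
    IsStringCGroup =
        (∀ i → (ρ i ∙ ρ i ≈ ε) × ¬ (ρ i ≈ ε))
      × (∀ g → Σ Word λ w → eval w ≈ g)
      × (ρ f0 ∙ ρ (fs (fs f0)) ≈ ρ (fs (fs f0)) ∙ ρ f0)
      × (∀ I J g → (InSub I g × InSub J g) ⇔ InSub (I ∩ J) g)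

    HasType : ℕ → ℕ → Set ℓ
    HasType p₁ p₂ = HasOrder (ρ f0 ∙ ρ (fs f0)) p₁ × HasOrder (ρ (fs f0) ∙ ρ (fs (fs f0))) p₂

    -- G ≅ ⟨ρ₀,ρ₁,ρ₂ ∣ R⟩ via ρᵢ ↦ ρᵢ : the map Word/~ → G induced by
    -- evaluation is well defined, injective and surjective.
    Presents : List Word → Set (c ⊔ ℓ)
    Presents R = (∀ u v → R ⊢ u ~ v → eval u ≈ eval v)
               × (∀ u v → eval u ≈ eval v → R ⊢ u ~ v)
               × (∀ g → Σ Word λ w → eval w ≈ g)

r₀ r₁ r₂ : Word
r₀ = gen f0
r₁ = gen (fs f0)
r₂ = gen (fs (fs f0))

base : ℕ → List Word
base q = wpow r₀ 2 ∷ wpow r₁ 2 ∷ wpow r₂ 2 ∷ wpow (r₀ ++ r₁) 4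
       ∷ wpow (r₁ ++ r₂) q ∷ wpow (r₀ ++ r₂) 2 ∷ []

r₁₂ : Word
r₁₂ = r₁ ++ r₂

G₁ G₂ G₃ G₄ G₅ G₆ G₇ G₈ : ℕ → List Word
G₁ n = base (2 ^ (n ∸ 3)) ++ (wcomm (wpow (r₀ ++ r₁) 2) r₂ ∷ [])
G₂ n = base (2 ^ (n ∸ 3)) ++ ((wcomm (wpow (r₀ ++ r₁) 2) r₂ ++ wpow r₁₂ (2 ^ (n ∸ 4))) ∷ [])
G₃ n = base (2 ^ (n ∸ 4)) ++ (wcomm (wpow (r₀ ++ r₁) 2) (wpow r₁₂ 2) ∷ [])
G₄ n = base (2 ^ (n ∸ 4)) ++ ((wcomm (wpow (r₀ ++ r₁) 2) (wpow r₁₂ 2) ++ wpow r₁₂ (2 ^ (n ∸ 5))) ∷ [])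
G₅ n = base (2 ^ (n ∸ 5)) ++ (wpow (wcomm r₀ (wpow r₁₂ 2)) 2
                             ∷ wcomm r₀ (wpow r₁₂ 4) ∷ [])
G₆ n = base (2 ^ (n ∸ 5)) ++ ((wpow (wcomm r₀ (wpow r₁₂ 2)) 2 ++ wpow r₁₂ (2 ^ (n ∸ 6)))
                             ∷ wcomm r₀ (wpow r₁₂ 4) ∷ [])
G₇ n = base (2 ^ (n ∸ 5)) ++ (wpow (wcomm r₀ (wpow r₁₂ 2)) 2
                             ∷ (wcomm r₀ (wpow r₁₂ 4) ++ wpow r₁₂ (2 ^ (n ∸ 6))) ∷ [])
G₈ n = base (2 ^ (n ∸ 5)) ++ ((wpow (wcomm r₀ (wpow r₁₂ 2)) 2 ++ wpow r₁₂ (2 ^ (n ∸ 6)))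
                             ∷ (wcomm r₀ (wpow r₁₂ 4) ++ wpow r₁₂ (2 ^ (n ∸ 6))) ∷ [])

{-# OPTIONS --safe #-}
module Submission where

-- Write a, b, c for ρ₀, ρ₁, ρ₂ and put t = bc, z = (ab)², w = ata = zt, u = w²; let Q be the order
-- of t and D = ⟨b, c⟩, of order 2Q.  Conjugation by a fixes z and c and exchanges t and w.
--
-- From the relators to the type: in a group satisfying the relators, every element is a power of t
-- times a product of some of the elements c, z, a (and u, or u and u⁻¹tu), each of which normalises
-- the subgroup generated by the previous ones and has its square there.  These are 2ⁿ normal forms,
-- so in a group of order 2ⁿ they are distinct.  This gives the orders of t and of ab; applied to
-- the presented group, it also shows that G has no further relations.
--
-- From the type to the relators: counting fixed points of involutions on cosets, D is the bottom of
-- a tower of subgroups of G, each of index 2 in the next.  As a normalises the last proper one, it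
-- contains w, and climbing down by squaring puts u (or u², or u⁴) in D, hence in ⟨t⟩.  For type
-- {4,2ⁿ⁻⁵} one has to exclude that u² ∉ D.  Conjugating by a then gives the relators up to an
-- involution of ⟨t⟩, that is, up to the power t^(Q/2).

open import Defs
open import Level using (Level; _⊔_; 0ℓ)
open import Algebra.Bundles using (Group)
import Algebra.Properties.Group as GroupProperties
open import Data.Bool using (Bool; true; false; not)
import Data.Bool.Properties as Bool
open import Data.Empty using (⊥; ⊥-elim)
open import Data.Fin as Fin using (Fin) renaming (zero to f0; suc to fs)
import Data.Fin.Properties as Fin
open import Data.Integer as ℤ using (ℤ; +_; -[1+_])
import Data.Integer.DivMod as ℤ
import Data.Integer.Properties as ℤ
open import Data.Integer.Tactic.RingSolver using () renaming (solve-∀ to ℤ-solve-∀)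
open import Data.List using (List; []; _∷_; _++_; foldr; length; map; reverse; tabulate)
open import Data.List.Membership.Propositional using (_∈_)
import Data.List.Properties as List
open import Data.List.Relation.Unary.All as All using (All; []; _∷_)
open import Data.List.Relation.Unary.Any as Any using (Any; here; there)
import Data.List.Relation.Unary.Any.Properties as Any
open import Data.Maybe using (Maybe; just; nothing)
open import Data.Nat as ℕ using (ℕ; zero; suc)
import Data.Nat.Properties as ℕ
open import Data.Nat.Tactic.RingSolver using () renaming (solve-∀ to ℕ-solve-∀)
open import Data.Product using (Σ; ∃; _×_; _,_; proj₁; proj₂)
open import Data.Product.Properties using (≡-dec)
open import Data.Sum using (_⊎_; inj₁; inj₂; [_,_]′)
open import Data.Sum.Function.Propositional using (_⊎-↔_)
open import Data.Sum.Properties using (inj₁-injective)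
open import Function.Base using (_∘_)
open import Function.Bundles using (_⇔_; _↔_; Inverse; mk⇔)
open import Function.Properties.Inverse using (↔-refl; ↔-sym; ↔-trans)
open import Relation.Binary.Bundles using (DecSetoid)
open import Relation.Binary.PropositionalEquality as ≡ using (_≡_; _≢_)
import Relation.Binary.Reasoning.Setoid as SetoidReasoning
open import Relation.Nullary using (¬_; Dec; yes; no; contradiction)
open import Relation.Nullary.Decidable using (_⊎-dec_; map′)

-- Word problems in groups by rewriting

-- No model of any of the eight presented groups is constructed. Their normal forms map onto `G`,
-- whose order is given, so `G` itself shows that no two of them coincide; the chains behind the
-- normal forms therefore need not be proper. In the other direction the subgroups between `D` and
-- `G` are known to exist, but not which they are. All that is deduced about `u` has to come from
-- inclusions, squares and conjugation in successive steps of index two. The chain below `D` starts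
-- at the trivial subgroup of a finite group, so membership in `D` is decidable and the proof may
-- split on `u² ∈ D`. If `u² ∉ D`, the subgroup next above `D` is `D ∪ D u²`, and `u t u⁻¹` has one
-- of the forms `t^x`, `t^x u²`, `t^x c u²`. Each of them contradicts either `u² ∉ ⟨t⟩` or a
-- congruence between exponents of `t`. These congruences are taken modulo 32, and 32 divides the
-- order of `t` in the third case because `2ⁿ⁻⁵` is at least 32.

Atom : Set
Atom = ℕ × Bool

inverseAtom : Atom → Atom
inverseAtom (i , s) = i , not s

infixl 7 _·_
infix 8 _⁻
infix 9 ‵_

data Expr : Set where
  ‵_  : ℕ → Expr
  _·_ : Expr → Expr → Expr
  _⁻  : Expr → Expr
  𝟏   : Expr

flat flat⁻ : Expr → List Atom
flat (‵ i)   = (i , false) ∷ []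
flat (e · f) = flat e ++ flat f
flat (e ⁻)   = flat⁻ e
flat 𝟏       = []
flat⁻ (‵ i)   = (i , true) ∷ []
flat⁻ (e · f) = flat⁻ f ++ flat⁻ e
flat⁻ (e ⁻)   = flat e
flat⁻ 𝟏       = []

pow : Expr → ℕ → Expr
pow e zero    = 𝟏
pow e (suc n) = e · pow e n

stripPrefix : List Atom → List Atom → Maybe (List Atom)
stripPrefix []      v       = just v
stripPrefix (_ ∷ _) []      = nothing
stripPrefix (x ∷ u) (y ∷ v) with ≡-dec ℕ._≟_ Bool._≟_ x y
... | yes _ = stripPrefix u v
... | no  _ = nothing

stripPrefix-sound : ∀ u v {s} → stripPrefix u v ≡ just s → v ≡ u ++ s
stripPrefix-sound []      v       ≡.refl = ≡.refl
stripPrefix-sound (x ∷ u) (y ∷ v) eq with ≡-dec ℕ._≟_ Bool._≟_ x y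
... | yes ≡.refl = ≡.cong (x ∷_) (stripPrefix-sound u v eq)

cancelHead : Atom → List Atom → Maybe (List Atom)
cancelHead x []      = nothing
cancelHead x (y ∷ v) with ≡-dec ℕ._≟_ Bool._≟_ y (inverseAtom x)
... | yes _ = just v
... | no  _ = nothing

module Rewriting {c ℓ : Level} (G : Group c ℓ) where
  open Group G
  open GroupProperties G
  open SetoidReasoning setoid

  at : List Carrier → ℕ → Carrier
  at []       _       = ε
  at (x ∷ _)  zero    = x
  at (_ ∷ xs) (suc i) = at xs i

  module _ (env : List Carrier) where

    value : Atom → Carrier
    value (i , false) = at env i
    value (i , true)  = at env i ⁻¹

    word : List Atom → Carrier
    word = foldr (λ x → value x ∙_) ε

    ⟦_⟧ : Expr → Carrier
    ⟦ ‵ i ⟧   = at env i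
    ⟦ e · f ⟧ = ⟦ e ⟧ ∙ ⟦ f ⟧
    ⟦ e ⁻ ⟧   = ⟦ e ⟧ ⁻¹
    ⟦ 𝟏 ⟧     = ε

    infix 4 _↦_by_

    record Rule : Set ℓ where
      constructor _↦_by_
      field
        lhs rhs : Expr
        sound   : ⟦ lhs ⟧ ≈ ⟦ rhs ⟧

    word-++ : ∀ u v → word (u ++ v) ≈ word u ∙ word v
    word-++ []      v = sym (identityˡ _)
    word-++ (x ∷ u) v = trans (∙-congˡ (word-++ u v)) (sym (assoc _ _ _))

    flat-sound  : ∀ e → word (flat e) ≈ ⟦ e ⟧
    flat⁻-sound : ∀ e → word (flat⁻ e) ≈ ⟦ e ⟧ ⁻¹
    flat-sound (‵ i)   = identityʳ _
    flat-sound (e · f) = trans (word-++ (flat e) (flat f)) (∙-cong (flat-sound e) (flat-sound f))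
    flat-sound (e ⁻)   = flat⁻-sound e
    flat-sound 𝟏       = refl
    flat⁻-sound (‵ i)   = identityʳ _
    flat⁻-sound (e · f) = trans (word-++ (flat⁻ f) (flat⁻ e))
      (trans (∙-cong (flat⁻-sound f) (flat⁻-sound e)) (sym (⁻¹-anti-homo-∙ _ _)))
    flat⁻-sound (e ⁻)   = trans (flat-sound e) (sym (⁻¹-involutive _))
    flat⁻-sound 𝟏       = sym ε⁻¹≈ε

    module _ (rules : List Rule) where

      rewriteHead : List Rule → List Atom → Maybe (List Atom × List Atom)
      rewriteHead []                     w = nothing
      rewriteHead ((l ↦ r by _) ∷ rules) w with stripPrefix (flat l) w
      ... | just s  = just (flat r , s)
      ... | nothing = rewriteHead rules w

      rewriteHead-sound : ∀ rs w {r s} → rewriteHead rs w ≡ just (r , s) → word w ≈ word r ∙ word s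
      rewriteHead-sound ((l ↦ r by p) ∷ rs) w eq with stripPrefix (flat l) w in match
      rewriteHead-sound ((l ↦ r by p) ∷ rs) w {s = s} ≡.refl | just _ = begin
        word w                    ≡⟨ ≡.cong word (stripPrefix-sound (flat l) w match) ⟩
        word (flat l ++ s)        ≈⟨ word-++ (flat l) s ⟩
        word (flat l) ∙ word s    ≈⟨ ∙-congʳ (trans (flat-sound l) (trans p (sym (flat-sound r)))) ⟩
        word (flat r) ∙ word s    ∎
      ... | nothing = rewriteHead-sound rs w eq

      value-inverse : ∀ x → value x ∙ value (inverseAtom x) ≈ ε
      value-inverse (i , false) = inverseʳ _
      value-inverse (i , true)  = inverseˡ _

      cancelHead-sound : ∀ x v {s} → cancelHead x v ≡ just s → value x ∙ word v ≈ word s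
      cancelHead-sound x (y ∷ v) eq with ≡-dec ℕ._≟_ Bool._≟_ y (inverseAtom x)
      cancelHead-sound x (_ ∷ v) ≡.refl | yes ≡.refl =
        trans (sym (assoc _ _ _)) (trans (∙-congʳ (value-inverse x)) (identityˡ _))

      -- The first argument bounds the number of nested rewriting steps.
      push : ℕ → Atom → List Atom → List Atom
      push zero    x v = x ∷ v
      push (suc k) x v with cancelHead x v
      ... | just s  = s
      ... | nothing with rewriteHead rules (x ∷ v)
      ...   | just (r , s) = foldr (push k) s r
      ...   | nothing      = x ∷ v

      push-sound  : ∀ k x v → word (push k x v) ≈ value x ∙ word v
      pushes-sound : ∀ k u v → word (foldr (push k) v u) ≈ word u ∙ word v
      push-sound zero    x v = refl
      push-sound (suc k) x v with cancelHead x v in eq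
      ... | just s  = sym (cancelHead-sound x v eq)
      ... | nothing with rewriteHead rules (x ∷ v) in eq′
      ...   | just (r , s) = trans (pushes-sound k r s) (sym (rewriteHead-sound rules (x ∷ v) eq′))
      ...   | nothing      = refl
      pushes-sound k []      v = sym (identityˡ _)
      pushes-sound k (x ∷ u) v =
        trans (push-sound k x _) (trans (∙-congˡ (pushes-sound k u v)) (sym (assoc _ _ _)))

      normalise : Expr → List Atom
      normalise e = foldr (push 1000) [] (flat e)

      normalise-sound : ∀ e → word (normalise e) ≈ ⟦ e ⟧
      normalise-sound e =
        trans (pushes-sound 1000 (flat e) []) (trans (identityʳ _) (flat-sound e))

      abstract
        -- Only soundness of the rules matters. Neither termination nor confluence is claimed: if
        -- the rules are too weak, the proof `≡.refl` of the equation between normal forms is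
        -- rejected. The result is abstract so that later types do not unfold the computation.
        rewriting : ∀ e f → normalise e ≡ normalise f → ⟦ e ⟧ ≈ ⟦ f ⟧
        rewriting e f eq =
          trans (sym (normalise-sound e)) (trans (reflexive (≡.cong word eq)) (normalise-sound f))

    involution : ∀ i → at env i ∙ at env i ≈ ε → List Rule
    involution i p = (‵ i · ‵ i ↦ 𝟏 by p) ∷ (‵ i ⁻ ↦ ‵ i by sym (inverseˡ-unique _ _ p)) ∷ []

  free : ∀ env e f → normalise env [] e ≡ normalise env [] f → ⟦_⟧ env e ≈ ⟦_⟧ env f
  free env = rewriting env []

  Commutes : Carrier → Carrier → Set ℓ
  Commutes x y = x ∙ y ≈ y ∙ x

  commutes-inverseˡ : ∀ {x y} → Commutes x y → Commutes (x ⁻¹) y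
  commutes-inverseˡ {x} {y} p = begin
    x ⁻¹ ∙ y                   ≈⟨ free (x ∷ y ∷ []) (‵ 0 ⁻ · ‵ 1) (‵ 0 ⁻ · (‵ 1 · ‵ 0) · ‵ 0 ⁻) ≡.refl ⟩
    (x ⁻¹ ∙ (y ∙ x)) ∙ x ⁻¹    ≈⟨ ∙-congʳ (∙-congˡ p) ⟨
    (x ⁻¹ ∙ (x ∙ y)) ∙ x ⁻¹    ≈⟨ free (x ∷ y ∷ []) (‵ 0 ⁻ · (‵ 0 · ‵ 1) · ‵ 0 ⁻) (‵ 1 · ‵ 0 ⁻) ≡.refl ⟩
    y ∙ x ⁻¹                   ∎

  commutes-inverseʳ : ∀ {x y} → Commutes x y → Commutes x (y ⁻¹)
  commutes-inverseʳ p = sym (commutes-inverseˡ (sym p))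

  -- Rules match atoms literally, so each combination of signs needs its own rule. All four move `i`
  -- to the right of `j`.
  commuting : ∀ env i j → Commutes (at env i) (at env j) → List (Rule env)
  commuting env i j p =
      (‵ i · ‵ j ↦ ‵ j · ‵ i by p)
    ∷ (‵ i ⁻ · ‵ j ↦ ‵ j · ‵ i ⁻ by commutes-inverseˡ p)
    ∷ (‵ i · ‵ j ⁻ ↦ ‵ j ⁻ · ‵ i by commutes-inverseʳ p)
    ∷ (‵ i ⁻ · ‵ j ⁻ ↦ ‵ j ⁻ · ‵ i ⁻ by commutes-inverseˡ (commutes-inverseʳ p))
    ∷ []

-- Integer powers, commutation and conjugation

module Powers {c ℓ : Level} (G : Group c ℓ) where
  open Group G
  open GroupProperties G
  open SetoidReasoning setoid
  open Rewriting G

  infixr 8 _^_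

  _^_ : Carrier → ℤ → Carrier
  x ^ (+ n)    = gpow G x n
  x ^ -[1+ n ] = gpow G x (suc n) ⁻¹

  gpow-cong : ∀ {x y} n → x ≈ y → gpow G x n ≈ gpow G y n
  gpow-cong zero    p = refl
  gpow-cong (suc n) p = ∙-cong p (gpow-cong n p)

  ^-cong : ∀ {x y} k → x ≈ y → x ^ k ≈ y ^ k
  ^-cong (+ n)    p = gpow-cong n p
  ^-cong -[1+ n ] p = ⁻¹-cong (gpow-cong (suc n) p)

  ^-≡ : ∀ x {i j} → i ≡ j → x ^ i ≈ x ^ j
  ^-≡ x eq = reflexive (≡.cong (x ^_) eq)

  commutes-∙ : ∀ {x y z} → Commutes x y → Commutes x z → Commutes x (y ∙ z)
  commutes-∙ {x} {y} {z} p q = begin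
    x ∙ (y ∙ z)  ≈⟨ assoc _ _ _ ⟨
    x ∙ y ∙ z    ≈⟨ ∙-congʳ p ⟩
    y ∙ x ∙ z    ≈⟨ assoc _ _ _ ⟩
    y ∙ (x ∙ z)  ≈⟨ ∙-congˡ q ⟩
    y ∙ (z ∙ x)  ≈⟨ assoc _ _ _ ⟨
    y ∙ z ∙ x    ∎

  commutes-resp : ∀ {x x′ y y′} → x ≈ x′ → y ≈ y′ → Commutes x y → Commutes x′ y′
  commutes-resp p q r = trans (sym (∙-cong p q)) (trans r (∙-cong q p))

  commutes-gpow : ∀ {x y} n → Commutes x y → Commutes x (gpow G y n)
  commutes-gpow zero    p = trans (identityʳ _) (sym (identityˡ _))
  commutes-gpow (suc n) p = commutes-∙ p (commutes-gpow n p)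

  commutes-^ : ∀ {x y} k → Commutes x y → Commutes x (y ^ k)
  commutes-^ (+ n)    p = commutes-gpow n p
  commutes-^ -[1+ n ] p = commutes-inverseʳ (commutes-gpow (suc n) p)

  commutes-^^ : ∀ x i j → Commutes (x ^ i) (x ^ j)
  commutes-^^ x i j = commutes-^ j (sym (commutes-^ i refl))

  ^-suc : ∀ x k → x ^ (ℤ.suc k) ≈ x ∙ x ^ k
  ^-suc x (+ n)          = refl
  ^-suc x -[1+ zero ]    = free (x ∷ []) 𝟏 (‵ 0 · (‵ 0 · 𝟏) ⁻) ≡.refl
  ^-suc x -[1+ suc n ]   = begin
    y ⁻¹                ≈⟨ free (x ∷ y ∷ []) (‵ 1 ⁻) (‵ 0 · (‵ 1 · ‵ 0) ⁻) ≡.refl ⟩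
    x ∙ (y ∙ x) ⁻¹      ≈⟨ ∙-congˡ (⁻¹-cong (commutes-gpow (suc n) refl)) ⟨
    x ∙ (x ∙ y) ⁻¹      ∎
    where y = gpow G x (suc n)

  ^-homo-+ℕ : ∀ x m k → x ^ (+ m ℤ.+ k) ≈ gpow G x m ∙ x ^ k
  ^-homo-+ℕ x zero    k = trans (^-≡ x (ℤ.+-identityˡ k)) (sym (identityˡ _))
  ^-homo-+ℕ x (suc m) k = begin
    x ^ (+ suc m ℤ.+ k)          ≈⟨ ^-≡ x (ℤ.suc-+ m k) ⟩
    x ^ ℤ.suc (+ m ℤ.+ k)        ≈⟨ ^-suc x (+ m ℤ.+ k) ⟩
    x ∙ x ^ (+ m ℤ.+ k)          ≈⟨ ∙-congˡ (^-homo-+ℕ x m k) ⟩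
    x ∙ (gpow G x m ∙ x ^ k)     ≈⟨ assoc _ _ _ ⟨
    x ∙ gpow G x m ∙ x ^ k       ∎

  ^-homo-+ : ∀ x i j → x ^ (i ℤ.+ j) ≈ x ^ i ∙ x ^ j
  ^-homo-+ x (+ m)    j = ^-homo-+ℕ x m j
  ^-homo-+ x -[1+ m ] j = y≈x\\z _ _ _ (begin
    gpow G x (suc m) ∙ x ^ (-[1+ m ] ℤ.+ j)   ≈⟨ ^-homo-+ℕ x (suc m) (-[1+ m ] ℤ.+ j) ⟨
    x ^ (+ suc m ℤ.+ (-[1+ m ] ℤ.+ j))        ≈⟨ ^-≡ x (≡.sym (ℤ.+-assoc (+ suc m) -[1+ m ] j)) ⟩
    x ^ (+ suc m ℤ.+ -[1+ m ] ℤ.+ j)          ≈⟨ ^-≡ x (≡.cong (ℤ._+ j) (ℤ.+-inverseʳ (+ suc m))) ⟩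
    x ^ (+ 0 ℤ.+ j)                           ≈⟨ ^-≡ x (ℤ.+-identityˡ j) ⟩
    x ^ j                                     ∎)

  ^-neg : ∀ x i → x ^ (ℤ.- i) ≈ (x ^ i) ⁻¹
  ^-neg x i = inverseˡ-unique _ _ (trans (sym (^-homo-+ x (ℤ.- i) i)) (^-≡ x (ℤ.+-inverseˡ i)))

  ^-homo-*ℕ : ∀ x i n → gpow G (x ^ i) n ≈ x ^ (i ℤ.* + n)
  ^-homo-*ℕ x i zero    = ^-≡ x (≡.sym (ℤ.*-zeroʳ i))
  ^-homo-*ℕ x i (suc n) = begin
    x ^ i ∙ gpow G (x ^ i) n      ≈⟨ ∙-congˡ (^-homo-*ℕ x i n) ⟩
    x ^ i ∙ x ^ (i ℤ.* + n)       ≈⟨ ^-homo-+ x i _ ⟨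
    x ^ (i ℤ.+ i ℤ.* + n)         ≈⟨ ^-≡ x (≡.sym (ℤ.*-suc i (+ n))) ⟩
    x ^ (i ℤ.* + suc n)           ∎

  ^-homo-* : ∀ x i j → (x ^ i) ^ j ≈ x ^ (i ℤ.* j)
  ^-homo-* x i (+ n)    = ^-homo-*ℕ x i n
  ^-homo-* x i -[1+ n ] = begin
    gpow G (x ^ i) (suc n) ⁻¹     ≈⟨ ⁻¹-cong (^-homo-*ℕ x i (suc n)) ⟩
    (x ^ (i ℤ.* + suc n)) ⁻¹      ≈⟨ ^-neg x (i ℤ.* + suc n) ⟨
    x ^ (ℤ.- (i ℤ.* + suc n))     ≈⟨ ^-≡ x (ℤ.neg-distribʳ-* i (+ suc n)) ⟩
    x ^ (i ℤ.* -[1+ n ])          ∎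

  ε^ : ∀ k → ε ^ k ≈ ε
  ε^ k = trans (^-homo-* ε (+ 0) k) (^-≡ ε (ℤ.*-zeroˡ k))

  conj : Carrier → Carrier → Carrier
  conj g x = g ∙ x ∙ g ⁻¹

  conj-cong : ∀ {g g′ x x′} → g ≈ g′ → x ≈ x′ → conj g x ≈ conj g′ x′
  conj-cong p q = ∙-cong (∙-cong p q) (⁻¹-cong p)

  conj-∙ : ∀ g x y → conj g (x ∙ y) ≈ conj g x ∙ conj g y
  conj-∙ g x y = free (g ∷ x ∷ y ∷ []) (‵ 0 · (‵ 1 · ‵ 2) · ‵ 0 ⁻)
                      (‵ 0 · ‵ 1 · ‵ 0 ⁻ · (‵ 0 · ‵ 2 · ‵ 0 ⁻)) ≡.refl

  conj-⁻¹ : ∀ g x → conj g (x ⁻¹) ≈ conj g x ⁻¹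
  conj-⁻¹ g x = free (g ∷ x ∷ []) (‵ 0 · ‵ 1 ⁻ · ‵ 0 ⁻) ((‵ 0 · ‵ 1 · ‵ 0 ⁻) ⁻) ≡.refl

  conj-ε : ∀ g → conj g ε ≈ ε
  conj-ε g = free (g ∷ []) (‵ 0 · 𝟏 · ‵ 0 ⁻) 𝟏 ≡.refl

  conj-gpow : ∀ g x n → conj g (gpow G x n) ≈ gpow G (conj g x) n
  conj-gpow g x zero    = conj-ε g
  conj-gpow g x (suc n) = trans (conj-∙ g x _) (∙-congˡ (conj-gpow g x n))

  conj-^ : ∀ g x k → conj g (x ^ k) ≈ conj g x ^ k
  conj-^ g x (+ n)    = conj-gpow g x n
  conj-^ g x -[1+ n ] = trans (conj-⁻¹ g _) (⁻¹-cong (conj-gpow g x (suc n)))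

  commutes⇒conj : ∀ {g x} → Commutes g x → conj g x ≈ x
  commutes⇒conj {g} {x} p = trans (∙-congʳ p) (//-rightDividesʳ g x)

  conj⇒commutes : ∀ {g x y} → conj g x ≈ y → g ∙ x ≈ y ∙ g
  conj⇒commutes {g} {x} {y} p = trans (sym (//-rightDividesˡ g (g ∙ x))) (∙-congʳ p)

-- Subgroups, and extensions by one element at a time

module Subgroups {c ℓ : Level} (G : Group c ℓ) where
  open Group G
  open GroupProperties G
  open SetoidReasoning setoid
  open Rewriting G
  open Powers G

  record IsSubgroup (P : Carrier → Set ℓ) : Set (c ⊔ ℓ) where
    field
      resp : ∀ {x y} → x ≈ y → P x → P y
      ε∈   : P ε
      ∙∈   : ∀ {x y} → P x → P y → P (x ∙ y)
      ⁻¹∈  : ∀ {x} → P x → P (x ⁻¹)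

    gpow∈ : ∀ {x} n → P x → P (gpow G x n)
    gpow∈ zero    p = ε∈
    gpow∈ (suc n) p = ∙∈ p (gpow∈ n p)

    ^∈ : ∀ {x} k → P x → P (x ^ k)
    ^∈ (+ n)    p = gpow∈ n p
    ^∈ -[1+ n ] p = ⁻¹∈ (gpow∈ (suc n) p)

    conj∈ : ∀ {x y} → P x → P y → P (conj x y)
    conj∈ p q = ∙∈ (∙∈ p q) (⁻¹∈ p)

  Extend : (Carrier → Set ℓ) → Carrier → Carrier → Set ℓ
  Extend P g x = P x ⊎ P (x ∙ g ⁻¹)

  -- Closure under conjugation by `g` alone is enough: since `g²` lies in `P`, conjugation by `g⁻¹`
  -- also preserves `P` (`normal⁻¹`). The element `g` may already lie in `P`, so a chain of such
  -- extensions bounds an order from above only.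
  record Extends (P : Carrier → Set ℓ) (g : Carrier) : Set (c ⊔ ℓ) where
    constructor extends
    field
      square : P (g ∙ g)
      normal : ∀ {x} → P x → P (conj g x)

  module _ {P : Carrier → Set ℓ} (isSubgroup : IsSubgroup P) where
    open IsSubgroup isSubgroup

    self∈Extend : ∀ g → Extend P g g
    self∈Extend g = inj₂ (resp (sym (inverseʳ g)) ε∈)

    module _ {g : Carrier} (ext : Extends P g) where
      open Extends ext

      normal⁻¹ : ∀ {x} → P x → P (g ⁻¹ ∙ x ∙ g)
      normal⁻¹ {x} p = resp
        (free (g ∷ x ∷ []) ((‵ 0 · ‵ 0) ⁻ · (‵ 0 · ‵ 1 · ‵ 0 ⁻) · (‵ 0 · ‵ 0)) (‵ 0 ⁻ · ‵ 1 · ‵ 0) ≡.refl)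
        (∙∈ (∙∈ (⁻¹∈ square) (normal p)) square)

      private
        ∙∈′ : ∀ {x y} → Extend P g x → Extend P g y → Extend P g (x ∙ y)
        ∙∈′ (inj₁ p) (inj₁ q) = inj₁ (∙∈ p q)
        ∙∈′ (inj₁ p) (inj₂ q) = inj₂ (resp (sym (assoc _ _ _)) (∙∈ p q))
        ∙∈′ {x} {y} (inj₂ p) (inj₁ q) = inj₂ (resp
          (free (g ∷ x ∷ y ∷ []) (‵ 1 · ‵ 0 ⁻ · (‵ 0 · ‵ 2 · ‵ 0 ⁻)) (‵ 1 · ‵ 2 · ‵ 0 ⁻) ≡.refl)
          (∙∈ p (normal q)))
        ∙∈′ {x} {y} (inj₂ p) (inj₂ q) = inj₁ (resp
          (free (g ∷ x ∷ y ∷ []) (‵ 1 · ‵ 0 ⁻ · (‵ 0 · (‵ 2 · ‵ 0 ⁻) · ‵ 0 ⁻) · (‵ 0 · ‵ 0)) (‵ 1 · ‵ 2) ≡.refl)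
          (∙∈ (∙∈ p (normal q)) square))

        ⁻¹∈′ : ∀ {x} → Extend P g x → Extend P g (x ⁻¹)
        ⁻¹∈′ (inj₁ p) = inj₁ (⁻¹∈ p)
        ⁻¹∈′ {x} (inj₂ p) = inj₂ (resp
          (free (g ∷ x ∷ []) ((‵ 0 · ‵ 0) ⁻ · (‵ 0 · (‵ 1 · ‵ 0 ⁻) ⁻ · ‵ 0 ⁻)) (‵ 1 ⁻ · ‵ 0 ⁻) ≡.refl)
          (∙∈ (⁻¹∈ square) (normal (⁻¹∈ p))))

      Extend-isSubgroup : IsSubgroup (Extend P g)
      Extend-isSubgroup = record
        { resp = λ eq → [ inj₁ ∘ resp eq , inj₂ ∘ resp (∙-congʳ eq) ]′
        ; ε∈   = inj₁ ε∈
        ; ∙∈   = ∙∈′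
        ; ⁻¹∈  = ⁻¹∈′
        }

      Extend-square : ∀ {x} → Extend P g x → P (x ∙ x)
      Extend-square (inj₁ p) = ∙∈ p p
      Extend-square {x} (inj₂ p) = resp
          (free (g ∷ x ∷ []) (‵ 1 · ‵ 0 ⁻ · (‵ 0 · (‵ 1 · ‵ 0 ⁻) · ‵ 0 ⁻) · (‵ 0 · ‵ 0)) (‵ 1 · ‵ 1) ≡.refl)
          (∙∈ (∙∈ p (normal p)) square)

      Extend-normal : ∀ {x y} → Extend P g x → P y → P (conj x y)
      Extend-normal (inj₁ p) q = conj∈ p q
      Extend-normal {x} {y} (inj₂ p) q = resp
        (free (g ∷ x ∷ y ∷ []) (‵ 1 · ‵ 0 ⁻ · (‵ 0 · ‵ 2 · ‵ 0 ⁻) · (‵ 1 · ‵ 0 ⁻) ⁻) (‵ 1 · ‵ 2 · ‵ 1 ⁻) ≡.refl)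
        (conj∈ p (normal q))

      Extend-index2 : ∀ {x y} → Extend P g x → Extend P g y → ¬ P x → P y ⊎ P (y ∙ x ⁻¹)
      Extend-index2 (inj₁ p) _        ¬p = contradiction p ¬p
      Extend-index2 (inj₂ p) (inj₁ q) ¬p = inj₁ q
      Extend-index2 {x} {y} (inj₂ p) (inj₂ q) ¬p = inj₂ (resp
        (free (g ∷ x ∷ y ∷ []) (‵ 2 · ‵ 0 ⁻ · (‵ 1 · ‵ 0 ⁻) ⁻) (‵ 2 · ‵ 1 ⁻) ≡.refl) (∙∈ q (⁻¹∈ p)))

  Trivial : Carrier → Set ℓ
  Trivial x = x ≈ ε

  Trivial-isSubgroup : IsSubgroup Trivial
  Trivial-isSubgroup = record
    { resp = λ eq p → trans (sym eq) p
    ; ε∈   = refl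
    ; ∙∈   = λ p q → trans (∙-cong p q) (identityˡ ε)
    ; ⁻¹∈  = λ p → trans (⁻¹-cong p) ε⁻¹≈ε
    }

  Cyclic : Carrier → Carrier → Set ℓ
  Cyclic t x = ∃ λ k → x ≈ t ^ k

  Cyclic-isSubgroup : ∀ t → IsSubgroup (Cyclic t)
  Cyclic-isSubgroup t = record
    { resp = λ eq (k , p) → k , trans (sym eq) p
    ; ε∈   = + 0 , refl
    ; ∙∈   = λ (i , p) (j , q) → i ℤ.+ j , trans (∙-cong p q) (sym (^-homo-+ t i j))
    ; ⁻¹∈  = λ (i , p) → ℤ.- i , trans (⁻¹-cong p) (sym (^-neg t i))
    }

  -- The subset B ⟨g₁⟩ ⋯ ⟨gₖ⟩ for the list gₖ ∷ ⋯ ∷ g₁ ∷ [], taking each gᵢ to the power 0 or 1.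
  In : (Carrier → Set ℓ) → List Carrier → Carrier → Set ℓ
  In B = foldr (λ g P → Extend P g) B

  data Chain (B : Carrier → Set ℓ) : List Carrier → Set (c ⊔ ℓ) where
    []  : Chain B []
    _∷_ : ∀ {g gs} → Extends (In B gs) g → Chain B gs → Chain B (g ∷ gs)

  In-isSubgroup : ∀ {B gs} → IsSubgroup B → Chain B gs → IsSubgroup (In B gs)
  In-isSubgroup sub []           = sub
  In-isSubgroup sub (ext ∷ exts) = Extend-isSubgroup (In-isSubgroup sub exts) ext

  module _ {P : Carrier → Set ℓ} (isSubgroup : IsSubgroup P) where
    open IsSubgroup isSubgroup

    Cyclic-conj : ∀ {t g} → P (conj g t) → ∀ {x} → Cyclic t x → P (conj g x)
    Cyclic-conj {t} {g} p (k , eq) =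
      resp (trans (sym (conj-^ g t k)) (conj-cong refl (sym eq))) (^∈ k p)

    In-conj : ∀ {B gs g} → (∀ {x} → B x → P (conj g x)) → All (P ∘ conj g) gs →
              ∀ {x} → In B gs x → P (conj g x)
    In-conj base []       p        = base p
    In-conj base (_ ∷ ps) (inj₁ q) = In-conj base ps q
    In-conj {g = g} base (p ∷ ps) {x} (inj₂ q) = resp
      (trans (sym (conj-∙ g _ _)) (conj-cong refl (//-rightDividesˡ _ x))) (∙∈ (In-conj base ps q) p)

  Index : ℕ → ℕ → Set
  Index q zero    = Fin q
  Index q (suc n) = Index q n ⊎ Index q n

  enumerate : ∀ q t gs → Index q (length gs) → Carrier
  enumerate q t []       i        = gpow G t (Fin.toℕ i)
  enumerate q t (g ∷ gs) (inj₁ i) = enumerate q t gs i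
  enumerate q t (g ∷ gs) (inj₂ i) = enumerate q t gs i ∙ g

  enumerate-surjective : ∀ q .{{_ : ℕ.NonZero q}} t gs → gpow G t q ≈ ε →
    ∀ {x} → In (Cyclic t) gs x → ∃ λ i → enumerate q t gs i ≈ x
  enumerate-surjective q t [] t^q≈ε {x} (k , p) = Fin.fromℕ< k%q<q , (begin
    gpow G t (Fin.toℕ (Fin.fromℕ< k%q<q))  ≡⟨ ≡.cong (gpow G t) (Fin.toℕ-fromℕ< k%q<q) ⟩
    t ^ (+ r)                              ≈⟨ identityʳ _ ⟨
    t ^ (+ r) ∙ ε                          ≈⟨ ∙-congˡ (trans (^-cong (k ℤ./ + q) t^q≈ε) (ε^ (k ℤ./ + q))) ⟨
    t ^ (+ r) ∙ (t ^ (+ q)) ^ (k ℤ./ + q)  ≈⟨ ∙-congˡ (^-homo-* t (+ q) (k ℤ./ + q)) ⟩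
    t ^ (+ r) ∙ t ^ (+ q ℤ.* (k ℤ./ + q))  ≈⟨ ^-homo-+ t (+ r) (+ q ℤ.* (k ℤ./ + q)) ⟨
    t ^ (+ r ℤ.+ + q ℤ.* (k ℤ./ + q))      ≈⟨ ^-≡ t (≡.trans (≡.cong (ℤ._+_ (+ r)) (ℤ.*-comm (+ q)
            (k ℤ./ + q))) (≡.sym (ℤ.a≡a%n+[a/n]*n k (+ q)))) ⟩
    t ^ k                                  ≈⟨ p ⟨
    x                                      ∎)
    where
    r = k ℤ.% + q
    k%q<q : r ℕ.< q
    k%q<q = ℤ.n%d<d k (+ q)
  enumerate-surjective q t (g ∷ gs) eq (inj₁ p) =
    let i , e = enumerate-surjective q t gs eq p in inj₁ i , e
  enumerate-surjective q t (g ∷ gs) eq (inj₂ p) =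
    let i , e = enumerate-surjective q t gs eq p in inj₂ i , trans (∙-congʳ e) (//-rightDividesˡ g _)

  Index-size : ∀ q n → Index q n ↔ Fin (2 ℕ.^ n ℕ.* q)
  Index-size q zero    = ≡.subst (λ m → Fin q ↔ Fin m) (≡.sym (ℕ.*-identityˡ q)) (↔-refl)
  Index-size q (suc n) = ≡.subst (λ m → Index q (suc n) ↔ Fin m) double
    (↔-trans (Index-size q n ⊎-↔ Index-size q n) (↔-sym Fin.+↔⊎))
    where
    double : 2 ℕ.^ n ℕ.* q ℕ.+ 2 ℕ.^ n ℕ.* q ≡ 2 ℕ.^ suc n ℕ.* q
    double = ≡.trans (≡.sym (ℕ.*-distribʳ-+ q (2 ℕ.^ n) (2 ℕ.^ n)))
               (≡.cong (λ m → (2 ℕ.^ n ℕ.+ m) ℕ.* q) (≡.sym (ℕ.+-identityʳ (2 ℕ.^ n))))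

-- Counting in finite sets

injection⇒surjection : ∀ {n} (s : Fin n → Fin n) → (∀ {i j} → s i ≡ s j → i ≡ j) → ∀ x → ∃ λ i → s i ≡ x
injection⇒surjection {suc n} s inj x with Fin.any? (λ i → s i Fin.≟ x)
... | yes p = p
-- A missed value can be punched out, which would leave an injection into a smaller finite set.
... | no ¬p = contradiction (Fin.injective⇒≤ {f = λ i → Fin.punchOut (x≢s i)}
                              (λ {i} {j} eq → inj (Fin.punchOut-injective (x≢s i) (x≢s j) eq))) ℕ.1+n≰n
  where
  x≢s : ∀ i → x ≢ s i
  x≢s i eq = ¬p (i , ≡.sym eq)

module _ {c ℓ : Level} (G : Group c ℓ) where
  open Group G

  -- Choosing an `f`-preimage for each element of an exact enumeration gives an injection of `Fin n`
  -- into itself. It is a bijection, so every index is a chosen one, and `f` separates the chosen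
  -- ones.
  card-surjective⇒injective : ∀ {n} → HasCard G n → (f : Fin n → Carrier) → (∀ g → ∃ λ i → f i ≈ g) →
                              ∀ i j → f i ≈ f j → i ≡ j
  card-surjective⇒injective {n} (e , e-inj , e-surj) f f-surj i j fi≈fj
    with injection⇒surjection s s-inj i | injection⇒surjection s s-inj j
    where
    s : Fin n → Fin n
    s k = proj₁ (f-surj (e k))
    s-inj : ∀ {k l} → s k ≡ s l → k ≡ l
    s-inj {k} {l} eq = e-inj k l (trans (sym (proj₂ (f-surj (e k))))
                         (trans (reflexive (≡.cong f eq)) (proj₂ (f-surj (e l)))))
  ... | k , ≡.refl | l , ≡.refl =
    ≡.cong (λ m → proj₁ (f-surj (e m))) (e-inj k l (trans (sym (proj₂ (f-surj (e k))))
      (trans fi≈fj (proj₂ (f-surj (e l))))))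

data Distinct {a r : Level} {A : Set a} (R : A → A → Set r) : List A → Set (a ⊔ r) where
  []  : Distinct R []
  _∷_ : ∀ {x xs} → ¬ Any (R x) xs → Distinct R xs → Distinct R (x ∷ xs)

data Pick {a : Level} {A : Set a} (y : A) : List A → List A → Set a where
  here  : ∀ {xs} → Pick y (y ∷ xs) xs
  there : ∀ {x xs ys} → Pick y xs ys → Pick y (x ∷ xs) (x ∷ ys)

-- Counting orbits of involutions and normalisers in finite 2-groups

module Involutions {a r : Level} (S : DecSetoid a r) where
  open DecSetoid S renaming (Carrier to A; _≈_ to _~_; _≟_ to _~?_; refl to ~-refl; sym to ~-sym; trans to ~-trans)

  _∈~_ : A → List A → Set (a ⊔ r)
  x ∈~ xs = Any (x ~_) xs

  ∈~-resp : ∀ {x y xs} → x ~ y → x ∈~ xs → y ∈~ xs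
  ∈~-resp p = Any.map (~-trans (~-sym p))

  pick : ∀ {x xs} → x ∈~ xs → ∃ λ y → ∃ λ ys → x ~ y × Pick y xs ys
  pick (here p)  = _ , _ , p , here
  pick (there m) = let y , ys , p , k = pick m in y , _ , p , there k

  pick-split : ∀ {x y xs ys} → Pick y xs ys → x ∈~ xs → x ~ y ⊎ x ∈~ ys
  pick-split here      (here p)  = inj₁ p
  pick-split here      (there m) = inj₂ m
  pick-split (there k) (here p)  = inj₂ (here p)
  pick-split (there k) (there m) = [ inj₁ , inj₂ ∘ there ]′ (pick-split k m)

  pick-rest : ∀ {x y xs ys} → Pick y xs ys → x ∈~ ys → x ∈~ xs
  pick-rest here      m         = there m
  pick-rest (there k) (here p)  = here p
  pick-rest (there k) (there m) = there (pick-rest k m)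

  pick-∈ : ∀ {y xs ys} → Pick y xs ys → y ∈~ xs
  pick-∈ here      = here ~-refl
  pick-∈ (there k) = there (pick-∈ k)

  pick-length : ∀ {y : A} {xs ys} → Pick y xs ys → length xs ≡ suc (length ys)
  pick-length here      = ≡.refl
  pick-length (there k) = ≡.cong suc (pick-length k)

  pick-distinct : ∀ {y xs ys} → Pick y xs ys → Distinct _~_ xs → Distinct _~_ ys × ¬ y ∈~ ys
  pick-distinct here      (n ∷ d) = d , n
  pick-distinct (there k) (n ∷ d) with pick-distinct k d
  ... | d′ , n′ = (n ∘ pick-rest k) ∷ d′ , λ { (here p) → n (∈~-resp p (pick-∈ k)) ; (there m) → n′ m }

  -- The conditions are restricted to the list because inversion is compatible with the cosets `xP`
  -- only for `x` in the normaliser of `P`.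
  record InvolutiveOn (f : A → A) (xs : List A) : Set (a ⊔ r) where
    field
      closed : ∀ {x} → x ∈~ xs → f x ∈~ xs
      resp   : ∀ {x y} → x ∈~ xs → x ~ y → f x ~ f y
      invol  : ∀ {x} → x ∈~ xs → f (f x) ~ x

  SameOrbit : (A → A) → A → A → Set r
  SameOrbit f x y = x ~ y ⊎ x ~ f y

  record Orbits (f : A → A) (xs : List A) : Set (a ⊔ r) where
    field
      fixed reps     : List A
      count          : length xs ≡ length fixed ℕ.+ 2 ℕ.* length reps
      fixed-distinct : Distinct _~_ fixed
      fixed⁺         : ∀ {x} → x ∈~ xs → f x ~ x → x ∈~ fixed
      fixed⁻         : ∀ {x} → x ∈~ fixed → x ∈~ xs × f x ~ x
      reps-distinct  : Distinct (SameOrbit f) reps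
      reps⁺          : ∀ {x} → x ∈~ xs → f x ~ x ⊎ Any (SameOrbit f x) reps
      reps⁻          : ∀ {x} → x ∈~ reps → x ∈~ xs

  module _ (f : A → A) where

    abstract
      -- An element leaves the list together with its partner, which may sit anywhere in the tail;
      -- the bound `n` makes this recursion structural.
      orbits : ∀ n xs → length xs ℕ.≤ n → Distinct _~_ xs → InvolutiveOn f xs → Orbits f xs
      orbits n       []       _            _       _   = record
        { fixed = [] ; reps = [] ; count = ≡.refl ; fixed-distinct = [] ; fixed⁺ = λ () ; fixed⁻ = λ ()
        ; reps-distinct = [] ; reps⁺ = λ () ; reps⁻ = λ () }
      orbits (suc n) (x ∷ xs) (ℕ.s≤s xs≤n) (x∉xs ∷ d) inv with f x ~? x
      ... | yes fx~x = record
        { fixed          = x ∷ fixed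
        ; reps           = reps
        ; count          = ≡.cong suc count
        ; fixed-distinct = (x∉xs ∘ proj₁ ∘ fixed⁻) ∷ fixed-distinct
        ; fixed⁺         = λ { (here p) _ → here p ; (there m) q → there (fixed⁺ m q) }
        ; fixed⁻         = λ { (here p)  → here p , ~-trans (resp (here p) p) (~-trans fx~x (~-sym p))
                             ; (there m) → let m′ , q = fixed⁻ m in there m′ , q }
        ; reps-distinct  = reps-distinct
        ; reps⁺          = λ { (here p)  → inj₁ (~-trans (resp (here p) p) (~-trans fx~x (~-sym p)))
                             ; (there m) → reps⁺ m }
        ; reps⁻          = there ∘ reps⁻
        }
        where
        open InvolutiveOn inv
        closed′ : ∀ {y} → y ∈~ xs → f y ∈~ xs
        closed′ {y} m with closed (there m)
        ... | there m′ = m′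
        ... | here p   = contradiction
          (∈~-resp (~-trans (~-sym (invol (there m))) (~-trans (resp (closed (there m)) p) fx~x)) m) x∉xs
        inv′ : InvolutiveOn f xs
        inv′ = record { closed = closed′ ; resp = resp ∘ there ; invol = invol ∘ there }
        open Orbits (orbits n xs xs≤n d inv′)
      ... | no fx≁x with InvolutiveOn.closed inv (here ~-refl)
      ...   | here p   = contradiction p fx≁x
      ...   | there m₀ with pick m₀
      ...     | y , ys , fx~y , k = record
        { fixed          = fixed
        ; reps           = x ∷ reps
        ; count          = ≡.trans (≡.cong suc (≡.trans (pick-length k) (≡.cong suc count)))
                             (arith (length fixed) (length reps))
        ; fixed-distinct = fixed-distinct
        ; fixed⁺         = λ { (here p) q → contradiction (~-trans (~-sym (resp (here p) p)) (~-trans q p)) fx≁x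
                             ; (there m) q → fixed⁺′ m q }
        ; fixed⁻         = λ m → let m′ , q = fixed⁻ m in there (pick-rest k m′) , q
        ; reps-distinct  = x∉reps ∷ reps-distinct
        ; reps⁺          = λ { (here p) → inj₂ (here (inj₁ p)) ; (there m) → reps⁺′ m }
        ; reps⁻          = λ { (here p) → here p ; (there m) → there (pick-rest k (reps⁻ m)) }
        }
        where
        open InvolutiveOn inv
        arith : ∀ u v → suc (suc (u ℕ.+ 2 ℕ.* v)) ≡ u ℕ.+ 2 ℕ.* suc v
        arith = ℕ-solve-∀
        d′ : Distinct _~_ ys × ¬ y ∈~ ys
        d′ = pick-distinct k d
        fy~x : f y ~ x
        fy~x = ~-trans (~-sym (resp (closed (here ~-refl)) fx~y)) (invol (here ~-refl))
        x∉ys : ¬ x ∈~ ys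
        x∉ys = x∉xs ∘ pick-rest k
        closed′ : ∀ {v} → v ∈~ ys → f v ∈~ ys
        closed′ {v} m with closed (there (pick-rest k m))
        ... | here p = contradiction
          (∈~-resp (~-trans (~-sym (invol (there (pick-rest k m)))) (~-trans (resp (closed (there
                  (pick-rest k m))) p) fx~y)) m)
          (proj₂ d′)
        ... | there m′ with pick-split k m′
        ...   | inj₁ p  = contradiction
          (∈~-resp (~-trans (~-sym (invol (there (pick-rest k m)))) (~-trans (resp (closed (there
                  (pick-rest k m))) p) fy~x)) m)
          x∉ys
        ...   | inj₂ m″ = m″
        inv′ : InvolutiveOn f ys
        inv′ = record
          { closed = closed′ ; resp = resp ∘ there ∘ pick-rest k ; invol = invol ∘ there ∘ pick-rest k }
        ys≤n : length ys ℕ.≤ n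
        ys≤n = ℕ.≤-trans (ℕ.n≤1+n _) (≡.subst (ℕ._≤ n) (pick-length k) xs≤n)
        open Orbits (orbits n ys ys≤n (proj₁ d′) inv′)
        fixed⁺′ : ∀ {v} → v ∈~ xs → f v ~ v → v ∈~ fixed
        fixed⁺′ m q with pick-split k m
        ... | inj₂ m′ = fixed⁺ m′ q
        ... | inj₁ p  = contradiction
          (~-trans fx~y (~-trans (~-sym p) (~-trans (~-sym q) (~-trans (resp (there m) p) fy~x)))) fx≁x
        reps⁺′ : ∀ {v} → v ∈~ xs → f v ~ v ⊎ Any (SameOrbit f v) (x ∷ reps)
        reps⁺′ m with pick-split k m
        ... | inj₁ p  = inj₂ (here (inj₂ (~-trans p (~-sym fx~y))))
        ... | inj₂ m′ = [ inj₁ , inj₂ ∘ there ]′ (reps⁺ m′)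
        x∉ : ∀ {v} → v ∈~ ys → ¬ SameOrbit f x v
        x∉ m (inj₁ p) = x∉ys (∈~-resp (~-sym p) m)
        x∉ m (inj₂ p) = x∉ys (∈~-resp (~-sym p) (closed′ m))
        x∉reps : ¬ Any (SameOrbit f x) reps
        x∉reps m = go m reps⁻
          where
          go : ∀ {zs} → Any (SameOrbit f x) zs → (∀ {v} → v ∈~ zs → v ∈~ ys) → ⊥
          go (here p)  sub = x∉ (sub (here ~-refl)) p
          go (there m) sub = go m (sub ∘ there)

module TwoGroups {c ℓ : Level} (G : Group c ℓ) {N : ℕ} (card : HasCard G N) where
  open Group G
  open GroupProperties G
  open SetoidReasoning setoid
  open Rewriting G
  open Powers G
  open Subgroups G

  index : Carrier → Fin N
  index x = proj₁ (proj₂ (proj₂ card) x)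

  index-cong : ∀ {x y} → x ≈ y → index x ≡ index y
  index-cong {x} {y} p = proj₁ (proj₂ card) _ _
    (trans (proj₂ (proj₂ (proj₂ card) x)) (trans p (sym (proj₂ (proj₂ (proj₂ card) y)))))

  index-injective : ∀ {x y} → index x ≡ index y → x ≈ y
  index-injective {x} {y} eq = trans (sym (proj₂ (proj₂ (proj₂ card) x)))
    (trans (reflexive (≡.cong (proj₁ card) eq)) (proj₂ (proj₂ (proj₂ card) y)))

  _≈?_ : ∀ x y → Dec (x ≈ y)
  x ≈? y = map′ index-injective index-cong (index x Fin.≟ index y)

  finite-order : ∀ x → ∃ λ k → gpow G x (suc k) ≈ ε
  finite-order x with Fin.pigeonhole (ℕ.n<1+n N) (λ i → index (gpow G x (Fin.toℕ i)))
  ... | i , j , i<j , eq = k , ∙-cancelˡ (x ^ (+ Fin.toℕ i)) _ _ (begin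
    x ^ (+ Fin.toℕ i) ∙ x ^ (+ suc k)      ≈⟨ ^-homo-+ x (+ Fin.toℕ i) (+ suc k) ⟨
    x ^ (+ (Fin.toℕ i ℕ.+ suc k))          ≡⟨ ≡.cong (gpow G x) (≡.trans (ℕ.+-suc (Fin.toℕ i) k)
            (ℕ.m+[n∸m]≡n i<j)) ⟩
    x ^ (+ Fin.toℕ j)                      ≈⟨ index-injective eq ⟨
    x ^ (+ Fin.toℕ i)                      ≈⟨ identityʳ _ ⟨
    x ^ (+ Fin.toℕ i) ∙ ε                  ∎)
    where k = Fin.toℕ j ℕ.∸ suc (Fin.toℕ i)

  module _ {P : Carrier → Set ℓ} (isSubgroup : IsSubgroup P) where
    open IsSubgroup isSubgroup

    private
      conj-iterate : ∀ {y} → (∀ {h} → P h → P (conj y h)) → ∀ n {h} → P h → P (conj (gpow G y n) h)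
      conj-iterate {y} cl zero    {h} p = resp (free (h ∷ []) (‵ 0) (𝟏 · ‵ 0 · 𝟏 ⁻) ≡.refl) p
      conj-iterate {y} cl (suc n) {h} p = resp
        (free (y ∷ h ∷ gpow G y n ∷ []) (‵ 0 · (‵ 2 · ‵ 1 · ‵ 2 ⁻) · ‵ 0 ⁻) (‵ 0 · ‵ 2 · ‵ 1 ·
                (‵ 0 · ‵ 2) ⁻) ≡.refl)
        (cl (conj-iterate cl n p))

    -- In a finite group `y⁻¹` is a nonnegative power of `y`.
    conj-inverse : ∀ {y} → (∀ {h} → P h → P (conj y h)) → ∀ {h} → P h → P (conj (y ⁻¹) h)
    conj-inverse {y} cl p with finite-order y
    ... | k , eq = resp (conj-cong (inverseʳ-unique y (gpow G y k) eq) refl) (conj-iterate cl k p)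

  -- The chain starts at the trivial subgroup, which makes membership decidable, and each step is
  -- proper, which makes the order exactly a power of 2.
  data Strict : List Carrier → Set (c ⊔ ℓ) where
    []  : Strict []
    _∷_ : ∀ {g gs} → Extends (In Trivial gs) g × ¬ In Trivial gs g → Strict gs → Strict (g ∷ gs)

  chain : ∀ {gs} → Strict gs → Chain Trivial gs
  chain []             = []
  chain ((ext , _) ∷ s) = ext ∷ chain s

  strict-isSubgroup : ∀ {gs} → Strict gs → IsSubgroup (In Trivial gs)
  strict-isSubgroup s = In-isSubgroup Trivial-isSubgroup (chain s)

  In? : ∀ gs x → Dec (In Trivial gs x)
  In? []       x = x ≈? ε
  In? (g ∷ gs) x = In? gs x ⊎-dec In? gs (x ∙ g ⁻¹)

  cosets : ∀ {gs} → Strict gs → DecSetoid c ℓ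
  cosets {gs} s = record
    { Carrier = Carrier
    ; _≈_ = λ x y → In Trivial gs (x ⁻¹ ∙ y)
    ; isDecEquivalence = record
      { isEquivalence = record
        { refl  = λ {x} → resp (sym (inverseˡ x)) ε∈
        ; sym   = λ {x} {y} p → resp (free (x ∷ y ∷ []) ((‵ 0 ⁻ · ‵ 1) ⁻) (‵ 1 ⁻ · ‵ 0) ≡.refl) (⁻¹∈ p)
        ; trans = λ {x} {y} {z} p q → resp
            (free (x ∷ y ∷ z ∷ []) ((‵ 0 ⁻ · ‵ 1) · (‵ 1 ⁻ · ‵ 2)) (‵ 0 ⁻ · ‵ 2) ≡.refl) (∙∈ p q)
        }
      ; _≟_ = λ x y → In? gs (x ⁻¹ ∙ y)
      }
    }
    where open IsSubgroup (strict-isSubgroup s)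

  record Transversal {gs : List Carrier} (s : Strict gs) : Set (c ⊔ ℓ) where
    open Involutions (cosets s)
    field
      elements : List Carrier
      distinct : Distinct (DecSetoid._≈_ (cosets s)) elements
      covers   : ∀ x → x ∈~ elements
      size     : 2 ℕ.^ length gs ℕ.* length elements ≡ N

  -- As `g` normalises `P`, right multiplication by `g` permutes the cosets `xP`; as `g² ∈ P` and
  -- `g ∉ P`, it is an involution without fixed points. Its orbits are the cosets of the larger
  -- subgroup, so orbit representatives form the new transversal.
  halve : ∀ {g gs} (s : Strict gs) (e : Extends (In Trivial gs) g × ¬ In Trivial gs g) →
          Transversal s → Transversal (e ∷ s)
  halve {g} {gs} s (ext , g∉) tr = record
    { elements = reps
    ; distinct = distinct′ reps-distinct
    ; covers   = λ x → covers′ (reps⁺ (covers x))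
    ; size     = ≡.trans (double (2 ℕ.^ length gs) (length reps)) (≡.trans (≡.cong
            (2 ℕ.^ length gs ℕ.*_) length-reps) size)
    }
    where
    open Transversal tr
    open Involutions (cosets s)
    open IsSubgroup (strict-isSubgroup s)
    open Extends ext
    P = In Trivial gs
    f : Carrier → Carrier
    f x = x ∙ g
    f-resp : ∀ {x y} → P (x ⁻¹ ∙ y) → P (f x ⁻¹ ∙ f y)
    f-resp {x} {y} p = resp
      (free (g ∷ x ∷ y ∷ []) (‵ 0 ⁻ · (‵ 1 ⁻ · ‵ 2) · ‵ 0) ((‵ 1 · ‵ 0) ⁻ · (‵ 2 · ‵ 0)) ≡.refl)
      (normal⁻¹ (strict-isSubgroup s) ext p)
    f-invol : ∀ x → P (f (f x) ⁻¹ ∙ x)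
    f-invol x = resp (free (g ∷ x ∷ []) ((‵ 0 · ‵ 0) ⁻) ((‵ 1 · ‵ 0 · ‵ 0) ⁻ · ‵ 1) ≡.refl) (⁻¹∈ square)
    f-free : ∀ x → ¬ P (f x ⁻¹ ∙ x)
    f-free x p = g∉ (resp (free (g ∷ x ∷ []) (((‵ 1 · ‵ 0) ⁻ · ‵ 1) ⁻) (‵ 0) ≡.refl) (⁻¹∈ p))
    f-involutive : InvolutiveOn f elements
    f-involutive = record { closed = λ _ → covers _ ; resp = λ _ → f-resp ; invol = λ _ → f-invol _ }
    open Orbits (orbits f (length elements) elements ℕ.≤-refl distinct f-involutive)
    no-fixed : ∀ zs → (∀ {x} → x ∈~ zs → P (f x ⁻¹ ∙ x)) → length zs ≡ 0
    no-fixed []       _   = ≡.refl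
    no-fixed (z ∷ zs) fix = contradiction (fix (here (DecSetoid.refl (cosets s)))) (f-free z)
    length-reps : 2 ℕ.* length reps ≡ length elements
    length-reps = ≡.sym (≡.trans count (≡.cong (ℕ._+ 2 ℕ.* length reps) (no-fixed fixed (proj₂ ∘ fixed⁻))))
    double : ∀ u v → (2 ℕ.* u) ℕ.* v ≡ u ℕ.* (2 ℕ.* v)
    double = ℕ-solve-∀
    split : ∀ {x y} → In Trivial (g ∷ gs) (x ⁻¹ ∙ y) → SameOrbit f x y
    split (inj₁ p) = inj₁ p
    split {x} {y} (inj₂ p) = inj₂ (resp
      (free (g ∷ x ∷ y ∷ []) (‵ 1 ⁻ · ‵ 2 · ‵ 0 ⁻ · (‵ 0 · ‵ 0)) (‵ 1 ⁻ · (‵ 2 · ‵ 0)) ≡.refl) (∙∈ p square))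
    unsplit : ∀ {x y} → SameOrbit f x y → In Trivial (g ∷ gs) (x ⁻¹ ∙ y)
    unsplit (inj₁ p) = inj₁ p
    unsplit {x} {y} (inj₂ p) = inj₂ (resp
      (free (g ∷ x ∷ y ∷ []) (‵ 1 ⁻ · (‵ 2 · ‵ 0) · (‵ 0 · ‵ 0) ⁻) (‵ 1 ⁻ · ‵ 2 · ‵ 0 ⁻) ≡.refl) (∙∈ p
              (⁻¹∈ square)))
    distinct′ : ∀ {zs} → Distinct (SameOrbit f) zs → Distinct (λ x y → In Trivial (g ∷ gs) (x ⁻¹ ∙ y)) zs
    distinct′ []      = []
    distinct′ (n ∷ d) = (n ∘ Any.map split) ∷ distinct′ d
    covers′ : ∀ {x} → P (f x ⁻¹ ∙ x) ⊎ Any (SameOrbit f x) reps → Any (λ y → In Trivial (g ∷ gs) (x ⁻¹ ∙ y)) reps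
    covers′ {x} (inj₁ p) = contradiction p (f-free x)
    covers′     (inj₂ m) = Any.map unsplit m

  transversal : ∀ {gs} (s : Strict gs) → Transversal s
  transversal [] = record
    { elements = tabulate (proj₁ card)
    ; distinct = tabulate-distinct (proj₁ card) (proj₁ (proj₂ card) _ _)
    ; covers   = λ x → let i , eq = proj₂ (proj₂ card) x in
                       Any.tabulate⁺ i (trans (∙-congˡ eq) (inverseˡ x))
    ; size     = ≡.trans (ℕ.*-identityˡ _) (List.length-tabulate (proj₁ card))
    }
    where
    ~⇒≈ : ∀ {x y} → x ⁻¹ ∙ y ≈ ε → x ≈ y
    ~⇒≈ {x} {y} p = sym (trans (inverseʳ-unique (x ⁻¹) y p) (⁻¹-involutive x))
    tabulate-distinct : ∀ {n} (f : Fin n → Carrier) → (∀ {i j} → f i ≈ f j → i ≡ j) →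
                        Distinct (λ x y → x ⁻¹ ∙ y ≈ ε) (tabulate f)
    tabulate-distinct {zero}  f inj = []
    tabulate-distinct {suc n} f inj =
      (λ m → let j , eq = Any.tabulate⁻ m in contradiction (inj (~⇒≈ eq)) λ ())
      ∷ tabulate-distinct (f ∘ Fin.suc) (Fin.suc-injective ∘ inj)
  transversal (e ∷ s) = halve s e (transversal s)

  -- A transversal of the cosets then has a single element.
  strict-full : ∀ {gs} → Strict gs → N ≡ 2 ℕ.^ length gs → ∀ x → In Trivial gs x
  strict-full {gs} s N≡ x = one (elements) length≡1 (covers x) (covers ε)
    where
    open Transversal (transversal s)
    open Involutions (cosets s)
    open DecSetoid (cosets s) using () renaming (sym to ~-sym; trans to ~-trans)
    instance _ = ℕ.m^n≢0 2 (length gs)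
    length≡1 : length elements ≡ 1
    length≡1 = ℕ.*-cancelˡ-≡ _ _ (2 ℕ.^ length gs) (≡.trans size (≡.trans N≡ (≡.sym (ℕ.*-identityʳ _))))
    one : ∀ ys → length ys ≡ 1 → x ∈~ ys → ε ∈~ ys → In Trivial gs x
    one (y ∷ []) _ (here p) (here q) = IsSubgroup.resp (strict-isSubgroup s)
      (trans (∙-congʳ ε⁻¹≈ε) (identityˡ x)) (~-trans q (~-sym p))

  Even : ℕ → Set
  Even m = ∃ λ h → m ≡ 2 ℕ.* h

  even-difference : ∀ {m} u v → m ≡ u ℕ.+ 2 ℕ.* v → Even m → Even u
  even-difference u v eq (h , eq′) = h ℕ.∸ v , ℕ.+-cancelʳ-≡ (2 ℕ.* v) _ _ (≡.trans (≡.sym eq)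
      (≡.trans eq′ (≡.trans (≡.cong (2 ℕ.*_) (≡.sym (ℕ.m∸n+n≡m v≤h))) (ℕ.*-distribˡ-+ 2 (h ℕ.∸ v) v))))
    where
    v≤h : v ℕ.≤ h
    v≤h = ℕ.*-cancelˡ-≤ 2 (≡.subst (2 ℕ.* v ℕ.≤_) (≡.trans (≡.sym eq) eq′) (ℕ.m≤n+m (2 ℕ.* v) u))

  -- Fixed points are counted modulo 2, first for the links of the chain acting on the cosets of the
  -- subgroup P they generate, then for inversion on the normaliser of P modulo P.
  module Normaliser {gs : List Carrier} (s : Strict gs) where
    open Involutions (cosets s)
    open DecSetoid (cosets s) using () renaming (_≈_ to _~_; sym to ~-sym; trans to ~-trans; refl to ~-refl)
    open IsSubgroup (strict-isSubgroup s)

    P : Carrier → Set ℓ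
    P = In Trivial gs

    ~-congˡ : ∀ h {x y} → x ~ y → (h ∙ x) ~ (h ∙ y)
    ~-congˡ h {x} {y} p = resp
      (free (h ∷ x ∷ y ∷ []) (‵ 1 ⁻ · ‵ 2) ((‵ 0 · ‵ 1) ⁻ · (‵ 0 · ‵ 2)) ≡.refl) p

    ≈⇒~ : ∀ {x y} → x ≈ y → x ~ y
    ≈⇒~ {x} p = resp (trans (sym (inverseˡ x)) (∙-congˡ p)) ε∈

    Fixes : List Carrier → Carrier → Set (c ⊔ ℓ)
    Fixes hs x = ∀ {h} → In Trivial hs h → (h ∙ x) ~ x

    record FixedList (hs : List Carrier) : Set (c ⊔ ℓ) where
      field
        points          : List Carrier
        points-distinct : Distinct _~_ points
        points-even     : Even (length points)
        points⁺         : ∀ {x} → Fixes hs x → x ∈~ points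
        points⁻         : ∀ {x} → x ∈~ points → Fixes hs x

    module _ {g : Carrier} {hs : List Carrier} (s′ : Strict hs) (ext : Extends (In Trivial hs) g)
             (fl : FixedList hs) where
      open FixedList fl

      -- The points are the cosets fixed by `⟨hs⟩`. From `h g x = g (g⁻¹ h g) x` and the normality
      -- of `⟨hs⟩`, `g` permutes them; from `g² ∈ ⟨hs⟩`, its square acts trivially. Hence one more
      -- link changes the number of fixed points by an even amount.
      link-involutive : InvolutiveOn (g ∙_) points
      link-involutive = record
        { closed = λ {x} m → points⁺ λ {h} p → ~-trans
            (≈⇒~ (free (g ∷ x ∷ h ∷ []) (‵ 2 · (‵ 0 · ‵ 1)) (‵ 0 · (‵ 0 ⁻ · ‵ 2 · ‵ 0 · ‵ 1)) ≡.refl))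
            (~-congˡ g (points⁻ m (normal⁻¹ (strict-isSubgroup s′) ext p)))
        ; resp = λ _ → ~-congˡ g
        ; invol = λ m → ~-trans (≈⇒~ (sym (assoc _ _ _))) (points⁻ m (Extends.square ext))
        }

      link-fixes : ∀ {x} → x ∈~ points → (g ∙ x) ~ x → Fixes (g ∷ hs) x
      link-fixes m q (inj₁ p) = points⁻ m p
      link-fixes {x} m q {h} (inj₂ p) = ~-trans
        (≈⇒~ (free (g ∷ x ∷ h ∷ []) (‵ 2 · ‵ 1) (‵ 2 · ‵ 0 ⁻ · (‵ 0 · ‵ 1)) ≡.refl))
        (~-trans (~-congˡ _ q) (points⁻ m p))

      fixedList-link : Orbits (g ∙_) points → FixedList (g ∷ hs)
      fixedList-link o = record
        { points          = fixed
        ; points-distinct = fixed-distinct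
        ; points-even     = even-difference (length fixed) (length reps) count points-even
        ; points⁺         = λ fix → fixed⁺ (points⁺ (λ p → fix (inj₁ p)))
                                           (fix (self∈Extend (strict-isSubgroup s′) g))
        ; points⁻         = λ m → link-fixes (proj₁ (fixed⁻ m)) (proj₂ (fixed⁻ m))
        }
        where open Orbits o

    fixedList : (tr : Transversal s) → Even (length (Transversal.elements tr)) →
                ∀ {hs} → Strict hs → FixedList hs
    fixedList tr even [] = record
      { points = elements ; points-distinct = distinct ; points-even = even
      ; points⁺ = λ _ → covers _
      ; points⁻ = λ _ p → ≈⇒~ (trans (∙-congʳ p) (identityˡ _)) }
      where open Transversal tr
    fixedList tr even ((ext , _) ∷ s′) =
      fixedList-link s′ ext fl (orbits _ (length points) points ℕ.≤-refl points-distinct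
              (link-involutive s′ ext fl))
      where
      fl = fixedList tr even s′
      open FixedList fl

    fixes⇒normal⁻¹ : ∀ {x} → Fixes gs x → ∀ {h} → P h → P (conj (x ⁻¹) h)
    fixes⇒normal⁻¹ {x} fix {h} p = resp
      (free (x ∷ h ∷ []) ((‵ 1 ⁻ · ‵ 0) ⁻ · ‵ 0) (‵ 0 ⁻ · ‵ 1 · ‵ 0 ⁻ ⁻) ≡.refl) (fix (⁻¹∈ p))

    fixes⇒normal : ∀ {x} → Fixes gs x → ∀ {h} → P h → P (conj x h)
    fixes⇒normal {x} fix p =
      resp (conj-cong (⁻¹-involutive x) refl) (conj-inverse (strict-isSubgroup s) (fixes⇒normal⁻¹ fix) p)

    normal⇒fixes : ∀ {x} → (∀ {h} → P h → P (conj (x ⁻¹) h)) → Fixes gs x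
    normal⇒fixes {x} cl {h} p = resp
      (free (x ∷ h ∷ []) (‵ 0 ⁻ · ‵ 1 ⁻ · ‵ 0 ⁻ ⁻) ((‵ 1 · ‵ 0) ⁻ · ‵ 0) ≡.refl) (cl (⁻¹∈ p))

    other : ∀ xs → Even (length xs) → ε ∈~ xs → Distinct _~_ xs → ∃ λ x → x ∈~ xs × ¬ P x
    other []           _           () _
    other (x ∷ [])     (zero , ())  _  _
    other (x ∷ [])     (suc h , e) _  _ = contradiction (≡.trans e (ℕ.+-suc (suc h) _)) λ ()
    other (x ∷ y ∷ xs) _ _ (x∉ ∷ _) with In? gs x
    ... | no  x∉P = x , here ~-refl , x∉P
    ... | yes x∈P = y , there (here ~-refl) , λ y∈P → x∉ (here (∙∈ (⁻¹∈ x∈P) y∈P))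

    module _ (fl : FixedList gs) where
      open FixedList fl

      inversion-involutive : InvolutiveOn _⁻¹ points
      inversion-involutive = record
        { closed = λ m → points⁺ (normal⇒fixes λ p →
            resp (conj-cong (sym (⁻¹-involutive _)) refl) (fixes⇒normal (points⁻ m) p))
        ; resp = λ {x} {y} m p → resp
            (free (x ∷ y ∷ []) (‵ 0 · (‵ 0 ⁻ · ‵ 1) ⁻ · ‵ 0 ⁻) (‵ 0 ⁻ ⁻ · ‵ 1 ⁻) ≡.refl)
            (fixes⇒normal (points⁻ m) (⁻¹∈ p))
        ; invol = λ _ → ≈⇒~ (⁻¹-involutive _)
        }

      ε∈points : ε ∈~ points
      ε∈points = points⁺ λ {h} p → resp (free (h ∷ []) (‵ 0 ⁻) ((‵ 0 · 𝟏) ⁻ · 𝟏) ≡.refl) (⁻¹∈ p)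

      -- Cauchy's theorem for the prime 2 in `N(P)/P`: inversion fixes the trivial coset, and the
      -- number of cosets it fixes is even, so it fixes another one, `gP`. Then `g² ∈ P`, and `g`
      -- normalises `P`.
      next-link : Orbits _⁻¹ points → ∃ λ g → Extends P g × ¬ P g
      next-link o with other fixed (even-difference (length fixed) (length reps) count points-even)
                         (fixed⁺ ε∈points (≈⇒~ ε⁻¹≈ε)) fixed-distinct
        where open Orbits o
      ... | g , m , g∉P = g , extends
            (resp (∙-congʳ (⁻¹-involutive g)) (proj₂ (Orbits.fixed⁻ o m)))
            (fixes⇒normal (points⁻ (proj₁ (Orbits.fixed⁻ o m)))) , g∉P

  abstract
    -- The number of cosets is `2^(k+1)`, and it is the evenness of this number that the fixed point
    -- counts propagate.
    strict-extend : ∀ {gs} → Strict gs → ∀ {k} → N ≡ 2 ℕ.^ suc (length gs ℕ.+ k) → ∃ λ g → Extends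
            (In Trivial gs) g × ¬ In Trivial gs g
    strict-extend {gs} s {k} N≡ =
      next-link fl (orbits _ (length points) points ℕ.≤-refl points-distinct (inversion-involutive fl))
      where
      open Normaliser s
      open Involutions (cosets s)
      arith : ∀ u v → 2 ℕ.* (u ℕ.* v) ≡ u ℕ.* (2 ℕ.* v)
      arith = ℕ-solve-∀
      even : Even (length (Transversal.elements (transversal s)))
      even = 2 ℕ.^ k , ℕ.*-cancelˡ-≡ _ _ (2 ℕ.^ length gs) {{ℕ.m^n≢0 2 (length gs)}} (≡.trans
              (Transversal.size (transversal s)) (≡.trans N≡
        (≡.trans (≡.cong (2 ℕ.*_) (ℕ.^-distribˡ-+-* 2 (length gs) k)) (arith (2 ℕ.^ length gs) (2 ℕ.^ k)))))
      fl : FixedList gs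
      fl = fixedList (transversal s) even s
      open FixedList fl

  -- Towers of subgroups of index two

  record IndexTwo (P P′ : Carrier → Set ℓ) : Set (c ⊔ ℓ) where
    field
      isSubgroup : IsSubgroup P
      included   : ∀ {x} → P x → P′ x
      square     : ∀ {x} → P′ x → P (x ∙ x)
      normal     : ∀ {x y} → P′ x → P y → P (conj x y)
      index2     : ∀ {x y} → P′ x → P′ y → ¬ P x → P y ⊎ P (y ∙ x ⁻¹)

  -- The intermediate subgroups are quantified existentially, so whatever is deduced from a tower
  -- can use only the fields of `IndexTwo`.
  data Tower : ℕ → (Carrier → Set ℓ) → Set (c ⊔ Level.suc ℓ) where
    top  : ∀ {P} → (∀ x → P x) → Tower zero P
    step : ∀ {k P P′} → IndexTwo P P′ → Tower k P′ → Tower (suc k) P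

  tower : ∀ k {gs} → Strict gs → N ≡ 2 ℕ.^ (k ℕ.+ length gs) → Tower k (In Trivial gs)
  tower zero    s N≡ = top (strict-full s N≡)
  tower (suc k) {gs} s N≡ = tower-step (strict-extend s (≡.trans N≡ (≡.cong (λ m → 2 ℕ.^ suc m) (ℕ.+-comm k
          (length gs)))))
    where
    sub = strict-isSubgroup s
    tower-step : (∃ λ g → Extends (In Trivial gs) g × ¬ In Trivial gs g) → Tower (suc k) (In Trivial gs)
    tower-step (g , e) = step (record
      { isSubgroup = sub
      ; included   = inj₁
      ; square     = Extend-square sub (proj₁ e)
      ; normal     = Extend-normal sub (proj₁ e)
      ; index2     = Extend-index2 sub (proj₁ e)
      }) (tower k (e ∷ s) (≡.trans N≡ (≡.cong (2 ℕ.^_) (≡.sym (ℕ.+-suc k (length gs))))))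

pattern 𝐭 = ‵ 0
pattern 𝐳 = ‵ 1
pattern 𝐚 = ‵ 2
pattern 𝐜 = ‵ 3

𝐰 𝐮 𝐫 : Expr
𝐰 = 𝐳 · 𝐭
𝐮 = 𝐰 · 𝐰
𝐫 = 𝐮 ⁻ · 𝐭 · 𝐮

-- The Coxeter group [4,∞]

module Coxeter {ℓ₁ ℓ₂ : Level} (G : Group ℓ₁ ℓ₂) (a b c : Group.Carrier G) where
  open Group G
  open GroupProperties G
  open SetoidReasoning setoid
  open Rewriting G
  open Powers G
  open Subgroups G

  record CoxeterRelations : Set ℓ₂ where
    field
      a²  : a ∙ a ≈ ε
      b²  : b ∙ b ≈ ε
      c²  : c ∙ c ≈ ε
      ab⁴ : gpow G (a ∙ b) 4 ≈ ε
      ac  : a ∙ c ≈ c ∙ a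

  t z w u r : Carrier
  t = b ∙ c
  z = (a ∙ b) ∙ (a ∙ b)
  w = z ∙ t
  u = w ∙ w
  r = u ⁻¹ ∙ t ∙ u

  module Relations (rels : CoxeterRelations) where
    open CoxeterRelations rels

    abc : List Carrier
    abc = a ∷ b ∷ c ∷ []

    private
      baba : b ∙ a ∙ b ∙ a ≈ a ∙ b ∙ a ∙ b
      baba = begin
        b ∙ a ∙ b ∙ a                                    ≈⟨ identityʳ _ ⟨
        b ∙ a ∙ b ∙ a ∙ ε                                ≈⟨ ∙-congˡ ab⁴ ⟨
        b ∙ a ∙ b ∙ a ∙ gpow G (a ∙ b) 4                 ≈⟨ rewriting abc
                (involution abc 0 a² ++ involution abc 1 b²)
          (‵ 1 · ‵ 0 · ‵ 1 · ‵ 0 · ((‵ 0 · ‵ 1) · ((‵ 0 · ‵ 1) · ((‵ 0 · ‵ 1) · ((‵ 0 · ‵ 1) · 𝟏)))))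
          (‵ 0 · ‵ 1 · ‵ 0 · ‵ 1) ≡.refl ⟩
        a ∙ b ∙ a ∙ b                                    ∎

    rules-abc : List (Rule abc)
    rules-abc = (‵ 1 · ‵ 0 · ‵ 1 · ‵ 0 ↦ ‵ 0 · ‵ 1 · ‵ 0 · ‵ 1 by baba)
              ∷ (‵ 2 · ‵ 0 ↦ ‵ 0 · ‵ 2 by sym ac)
              ∷ involution abc 0 a² ++ involution abc 1 b² ++ involution abc 2 c²

    private
      A B C T Z : Expr
      A = ‵ 0
      B = ‵ 1
      C = ‵ 2
      T = B · C
      Z = (A · B) · (A · B)

      ct : c ∙ t ≈ t ⁻¹ ∙ c
      ct = rewriting abc rules-abc (C · T) (T ⁻ · C) ≡.refl

      ct⁻¹ : c ∙ t ⁻¹ ≈ t ∙ c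
      ct⁻¹ = rewriting abc rules-abc (C · T ⁻) (T · C) ≡.refl

      cz : c ∙ z ≈ t ⁻¹ ∙ z ∙ t ∙ c
      cz = rewriting abc rules-abc (C · Z) (T ⁻ · Z · T · C) ≡.refl

      at′ : a ∙ t ≈ z ∙ t ∙ a
      at′ = rewriting abc rules-abc (A · T) (Z · T · A) ≡.refl

      at⁻¹ : a ∙ t ⁻¹ ≈ t ⁻¹ ∙ z ∙ a
      at⁻¹ = rewriting abc rules-abc (A · T ⁻) (T ⁻ · Z · A) ≡.refl

      az : a ∙ z ≈ z ∙ a
      az = rewriting abc rules-abc (A · Z) (Z · A) ≡.refl

      z² : z ∙ z ≈ ε
      z² = rewriting abc rules-abc (Z · Z) 𝟏 ≡.refl

    b≈tc : b ≈ t ∙ c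
    b≈tc = rewriting abc rules-abc B (T · C) ≡.refl

    -- A complete rewriting system for [4,∞] on t, z, a, c: since z is an involution, ⟨t , z⟩ is
    -- the free product ℤ * ℤ/2, and a and c move to the right.
    rules : ∀ extra → List (Rule (t ∷ z ∷ a ∷ c ∷ extra))
    rules extra = involution env 1 z² ++ involution env 2 a² ++ involution env 3 c²
      ++ (‵ 3 · ‵ 2 ↦ ‵ 2 · ‵ 3 by sym ac)
      ∷ (‵ 3 · ‵ 0 ↦ ‵ 0 ⁻ · ‵ 3 by ct)
      ∷ (‵ 3 · ‵ 0 ⁻ ↦ ‵ 0 · ‵ 3 by ct⁻¹)
      ∷ (‵ 3 · ‵ 1 ↦ ‵ 0 ⁻ · ‵ 1 · ‵ 0 · ‵ 3 by cz)
      ∷ (‵ 2 · ‵ 0 ↦ ‵ 1 · ‵ 0 · ‵ 2 by at′)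
      ∷ (‵ 2 · ‵ 0 ⁻ ↦ ‵ 0 ⁻ · ‵ 1 · ‵ 2 by at⁻¹)
      ∷ (‵ 2 · ‵ 1 ↦ ‵ 1 · ‵ 2 by az)
      ∷ []
      where env = t ∷ z ∷ a ∷ c ∷ extra

    tzac : List Carrier
    tzac = t ∷ z ∷ a ∷ c ∷ []

    coxeter : ∀ e f → normalise tzac (rules []) e ≡ normalise tzac (rules []) f → ⟦_⟧ tzac e ≈ ⟦_⟧ tzac f
    coxeter = rewriting tzac (rules [])

    conj-ct : conj c t ≈ t ⁻¹
    conj-ct = coxeter (𝐜 · 𝐭 · 𝐜 ⁻) (𝐭 ⁻) ≡.refl

    conj-zt : conj z t ≈ u ∙ t ⁻¹
    conj-zt = coxeter (𝐳 · 𝐭 · 𝐳 ⁻) (𝐮 · 𝐭 ⁻) ≡.refl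

    conj-zc : conj z c ≈ conj z t ⁻¹ ∙ t ∙ c
    conj-zc = coxeter (𝐳 · 𝐜 · 𝐳 ⁻) ((𝐳 · 𝐭 · 𝐳 ⁻) ⁻ · 𝐭 · 𝐜) ≡.refl

    conj-zu : conj z u ≈ t ∙ conj z t
    conj-zu = coxeter (𝐳 · 𝐮 · 𝐳 ⁻) (𝐭 · (𝐳 · 𝐭 · 𝐳 ⁻)) ≡.refl

    -- `c` inverts `t` and commutes with `a`, so it also inverts `w = a t a` and `u = w²`.
    conj-uc : conj u c ≈ u ∙ u ∙ c
    conj-uc = coxeter (𝐮 · 𝐜 · 𝐮 ⁻) (𝐮 · 𝐮 · 𝐜) ≡.refl

    conj-at : conj a t ≈ w
    conj-at = coxeter (𝐚 · 𝐭 · 𝐚 ⁻) 𝐰 ≡.refl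

    conj-aw : conj a w ≈ t
    conj-aw = coxeter (𝐚 · 𝐰 · 𝐚 ⁻) 𝐭 ≡.refl

    conj-au : conj a u ≈ t ∙ t
    conj-au = coxeter (𝐚 · 𝐮 · 𝐚 ⁻) (𝐭 · 𝐭) ≡.refl

    conj-ac : conj a c ≈ c
    conj-ac = coxeter (𝐚 · 𝐜 · 𝐚 ⁻) 𝐜 ≡.refl

    conj-az : conj a z ≈ z
    conj-az = coxeter (𝐚 · 𝐳 · 𝐚 ⁻) 𝐳 ≡.refl

    commutes-tz⇒tw : ∀ {x} → Commutes x t → Commutes x z → Commutes x w
    commutes-tz⇒tw xt xz = commutes-∙ xz xt

    commutes-tw⇒z : ∀ {x} → Commutes x t → Commutes x w → Commutes x z
    commutes-tw⇒z xt xw = commutes-resp refl (coxeter (𝐰 · 𝐭 ⁻) 𝐳 ≡.refl) (commutes-∙ xw (commutes-inverseʳ xt))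

    commutes-conj-a : ∀ {x y} → Commutes x y → Commutes (conj a x) (conj a y)
    commutes-conj-a p = trans (sym (conj-∙ a _ _)) (trans (conj-cong refl p) (conj-∙ a _ _))

    -- Normal forms forced by the relators

    Contains : (Carrier → Set ℓ₂) → Set (ℓ₁ ⊔ ℓ₂)
    Contains P = IsSubgroup P × P a × P b × P c

    module _ {gs : List Carrier} (ch : Chain (Cyclic t) gs) where
      private P = In (Cyclic t) gs
      open IsSubgroup (In-isSubgroup (Cyclic-isSubgroup t) ch)

      link : ∀ {g} → P (g ∙ g) → P (conj g t) → All (P ∘ conj g) gs → Chain (Cyclic t) (g ∷ gs)
      link sq ct cgs = extends sq (In-conj sub (Cyclic-conj sub ct) cgs) ∷ ch
        where sub = In-isSubgroup (Cyclic-isSubgroup t) ch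

    t∈ : ∀ gs → In (Cyclic t) gs t
    t∈ []       = + 1 , sym (identityʳ t)
    t∈ (g ∷ gs) = inj₁ (t∈ gs)

    chain-c : Chain (Cyclic t) (c ∷ [])
    chain-c = link [] (resp (sym c²) ε∈) (resp (sym conj-ct) (⁻¹∈ (t∈ []))) []
      where open IsSubgroup (Cyclic-isSubgroup t)

    contains : ∀ {gs} → Chain (Cyclic t) gs → In (Cyclic t) gs c → In (Cyclic t) gs a → Contains (In (Cyclic t) gs)
    contains {gs} ch c∈ a∈ = sub , a∈ , resp (sym b≈tc) (∙∈ (t∈ gs) c∈) , c∈
      where
      sub = In-isSubgroup (Cyclic-isSubgroup t) ch
      open IsSubgroup sub

    gs₁ gs₂ gs₃ : List Carrier
    gs₁ = a ∷ z ∷ c ∷ []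
    gs₂ = a ∷ z ∷ u ∷ c ∷ []
    gs₃ = a ∷ z ∷ u ∷ r ∷ c ∷ []

    cover₁ : Cyclic t (z ∙ c ∙ z ∙ c) → Contains (In (Cyclic t) gs₁)
    cover₁ h∈ = contains chain-a (inj₁ (inj₁ (self∈Extend (Cyclic-isSubgroup t) c))) (self∈Extend
            (In-isSubgroup (Cyclic-isSubgroup t) chain-z) a)
      where
      chain-z : Chain (Cyclic t) (z ∷ c ∷ [])
      chain-z = link chain-c (resp (sym z²) ε∈)
        -- Since `z` commutes with `b`, one has `z t z = b z c z = t (z c z c)⁻¹`.
        (resp (coxeter (𝐭 · (𝐳 · 𝐜 · 𝐳 · 𝐜) ⁻) (𝐳 · 𝐭 · 𝐳 ⁻) ≡.refl) (∙∈ (t∈ (c ∷ [])) (⁻¹∈ (inj₁ h∈))))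
        (resp (coxeter (𝐳 · 𝐜 · 𝐳 · 𝐜 · 𝐜) (𝐳 · 𝐜 · 𝐳 ⁻) ≡.refl) (∙∈ (inj₁ h∈) (self∈Extend
                (Cyclic-isSubgroup t) c)) ∷ [])
        where open IsSubgroup (In-isSubgroup (Cyclic-isSubgroup t) chain-c)
      chain-a : Chain (Cyclic t) gs₁
      chain-a = link chain-z (resp (sym a²) ε∈)
        (resp (sym conj-at) (∙∈ z∈ (t∈ (z ∷ c ∷ []))))
        (resp (sym conj-az) z∈ ∷ resp (sym conj-ac) (inj₁ (self∈Extend (Cyclic-isSubgroup t) c)) ∷ [])
        where
        open IsSubgroup (In-isSubgroup (Cyclic-isSubgroup t) chain-z)
        z∈ = self∈Extend (In-isSubgroup (Cyclic-isSubgroup t) chain-c) z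

    -- Common end of the second and third cases: `z t z = u t⁻¹`, so `z` can be adjoined once `u` is
    -- present, and `a t a = z t` then lets `a` follow.
    chain-za : ∀ {gs} → Chain (Cyclic t) gs → In (Cyclic t) gs c → In (Cyclic t) gs u →
               All (In (Cyclic t) gs ∘ conj z) gs → All (In (Cyclic t) (z ∷ gs) ∘ conj a) gs →
               Contains (In (Cyclic t) (a ∷ z ∷ gs))
    chain-za {gs} ch c∈ u∈ zgs ags = contains chain-a (inj₁ (inj₁ c∈)) (self∈Extend (In-isSubgroup
            (Cyclic-isSubgroup t) chain-z) a)
      where
      chain-z : Chain (Cyclic t) (z ∷ gs)
      chain-z = link ch (resp (sym z²) ε∈) (resp (sym conj-zt) (∙∈ u∈ (⁻¹∈ (t∈ gs)))) zgs
        where open IsSubgroup (In-isSubgroup (Cyclic-isSubgroup t) ch)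
      chain-a : Chain (Cyclic t) (a ∷ z ∷ gs)
      chain-a = link chain-z (resp (sym a²) ε∈) (resp (sym conj-at) (∙∈ z∈ (t∈ (z ∷ gs))))
        (resp (sym conj-az) z∈ ∷ ags)
        where
        open IsSubgroup (In-isSubgroup (Cyclic-isSubgroup t) chain-z)
        z∈ = self∈Extend (In-isSubgroup (Cyclic-isSubgroup t) ch) z

    t⁸ᴷ∈ : ∀ K → Cyclic t ((t ^ + 8) ^ K)
    t⁸ᴷ∈ K = + 8 ℤ.* K , ^-homo-* t (+ 8) K

    -- Here `h` is the optional twist. The relation gives `z t² z = t² h`, so `z` commutes with
    -- `t⁴`, hence with `h`. Conjugation by `a` turns `h` into an involution `k` that also commutes
    -- with `t` and `z`. Once `h = k` is known, `u² = t⁴` and `u t u⁻¹ = t h`, so `u` normalises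
    -- `⟨t, c⟩`.
    cover₂ : ∀ K → let h = (t ^ + 8) ^ K in h ∙ h ≈ ε → z ∙ t ∙ t ≈ t ∙ t ∙ h ∙ z → Contains (In (Cyclic t) gs₂)
    cover₂ K h² ztt = chain-za chain-u c∈ u∈ (zu ∷ zc ∷ []) (resp′ (sym conj-au) (inj₁ (∙∈ t∈u t∈u)) ∷ resp′
            (sym conj-ac) (inj₁ c∈) ∷ [])
      where
      h k : Carrier
      h = (t ^ + 8) ^ K
      k = conj a h
      th : Commutes t h
      th = commutes-^ K (commutes-^ (+ 8) refl)

      zt⁴ : Commutes z (t ^ + 4)
      zt⁴ = rewriting env ((𝐳 · 𝐭 · 𝐭 ↦ 𝐭 · 𝐭 · ‵ 4 · 𝐳 by ztt) ∷ commuting env 4 0 (sym th) ++ involution env 4 h²)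
        (𝐳 · pow 𝐭 4) (pow 𝐭 4 · 𝐳) ≡.refl
        where env = t ∷ z ∷ a ∷ c ∷ h ∷ []

      t⁸ : (t ^ + 4) ^ + 2 ≈ t ^ + 8
      t⁸ = ^-homo-* t (+ 4) (+ 2)
      zh : Commutes z h
      zh = commutes-^ K (commutes-resp refl t⁸ (commutes-^ (+ 2) zt⁴))

      -- The conjugates by a of the preceding relations.
      k≈ : k ≈ (w ^ + 8) ^ K
      k≈ = trans (conj-^ a _ K) (^-cong K (trans (conj-^ a t (+ 8)) (^-cong (+ 8) conj-at)))
      wk : Commutes w k
      wk = commutes-resp conj-at refl (commutes-conj-a th)
      zk : Commutes z k
      zk = commutes-resp conj-az refl (commutes-conj-a zh)
      tk : Commutes t k
      tk = commutes-resp (coxeter (𝐳 · 𝐰) 𝐭 ≡.refl) refl (sym (commutes-∙ (sym zk) (sym wk)))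
      k² : k ∙ k ≈ ε
      k² = trans (sym (conj-∙ a h h)) (trans (conj-cong refl h²) (conj-ε a))
      tztz : t ∙ z ∙ t ∙ z ≈ z ∙ t ∙ z ∙ t ∙ k
      tztz = begin
        t ∙ z ∙ t ∙ z                    ≈⟨ coxeter (𝐭 · 𝐳 · 𝐭 · 𝐳) (𝐚 · (𝐳 · 𝐭 · 𝐭) · 𝐚 ⁻ · 𝐳) ≡.refl ⟩
        conj a (z ∙ t ∙ t) ∙ z           ≈⟨ ∙-congʳ (conj-cong refl ztt) ⟩
        conj a (t ∙ t ∙ h ∙ z) ∙ z       ≈⟨ rewriting env (rules (h ∷ [])) (𝐚 · (𝐭 · 𝐭 · ‵ 4 · 𝐳) · 𝐚 ⁻ · 𝐳)
                (𝐳 · 𝐭 · 𝐳 · 𝐭 · (𝐚 · ‵ 4 · 𝐚 ⁻)) ≡.refl ⟩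
        z ∙ t ∙ z ∙ t ∙ k                ∎
        where env = t ∷ z ∷ a ∷ c ∷ h ∷ []

      ztzt : z ∙ t ∙ z ∙ t ≈ t ∙ z ∙ t ∙ z ∙ k
      ztzt = sym (trans (∙-congʳ tztz) (trans (assoc _ _ _) (trans (∙-congˡ k²) (identityʳ _))))

      env = t ∷ z ∷ h ∷ k ∷ []
      central : List (Rule env)
      central = commuting env 0 2 th ++ commuting env 1 2 zh ++ commuting env 0 3 tk ++ commuting env 1 3 zk
        ++ commuting env 3 2 (commutes-^ K (commutes-gpow 8 (sym tk)))
        ++ involution env 1 z² ++ involution env 2 h² ++ involution env 3 k²
      u⁴≈t⁸ : u ∙ u ∙ (u ∙ u) ≈ t ^ + 8
      u⁴≈t⁸ = rewriting env
        ((𝐳 · 𝐭 · 𝐳 · 𝐭 ↦ 𝐭 · 𝐳 · 𝐭 · 𝐳 · ‵ 3 by ztzt) ∷ (𝐳 · 𝐭 · 𝐭 ↦ 𝐭 · 𝐭 · ‵ 2 · 𝐳 by ztt) ∷ central)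
        (𝐮 · 𝐮 · (𝐮 · 𝐮)) (pow 𝐭 8) ≡.refl
      -- `u⁴` equals `w⁸` by definition and `t⁸` by the line above, while `h` and `k` are the same
      -- power of `t⁸` and of `w⁸`.
      h≈k : h ≈ k
      h≈k = trans (^-cong K (trans (sym u⁴≈t⁸) (free tzac (𝐮 · 𝐮 · (𝐮 · 𝐮)) (pow 𝐰 8) ≡.refl))) (sym k≈)
      ztzt′ : z ∙ t ∙ z ∙ t ≈ t ∙ z ∙ t ∙ z ∙ h
      ztzt′ = trans ztzt (∙-congˡ (sym h≈k))
      u²≈t⁴ : u ∙ u ≈ t ^ + 4
      u²≈t⁴ = rewriting env
        ((𝐳 · 𝐭 · 𝐳 · 𝐭 ↦ 𝐭 · 𝐳 · 𝐭 · 𝐳 · ‵ 2 by ztzt′) ∷ (𝐳 · 𝐭 · 𝐭 ↦ 𝐭 · 𝐭 · ‵ 2 · 𝐳 by ztt) ∷ central)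
        (𝐮 · 𝐮) (pow 𝐭 4) ≡.refl
      ut : conj u t ≈ t ∙ h
      ut = trans (∙-congʳ (rewriting env
        ((𝐳 · 𝐭 · 𝐳 · 𝐭 ↦ 𝐭 · 𝐳 · 𝐭 · 𝐳 · ‵ 2 by ztzt′) ∷ central)
        (𝐮 · 𝐭) (𝐭 · ‵ 2 · 𝐮) ≡.refl)) (//-rightDividesʳ u (t ∙ h))

      subD = In-isSubgroup (Cyclic-isSubgroup t) chain-c
      c∈D = self∈Extend (Cyclic-isSubgroup t) c
      chain-u : Chain (Cyclic t) (u ∷ c ∷ [])
      chain-u = link chain-c (resp (sym u²≈t⁴) t⁴∈) (resp (sym ut) (∙∈ (t∈ (c ∷ [])) (inj₁ (t⁸ᴷ∈ K))))
        (resp (sym (trans conj-uc (∙-congʳ u²≈t⁴))) (∙∈ t⁴∈ c∈D) ∷ [])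
        where
        open IsSubgroup subD
        t⁴∈ = ^∈ (+ 4) (t∈ (c ∷ []))
      open IsSubgroup (In-isSubgroup (Cyclic-isSubgroup t) chain-u)
      u∈ = self∈Extend subD u
      c∈ : In (Cyclic t) (u ∷ c ∷ []) c
      c∈ = inj₁ c∈D
      t∈u = t∈ (u ∷ c ∷ [])
      zt = resp (sym conj-zt) (∙∈ u∈ (⁻¹∈ t∈u))
      zu = resp (sym conj-zu) (∙∈ t∈u zt)
      zc = resp (sym conj-zc) (∙∈ (∙∈ (⁻¹∈ zt) t∈u) c∈)
      resp′ : ∀ {x y} → x ≈ y → In (Cyclic t) (z ∷ u ∷ c ∷ []) x → In (Cyclic t) (z ∷ u ∷ c ∷ []) y
      resp′ eq = [ inj₁ ∘ resp eq , inj₂ ∘ resp (∙-congʳ eq) ]′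

    -- The hypotheses speak of the squares `t²` and `u²` only. They become applicable to the product
    -- of `r` and `t` because conjugating it by `w` produces `t⁻¹ u² t⁻¹`. Both directions of the
    -- third case use this.
    r-t-commutator : ∀ {x} → Commutes t x → Commutes z x → x ∙ x ≈ ε → Commutes t (u ∙ u) →
                     t ∙ t ∙ u ≈ u ∙ t ∙ t ∙ x → r ∙ t ≈ t ∙ x ∙ r
    r-t-commutator {x} tx zx x² tu² ttu = rt
      where
      wx : Commutes w x
      wx = sym (commutes-tz⇒tw (sym tx) (sym zx))
      ux : Commutes u x
      ux = sym (commutes-∙ (sym wx) (sym wx))
      env : List Carrier
      env = t ∷ u ∷ x ∷ []
      central : List (Rule env)
      central = commuting env 2 0 (sym tx) ++ commuting env 2 1 (sym ux) ++ involution env 2 x²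
      t⁻²u : t ⁻¹ ∙ t ⁻¹ ∙ u ≈ u ∙ t ⁻¹ ∙ t ⁻¹ ∙ x
      t⁻²u = begin
        t ⁻¹ ∙ t ⁻¹ ∙ u                                     ≈⟨ rewriting env central (𝐭 ⁻ · 𝐭 ⁻ · ‵ 1)
                (𝐭 ⁻ · 𝐭 ⁻ · (‵ 1 · 𝐭 · 𝐭 · ‵ 2) · 𝐭 ⁻ · 𝐭 ⁻ · ‵ 2) ≡.refl ⟩
        t ⁻¹ ∙ t ⁻¹ ∙ (u ∙ t ∙ t ∙ x) ∙ t ⁻¹ ∙ t ⁻¹ ∙ x     ≈⟨ ∙-congʳ (∙-congʳ (∙-congʳ (∙-congˡ ttu))) ⟨
        t ⁻¹ ∙ t ⁻¹ ∙ (t ∙ t ∙ u) ∙ t ⁻¹ ∙ t ⁻¹ ∙ x         ≈⟨ free env (𝐭 ⁻ · 𝐭 ⁻ ·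
                (𝐭 · 𝐭 · ‵ 1) · 𝐭 ⁻ · 𝐭 ⁻ · ‵ 2) (‵ 1 · 𝐭 ⁻ · 𝐭 ⁻ · ‵ 2) ≡.refl ⟩
        u ∙ t ⁻¹ ∙ t ⁻¹ ∙ x                                 ∎
      t⁻¹u² : t ⁻¹ ∙ u ∙ u ≈ u ∙ u ∙ t ⁻¹
      t⁻¹u² = trans (assoc _ _ _) (commutes-inverseˡ tu²)
      -- Conjugation by w carries r and t to t⁻¹ u and u t⁻¹.
      rt : r ∙ t ≈ t ∙ x ∙ r
      rt = begin
        r ∙ t                                          ≈⟨ coxeter (𝐫 · 𝐭) (𝐰 ⁻ · (𝐭 ⁻ · 𝐮 · 𝐮 · 𝐭 ⁻) · 𝐰) ≡.refl ⟩
        w ⁻¹ ∙ (t ⁻¹ ∙ u ∙ u ∙ t ⁻¹) ∙ w               ≈⟨ ∙-congʳ (∙-congˡ (rewriting env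
          ((𝐭 ⁻ · ‵ 1 · ‵ 1 ↦ ‵ 1 · ‵ 1 · 𝐭 ⁻ by t⁻¹u²) ∷ (𝐭 ⁻ · 𝐭 ⁻ · ‵ 1 ↦ ‵ 1 · 𝐭 ⁻ · 𝐭 ⁻ · ‵ 2 by t⁻²u) ∷
                  central)
          (𝐭 ⁻ · ‵ 1 · ‵ 1 · 𝐭 ⁻) (‵ 1 · 𝐭 ⁻ · 𝐭 ⁻ · ‵ 1 · ‵ 2) ≡.refl)) ⟩
        w ⁻¹ ∙ (u ∙ t ⁻¹ ∙ t ⁻¹ ∙ u ∙ x) ∙ w           ≈⟨ rewriting env′ (commuting env′ 4 0
                (sym tx) ++ commuting env′ 4 1 (sym zx) ++ rules (x ∷ []))
          (𝐰 ⁻ · (𝐮 · 𝐭 ⁻ · 𝐭 ⁻ · 𝐮 · ‵ 4) · 𝐰) (𝐭 · ‵ 4 · 𝐫) ≡.refl ⟩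
        t ∙ x ∙ r                                      ∎
        where
        env′ = t ∷ z ∷ a ∷ c ∷ x ∷ []

    -- Now `u` need not normalise `⟨t, c⟩`. But `u²` commutes with `t`, so conjugation by `u`
    -- exchanges `t` and `r`; this is why `r` is adjoined before `u`. The element `x = h₁ h₂` is the
    -- commutator of `r` and `t` and also the quotient of `r²` by `t²`.
    cover₃ : ∀ K₁ K₂ → let h₁ = (t ^ + 8) ^ K₁; h₂ = (t ^ + 8) ^ K₂ in h₁ ∙ h₁ ≈ ε → h₂ ∙ h₂ ≈ ε →
             u ⁻¹ ∙ t ∙ t ∙ (u ⁻¹ ∙ t ∙ t) ≈ h₁ → u ∙ u ≈ t ^ + 4 ∙ h₂ → Contains (In (Cyclic t) gs₃)
    cover₃ K₁ K₂ h₁² h₂² e₁ e₂ = chain-za chain-u c∈ u∈ (zu ∷ zr ∷ zc ∷ [])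
        (au ∷ Z.resp (conj-r a) (Z.∙∈ (Z.∙∈ (Z.⁻¹∈ au) (Z.resp (sym conj-at) at∈)) au) ∷ Z.resp (sym conj-ac)
                (inj₁ c∈) ∷ [])
      where
      h₁ h₂ x : Carrier
      h₁ = (t ^ + 8) ^ K₁
      h₂ = (t ^ + 8) ^ K₂
      x = h₁ ∙ h₂
      th : ∀ K → Commutes t ((t ^ + 8) ^ K)
      th K = commutes-^ K (commutes-^ (+ 8) refl)
      tu² : Commutes t (u ∙ u)
      tu² = commutes-resp refl (sym e₂) (commutes-∙ (commutes-^ (+ 4) refl) (th K₂))
      zu² : Commutes z (u ∙ u)
      zu² = sym (commutes-tw⇒z (sym tu²) (free tzac (𝐮 · 𝐮 · 𝐰) (𝐰 · (𝐮 · 𝐮)) ≡.refl))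
      -- Squaring `u² = t⁴ h₂` gives `u⁴ = t⁸`, and `u²` commutes with both `t` and `w`, hence with
      -- `z`.
      zt⁸ : Commutes z (t ^ + 8)
      zt⁸ = commutes-resp refl (trans (∙-cong e₂ e₂) (rewriting env (commuting env 4 0 (sym
              (th K₂)) ++ involution env 4 h₂²)
              (pow 𝐭 4 · ‵ 4 · (pow 𝐭 4 · ‵ 4)) (pow 𝐭 8) ≡.refl)) (commutes-∙ zu² zu²)
        where env = t ∷ z ∷ a ∷ c ∷ h₂ ∷ []
      tx : Commutes t x
      tx = commutes-∙ (th K₁) (th K₂)
      zx : Commutes z x
      zx = commutes-∙ (commutes-^ K₁ zt⁸) (commutes-^ K₂ zt⁸)
      h₁h₂ : Commutes h₁ h₂
      h₁h₂ = commutes-^^ (t ^ + 8) K₁ K₂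
      x² : x ∙ x ≈ ε
      x² = rewriting env (commuting env 0 1 h₁h₂ ++ involution env 0 h₁² ++ involution env 1 h₂²) (‵ 0 · ‵ 1 ·
              (‵ 0 · ‵ 1)) 𝟏 ≡.refl
        where env = h₁ ∷ h₂ ∷ []
      ttu : t ∙ t ∙ u ≈ u ∙ t ∙ t ∙ x
      ttu = begin
        t ∙ t ∙ u  ≈⟨ free (t ∷ u ∷ []) (𝐭 · 𝐭 · ‵ 1) (‵ 1 · (‵ 1 ⁻ · 𝐭 · 𝐭 · (‵ 1 ⁻ · 𝐭 · 𝐭)) · (𝐭 ⁻ · 𝐭 ⁻) ·
                (‵ 1 · ‵ 1)) ≡.refl ⟩
        u ∙ (u ⁻¹ ∙ t ∙ t ∙ (u ⁻¹ ∙ t ∙ t)) ∙ (t ⁻¹ ∙ t ⁻¹) ∙ (u ∙ u)  ≈⟨ ∙-cong (∙-congʳ (∙-congˡ e₁)) e₂ ⟩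
        u ∙ h₁ ∙ (t ⁻¹ ∙ t ⁻¹) ∙ (t ^ + 4 ∙ h₂)  ≈⟨ rewriting env (commuting env 2 0 (sym (th K₁)))
                (‵ 1 · ‵ 2 · (𝐭 ⁻ · 𝐭 ⁻) · (pow 𝐭 4 · ‵ 3)) (‵ 1 · 𝐭 · 𝐭 · (‵ 2 · ‵ 3)) ≡.refl ⟩
        u ∙ t ∙ t ∙ x  ∎
        where env = t ∷ u ∷ h₁ ∷ h₂ ∷ []

      env : List Carrier
      env = t ∷ u ∷ x ∷ []
      r² : r ∙ r ≈ t ∙ t ∙ x
      r² = begin
        r ∙ r                    ≈⟨ free env (‵ 1 ⁻ · 𝐭 · ‵ 1 · (‵ 1 ⁻ · 𝐭 · ‵ 1)) (‵ 1 ⁻ · (𝐭 · 𝐭 · ‵ 1)) ≡.refl ⟩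
        u ⁻¹ ∙ (t ∙ t ∙ u)       ≈⟨ ∙-congˡ ttu ⟩
        u ⁻¹ ∙ (u ∙ t ∙ t ∙ x)   ≈⟨ free env (‵ 1 ⁻ · (‵ 1 · 𝐭 · 𝐭 · ‵ 2)) (𝐭 · 𝐭 · ‵ 2) ≡.refl ⟩
        t ∙ t ∙ x                ∎

      rt : r ∙ t ≈ t ∙ x ∙ r
      rt = r-t-commutator tx zx x² tu² ttu
      conj-rt : conj r t ≈ t ∙ x
      conj-rt = trans (∙-congʳ rt) (//-rightDividesʳ r (t ∙ x))
      conj-rc : conj r c ≈ r ∙ r ∙ c
      conj-rc = begin
        conj r c                                  ≈⟨ coxeter (𝐫 · 𝐜 · 𝐫 ⁻) (𝐮 ⁻ · 𝐭 ·
                (𝐮 · 𝐮 · 𝐭) · 𝐮 ⁻ · 𝐜) ≡.refl ⟩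
        u ⁻¹ ∙ t ∙ (u ∙ u ∙ t) ∙ u ⁻¹ ∙ c         ≈⟨ ∙-congʳ (∙-congʳ (∙-congˡ tu²)) ⟨
        u ⁻¹ ∙ t ∙ (t ∙ (u ∙ u)) ∙ u ⁻¹ ∙ c       ≈⟨ coxeter (𝐮 ⁻ · 𝐭 · (𝐭 · (𝐮 · 𝐮)) · 𝐮 ⁻ · 𝐜)
                (𝐫 · 𝐫 · 𝐜) ≡.refl ⟩
        r ∙ r ∙ c                                 ∎
      conj-ut : conj u t ≈ r
      conj-ut = begin
        conj u t                             ≈⟨ free env (‵ 1 · 𝐭 · ‵ 1 ⁻) (‵ 1 ⁻ ·
                (‵ 1 · ‵ 1 · 𝐭) · ‵ 1 ⁻) ≡.refl ⟩
        u ⁻¹ ∙ (u ∙ u ∙ t) ∙ u ⁻¹            ≈⟨ ∙-congʳ (∙-congˡ tu²) ⟨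
        u ⁻¹ ∙ (t ∙ (u ∙ u)) ∙ u ⁻¹          ≈⟨ free env (‵ 1 ⁻ · (𝐭 · (‵ 1 · ‵ 1)) · ‵ 1 ⁻)
                (‵ 1 ⁻ · 𝐭 · ‵ 1) ≡.refl ⟩
        r                                    ∎
      conj-r : ∀ g → conj g u ⁻¹ ∙ conj g t ∙ conj g u ≈ conj g r
      conj-r g = free (g ∷ t ∷ u ∷ []) ((‵ 0 · ‵ 2 · ‵ 0 ⁻) ⁻ · (‵ 0 · ‵ 1 · ‵ 0 ⁻) · (‵ 0 · ‵ 2 · ‵ 0 ⁻))
              (‵ 0 · (‵ 2 ⁻ · ‵ 1 · ‵ 2) · ‵ 0 ⁻) ≡.refl

      subT = Cyclic-isSubgroup t
      subD = In-isSubgroup subT chain-c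
      c∈D : In (Cyclic t) (c ∷ []) c
      c∈D = self∈Extend subT c
      x∈T : Cyclic t x
      x∈T = IsSubgroup.∙∈ subT (t⁸ᴷ∈ K₁) (t⁸ᴷ∈ K₂)
      chain-r : Chain (Cyclic t) (r ∷ c ∷ [])
      chain-r = link chain-c (resp (sym r²) ttx) (resp (sym conj-rt) (∙∈ t∈D (inj₁ x∈T)))
        (resp (sym (trans conj-rc (∙-congʳ r²))) (∙∈ ttx c∈D) ∷ [])
        where
        open IsSubgroup subD
        t∈D = t∈ (c ∷ [])
        ttx = ∙∈ (∙∈ t∈D t∈D) (inj₁ x∈T)
      subR = In-isSubgroup subT chain-r
      chain-u : Chain (Cyclic t) (u ∷ r ∷ c ∷ [])
      chain-u = link chain-r u²∈ (resp (sym conj-ut) (self∈Extend subD r))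
        (resp (free env (𝐭) (‵ 1 · (‵ 1 ⁻ · 𝐭 · ‵ 1) · ‵ 1 ⁻) ≡.refl) t∈R ∷ resp (sym conj-uc) (∙∈ u²∈
                (inj₁ c∈D)) ∷ [])
        where
        open IsSubgroup subR
        t∈R = t∈ (r ∷ c ∷ [])
        u²∈ = resp (sym e₂) (∙∈ (^∈ (+ 4) t∈R) (inj₁ (inj₁ (t⁸ᴷ∈ K₂))))
      subU = In-isSubgroup subT chain-u
      open IsSubgroup subU
      u∈ : In (Cyclic t) (u ∷ r ∷ c ∷ []) u
      u∈ = self∈Extend subR u
      c∈ : In (Cyclic t) (u ∷ r ∷ c ∷ []) c
      c∈ = inj₁ (inj₁ c∈D)
      t∈u = t∈ (u ∷ r ∷ c ∷ [])
      zt = resp (sym conj-zt) (∙∈ u∈ (⁻¹∈ t∈u))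
      zu = resp (sym conj-zu) (∙∈ t∈u zt)
      zr = resp (conj-r z) (∙∈ (∙∈ (⁻¹∈ zu) zt) zu)
      zc = resp (sym conj-zc) (∙∈ (∙∈ (⁻¹∈ zt) t∈u) c∈)
      subZ : IsSubgroup (In (Cyclic t) (z ∷ u ∷ r ∷ c ∷ []))
      subZ = In-isSubgroup subT (link chain-u (resp (sym z²) ε∈) zt (zu ∷ zr ∷ zc ∷ []))
      module Z = IsSubgroup subZ
      au = Z.resp (sym conj-au) (inj₁ (∙∈ t∈u t∈u))
      at∈ = Z.∙∈ (self∈Extend subU z) (inj₁ t∈u)

-- Parity and congruences between exponents

abstract
  parity : ∀ k → ∃ λ j → k ≡ + 2 ℤ.* j ⊎ k ≡ + 1 ℤ.+ + 2 ℤ.* j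
  parity k with k ℤ.% + 2 in eq | ℤ.n%d<d k (+ 2)
  ... | 0 | _ = k ℤ./ + 2 , inj₁ (≡.trans (ℤ.a≡a%n+[a/n]*n k (+ 2))
                  (≡.trans (≡.cong (λ r → + r ℤ.+ k ℤ./ + 2 ℤ.* + 2) eq) (lemma (k ℤ./ + 2))))
    where
    lemma : ∀ i → + 0 ℤ.+ i ℤ.* + 2 ≡ + 2 ℤ.* i
    lemma = ℤ-solve-∀
  ... | 1 | _ = k ℤ./ + 2 , inj₂ (≡.trans (ℤ.a≡a%n+[a/n]*n k (+ 2))
                  (≡.trans (≡.cong (λ r → + r ℤ.+ k ℤ./ + 2 ℤ.* + 2) eq) (lemma (k ℤ./ + 2))))
    where
    lemma : ∀ i → + 1 ℤ.+ i ℤ.* + 2 ≡ + 1 ℤ.+ + 2 ℤ.* i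
    lemma = ℤ-solve-∀
  ... | suc (suc _) | ℕ.s≤s (ℕ.s≤s ())

odd≢even : ∀ i j → + 1 ℤ.+ + 2 ℤ.* i ≢ + 2 ℤ.* j
odd≢even i j eq = 1≢2n ℤ.∣ j ℤ.- i ∣ (≡.trans (≡.cong ℤ.∣_∣ 1≡) (ℤ.abs-* (+ 2) (j ℤ.- i)))
  where
  lemma₁ : ∀ i → + 1 ≡ + 1 ℤ.+ + 2 ℤ.* i ℤ.- + 2 ℤ.* i
  lemma₁ = ℤ-solve-∀
  lemma₂ : ∀ i j → + 2 ℤ.* j ℤ.- + 2 ℤ.* i ≡ + 2 ℤ.* (j ℤ.- i)
  lemma₂ = ℤ-solve-∀
  1≡ : + 1 ≡ + 2 ℤ.* (j ℤ.- i)
  1≡ = ≡.trans (lemma₁ i) (≡.trans (≡.cong (ℤ._- + 2 ℤ.* i) eq) (lemma₂ i j))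
  1≢2n : ∀ n → 1 ≢ 2 ℕ.* n
  1≢2n (suc n) e = contradiction (≡.trans e (ℕ.+-suc (suc n) (n ℕ.+ 0))) λ ()

-- Each congruence fails by parity once a power of 2 is cancelled.
module Congruences where

  scaled-odd≢even : ∀ k .{{_ : ℤ.NonZero k}} i j → k ℤ.* (+ 1 ℤ.+ + 2 ℤ.* i) ≢ k ℤ.* (+ 2 ℤ.* j)
  scaled-odd≢even k i j eq = odd≢even i j (ℤ.*-cancelˡ-≡ k (+ 1 ℤ.+ + 2 ℤ.* i) (+ 2 ℤ.* j) eq)

  8≢8i[2j]+32m : ∀ i j m → + 8 ≢ + 8 ℤ.* i ℤ.* (+ 2 ℤ.* j) ℤ.+ + 32 ℤ.* m
  8≢8i[2j]+32m i j m eq = scaled-odd≢even (+ 8) (+ 0) (i ℤ.* j ℤ.+ + 2 ℤ.* m) (≡.trans eq (lemma i j m))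
    where
    lemma : ∀ i j m → + 8 ℤ.* i ℤ.* (+ 2 ℤ.* j) ℤ.+ + 32 ℤ.* m ≡ + 8 ℤ.* (+ 2 ℤ.* (i ℤ.* j ℤ.+ + 2 ℤ.* m))
    lemma = ℤ-solve-∀

  -n≢1+n²[8ij+2]+32s : ∀ {n i} j l s → n ≡ + 1 ℤ.+ + 4 ℤ.* (+ 1 ℤ.+ + 2 ℤ.* j) → i ≡ + 1 ℤ.+ + 2 ℤ.* l →
    n ℤ.* ℤ.- (+ 1) ≢ + 1 ℤ.+ n ℤ.* n ℤ.* (+ 8 ℤ.* i ℤ.* j ℤ.+ + 2) ℤ.+ + 32 ℤ.* s
  -n≢1+n²[8ij+2]+32s j l s ≡.refl ≡.refl eq =
    scaled-odd≢even (+ 8) (X j l s) (+ 0) (≡.trans (lemma j l s) (ℤ.i≡j⇒i-j≡0 (≡.sym eq)))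
    where
    X : ℤ → ℤ → ℤ → ℤ
    -- Obtained by expanding the right side minus the left side of the excluded equation as
    -- `8 (1 + 2 X)`.
    X j l s = + 3 ℤ.+ + 23 ℤ.* j ℤ.+ + 25 ℤ.* l ℤ.* j ℤ.+ + 48 ℤ.* j ℤ.* j ℤ.+ + 80 ℤ.* l ℤ.* j ℤ.* j
      ℤ.+ + 32 ℤ.* j ℤ.* j ℤ.* j ℤ.+ + 64 ℤ.* l ℤ.* j ℤ.* j ℤ.* j ℤ.+ + 2 ℤ.* s
    lemma : ∀ j l s → let n = + 1 ℤ.+ + 4 ℤ.* (+ 1 ℤ.+ + 2 ℤ.* j) in
      + 8 ℤ.* (+ 1 ℤ.+ + 2 ℤ.* (+ 3 ℤ.+ + 23 ℤ.* j ℤ.+ + 25 ℤ.* l ℤ.* j ℤ.+ + 48 ℤ.* j ℤ.* j ℤ.+ + 80 ℤ.* l ℤ.*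
              j ℤ.* j
        ℤ.+ + 32 ℤ.* j ℤ.* j ℤ.* j ℤ.+ + 64 ℤ.* l ℤ.* j ℤ.* j ℤ.* j ℤ.+ + 2 ℤ.* s))
      ≡ + 1 ℤ.+ n ℤ.* n ℤ.* (+ 8 ℤ.* (+ 1 ℤ.+ + 2 ℤ.* l) ℤ.* j ℤ.+ + 2) ℤ.+ + 32 ℤ.* s ℤ.- n ℤ.* ℤ.- (+ 1)
    lemma = ℤ-solve-∀

  2[1+4k]-form : ∀ k → + 2 ℤ.* (+ 1 ℤ.+ + 2 ℤ.* (+ 2 ℤ.* k)) ≡ + 2 ℤ.+ + 8 ℤ.* k
  2[1+4k]-form = ℤ-solve-∀

  x+mx+8i≢2+8k : ∀ {x} y d i k → x ≡ + 2 ℤ.* y → x ℤ.+ (+ 1 ℤ.+ + 4 ℤ.* d) ℤ.* x ℤ.+ + 8 ℤ.* i ≢ + 2 ℤ.+ + 8 ℤ.* k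
  x+mx+8i≢2+8k y d i k ≡.refl eq = scaled-odd≢even (+ 2) (+ 2 ℤ.* k) (y ℤ.+ + 2 ℤ.* d ℤ.* y ℤ.+ + 2 ℤ.* i)
    (≡.trans (2[1+4k]-form k) (≡.trans (≡.sym eq) (lemma y d i)))
    where
    lemma : ∀ y d i → + 2 ℤ.* y ℤ.+ (+ 1 ℤ.+ + 4 ℤ.* d) ℤ.* (+ 2 ℤ.* y) ℤ.+ + 8 ℤ.* i ≡ + 2 ℤ.* (+ 2 ℤ.*
            (y ℤ.+ + 2 ℤ.* d ℤ.* y ℤ.+ + 2 ℤ.* i))
    lemma = ℤ-solve-∀

  x-mx≢2+8k : ∀ x d k → x ℤ.+ ℤ.- (+ 1) ℤ.* ((+ 1 ℤ.+ + 4 ℤ.* d) ℤ.* x) ≢ + 2 ℤ.+ + 8 ℤ.* k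
  x-mx≢2+8k x d k eq = scaled-odd≢even (+ 2) (+ 2 ℤ.* k) (ℤ.- (d ℤ.* x))
    (≡.trans (2[1+4k]-form k) (≡.trans (≡.sym eq) (lemma x d)))
    where
    lemma : ∀ x d → x ℤ.+ ℤ.- (+ 1) ℤ.* ((+ 1 ℤ.+ + 4 ℤ.* d) ℤ.* x) ≡ + 2 ℤ.* (+ 2 ℤ.* (ℤ.- (d ℤ.* x)))
    lemma = ℤ-solve-∀

-- Orders of elements and cyclic subgroups of 2-power order

module Orders {ℓ₁ ℓ₂ : Level} (G : Group ℓ₁ ℓ₂) where
  open Group G
  open GroupProperties G
  open SetoidReasoning setoid
  open Rewriting G
  open Powers G
  open Subgroups G

  abstract
    order-divides : ∀ {x n} → HasOrder G x n → ∀ k → x ^ k ≈ ε → ∃ λ m → k ≡ m ℤ.* + n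
    order-divides {x} {n@(suc _)} (_ , x^n , minimal) k x^k with k ℤ.% + n in eq | ℤ.n%d<d k (+ n)
    ... | zero  | _   = k ℤ./ + n , ≡.trans (ℤ.a≡a%n+[a/n]*n k (+ n))
                          (≡.trans (≡.cong (λ r → + r ℤ.+ k ℤ./ + n ℤ.* + n) eq) (ℤ.+-identityˡ _))
    ... | suc r | r<n = contradiction (begin
      x ^ (+ suc r)                                     ≈⟨ identityʳ _ ⟨
      x ^ (+ suc r) ∙ ε                                 ≈⟨ ∙-congˡ (ε^ (k ℤ./ + n)) ⟨
      x ^ (+ suc r) ∙ ε ^ (k ℤ./ + n)                   ≈⟨ ∙-congˡ (^-cong (k ℤ./ + n) x^n) ⟨
      x ^ (+ suc r) ∙ (x ^ + n) ^ (k ℤ./ + n)           ≈⟨ ∙-congˡ (^-homo-* x (+ n) (k ℤ./ + n)) ⟩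
      x ^ (+ suc r) ∙ x ^ (+ n ℤ.* (k ℤ./ + n))         ≈⟨ ^-homo-+ x (+ suc r) (+ n ℤ.* (k ℤ./ + n)) ⟨
      x ^ (+ suc r ℤ.+ + n ℤ.* (k ℤ./ + n))             ≈⟨ ^-≡ x (≡.cong (ℤ._+_ (+ suc r)) (ℤ.*-comm (+ n)
              (k ℤ./ + n))) ⟩
      x ^ (+ suc r ℤ.+ k ℤ./ + n ℤ.* + n)               ≈⟨ ^-≡ x (≡.sym (≡.trans (ℤ.a≡a%n+[a/n]*n k (+ n))
              (≡.cong (λ r → + r ℤ.+ k ℤ./ + n ℤ.* + n) eq))) ⟩
      x ^ k                                             ≈⟨ x^k ⟩
      ε                                                 ∎) (minimal (suc r) (ℕ.s≤s ℕ.z≤n) r<n)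

  Cyclic-commutes : ∀ {t x y} → Cyclic t x → Cyclic t y → Commutes x y
  Cyclic-commutes {t} (i , p) (j , q) = commutes-resp (sym p) (sym q) (commutes-^^ t i j)

  commutes-Cyclic : ∀ {g t x} → Commutes g t → Cyclic t x → Commutes g x
  commutes-Cyclic gt (i , p) = commutes-resp refl (sym p) (commutes-^ i gt)

  -- The successive squares `t, t², t⁴, …` as links over the trivial subgroup: membership reads off
  -- the binary expansion of an exponent. This puts `⟨t⟩` into the form to which the counting of
  -- cosets applies.
  powers : Carrier → ℕ → List Carrier
  powers t zero    = []
  powers t (suc q) = t ∷ powers (t ∙ t) q

  length-powers : ∀ t q → length (powers t q) ≡ q
  length-powers t zero    = ≡.refl
  length-powers t (suc q) = ≡.cong suc (length-powers (t ∙ t) q)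

  square-^ : ∀ t k → (t ∙ t) ^ k ≈ t ^ (+ 2 ℤ.* k)
  square-^ t k = trans (^-cong k (∙-congˡ (sym (identityʳ t)))) (^-homo-* t (+ 2) k)

  powers⇒Cyclic : ∀ t q {x} → In Trivial (powers t q) x → Cyclic t x
  powers⇒Cyclic t zero    p        = + 0 , p
  powers⇒Cyclic t (suc q) (inj₁ p) = let k , e = powers⇒Cyclic (t ∙ t) q p in + 2 ℤ.* k , trans e (square-^ t k)
  powers⇒Cyclic t (suc q) {x} (inj₂ p) = let k , e = powers⇒Cyclic (t ∙ t) q p in ℤ.suc (+ 2 ℤ.* k) , (begin
    x                          ≈⟨ //-rightDividesˡ t x ⟨
    x ∙ t ⁻¹ ∙ t               ≈⟨ ∙-congʳ (trans e (square-^ t k)) ⟩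
    t ^ (+ 2 ℤ.* k) ∙ t        ≈⟨ commutes-^ (+ 2 ℤ.* k) refl ⟨
    t ∙ t ^ (+ 2 ℤ.* k)        ≈⟨ ^-suc t (+ 2 ℤ.* k) ⟨
    t ^ ℤ.suc (+ 2 ℤ.* k)      ∎)

  powers-resp : ∀ t q {x y} → x ≈ y → In Trivial (powers t q) x → In Trivial (powers t q) y
  powers-resp t zero    e p        = trans (sym e) p
  powers-resp t (suc q) e (inj₁ p) = inj₁ (powers-resp (t ∙ t) q e p)
  powers-resp t (suc q) e (inj₂ p) = inj₂ (powers-resp (t ∙ t) q (∙-congʳ e) p)

  square-gpow : ∀ t n → gpow G (t ∙ t) n ≈ gpow G t (2 ℕ.* n)
  square-gpow t n = trans (square-^ t (+ n)) (^-≡ t (≡.sym (ℤ.pos-* 2 n)))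

  Cyclic⇒powers : ∀ t q → gpow G t (2 ℕ.^ q) ≈ ε → ∀ {x} → Cyclic t x → In Trivial (powers t q) x
  Cyclic⇒powers t zero    t^1 (k , p) = trans p (trans (^-cong k (trans (sym (identityʳ t)) t^1)) (ε^ k))
  Cyclic⇒powers t (suc q) t^Q {x} (k , p) with parity k
  ... | j , inj₁ k≡ = inj₁ (Cyclic⇒powers (t ∙ t) q (trans (square-gpow t (2 ℕ.^ q)) t^Q)
                        (j , trans p (trans (^-≡ t k≡) (sym (square-^ t j)))))
  ... | j , inj₂ k≡ = inj₂ (Cyclic⇒powers (t ∙ t) q (trans (square-gpow t (2 ℕ.^ q)) t^Q) (j , (begin
    x ∙ t ⁻¹                       ≈⟨ ∙-congʳ (trans p (trans (^-≡ t k≡) (^-suc t (+ 2 ℤ.* j)))) ⟩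
    t ∙ t ^ (+ 2 ℤ.* j) ∙ t ⁻¹     ≈⟨ commutes⇒conj (commutes-^ (+ 2 ℤ.* j) refl) ⟩
    t ^ (+ 2 ℤ.* j)                ≈⟨ square-^ t j ⟨
    (t ∙ t) ^ j                    ∎)))

  order-square : ∀ {t} q → HasOrder G t (2 ℕ.^ suc q) → HasOrder G (t ∙ t) (2 ℕ.^ q)
  order-square {t} q (_ , t^Q , minimal) = ℕ.m^n>0 2 q , trans (square-gpow t (2 ℕ.^ q)) t^Q ,
    λ m 0<m m<Q e → minimal (2 ℕ.* m) (ℕ.*-monoʳ-< 2 0<m) (ℕ.*-monoʳ-< 2 m<Q) (trans (sym (square-gpow t m)) e)

  module _ {N : ℕ} (card : HasCard G N) where
    open TwoGroups G card

    powers-strict : ∀ t q → HasOrder G t (2 ℕ.^ q) → Strict (powers t q)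
    powers-strict t zero    o = []
    powers-strict t (suc q) o = (extends square normal , t∉) ∷ powers-strict (t ∙ t) q o²
      where
      o² = order-square q o
      square : In Trivial (powers (t ∙ t) q) (t ∙ t)
      square = Cyclic⇒powers (t ∙ t) q (proj₁ (proj₂ o²)) (+ 1 , sym (identityʳ _))
      normal : ∀ {x} → In Trivial (powers (t ∙ t) q) x → In Trivial (powers (t ∙ t) q) (conj t x)
      normal p = powers-resp (t ∙ t) q (sym (commutes⇒conj
        (commutes-Cyclic (commutes-∙ refl refl) (powers⇒Cyclic (t ∙ t) q p)))) p
      -- If `t` were `t^(2j)`, its even order would divide the odd number `1 - 2j`.
      t∉ : ¬ In Trivial (powers (t ∙ t) q) t
      t∉ p with powers⇒Cyclic (t ∙ t) q p
      ... | j , e with order-divides o (+ 1 ℤ.- + 2 ℤ.* j) (begin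
          t ^ (+ 1 ℤ.- + 2 ℤ.* j)               ≈⟨ ^-homo-+ t (+ 1) (ℤ.- (+ 2 ℤ.* j)) ⟩
          t ^ + 1 ∙ t ^ (ℤ.- (+ 2 ℤ.* j))       ≈⟨ ∙-cong (trans (identityʳ t) (trans e (square-^ t j)))
                  (^-neg t (+ 2 ℤ.* j)) ⟩
          t ^ (+ 2 ℤ.* j) ∙ (t ^ (+ 2 ℤ.* j)) ⁻¹ ≈⟨ inverseʳ _ ⟩
          ε                                     ∎)
      ...   | m , eq = odd≢even (ℤ.- j) (m ℤ.* + (2 ℕ.^ q)) (≡.trans (lemma₁ j) (≡.trans eq
                (≡.trans (≡.cong (m ℤ.*_) (ℤ.pos-* 2 (2 ℕ.^ q))) (lemma₂ m (+ (2 ℕ.^ q))))))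
        where
        lemma₁ : ∀ j → + 1 ℤ.+ + 2 ℤ.* (ℤ.- j) ≡ + 1 ℤ.- + 2 ℤ.* j
        lemma₁ = ℤ-solve-∀
        lemma₂ : ∀ m k → m ℤ.* (+ 2 ℤ.* k) ≡ + 2 ℤ.* (m ℤ.* k)
        lemma₂ = ℤ-solve-∀

-- From the type to the relators

module Classification {ℓ₁ ℓ₂ : Level} (G : Group ℓ₁ ℓ₂) (a b c : Group.Carrier G)
  (rels : Coxeter.CoxeterRelations G a b c) (q P : ℕ) .{{_ : ℕ.NonZero P}} (Q≡32P : 2 ℕ.^ q ≡ 32 ℕ.* P)
  (order : HasOrder G (Coxeter.t G a b c) (2 ℕ.^ q)) where
  open Group G
  open GroupProperties G
  open SetoidReasoning setoid
  open Rewriting G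
  open Powers G
  open Subgroups G
  open Orders G
  open Coxeter G a b c
  open Relations rels
  open CoxeterRelations rels
  open Congruences

  Q half : ℕ
  Q = 2 ℕ.^ q
  half = 16 ℕ.* P

  T : Carrier → Set ℓ₂
  T = Cyclic t

  module T = IsSubgroup (Cyclic-isSubgroup t)

  t∈T : T t
  t∈T = + 1 , sym (identityʳ t)

  t^Q : t ^ + Q ≈ ε
  t^Q = proj₁ (proj₂ order)

  Q≡2half : Q ≡ 2 ℕ.* half
  Q≡2half = ≡.trans Q≡32P (lemma P)
    where
    lemma : ∀ m → 32 ℕ.* m ≡ 2 ℕ.* (16 ℕ.* m)
    lemma = ℕ-solve-∀

  t^≉ε : ∀ m .{{_ : ℕ.NonZero m}} → m ℕ.< 32 → ¬ gpow G t m ≈ ε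
  t^≉ε m m<32 = proj₂ (proj₂ order) m (ℕ.>-nonZero⁻¹ m)
    (ℕ.<-≤-trans m<32 (≡.subst (32 ℕ.≤_) (≡.sym Q≡32P) (ℕ.m≤m*n 32 P)))

  w^ : ∀ k → conj a (t ^ k) ≈ w ^ k
  w^ k = trans (conj-^ a t k) (^-cong k conj-at)

  t^ : ∀ k → conj a (w ^ k) ≈ t ^ k
  t^ k = trans (conj-^ a w k) (^-cong k conj-aw)

  conj-≉ε : ∀ g {x} → ¬ x ≈ ε → ¬ conj g x ≈ ε
  conj-≉ε g {x} x≉ε e = x≉ε (begin
    x                          ≈⟨ free (g ∷ x ∷ []) (‵ 1) (‵ 0 ⁻ · (‵ 0 · ‵ 1 · ‵ 0 ⁻) · ‵ 0) ≡.refl ⟩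
    g ⁻¹ ∙ conj g x ∙ g        ≈⟨ ∙-congʳ (∙-congˡ e) ⟩
    g ⁻¹ ∙ ε ∙ g               ≈⟨ free (g ∷ []) (‵ 0 ⁻ · 𝟏 · ‵ 0) 𝟏 ≡.refl ⟩
    ε                          ∎)

  w^≉ε : ∀ m .{{_ : ℕ.NonZero m}} → m ℕ.< 32 → ¬ gpow G w m ≈ ε
  w^≉ε m m<32 e = conj-≉ε a (t^≉ε m m<32) (trans (w^ (+ m)) e)

  abstract
    -- Weakened from the order of `t` to its divisor 32, a constant for which the congruences can be
    -- refuted.
    exponents : ∀ i j → t ^ i ≈ t ^ j → ∃ λ m → i ≡ j ℤ.+ + 32 ℤ.* m
    exponents i j e with order-divides order (i ℤ.- j) (begin
      t ^ (i ℤ.- j)           ≈⟨ ^-homo-+ t i (ℤ.- j) ⟩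
      t ^ i ∙ t ^ (ℤ.- j)     ≈⟨ ∙-cong e (^-neg t j) ⟩
      t ^ j ∙ (t ^ j) ⁻¹      ≈⟨ inverseʳ _ ⟩
      ε                       ∎)
    ... | m , eq = m ℤ.* + P , ≡.trans (lemma₁ i j) (≡.trans (≡.cong (ℤ._+_ j) (≡.trans eq
          (≡.cong (m ℤ.*_) (≡.trans (≡.cong +_ Q≡32P) (ℤ.pos-* 32 P))))) (lemma₂ j m (+ P)))
      where
      lemma₁ : ∀ i j → i ≡ j ℤ.+ (i ℤ.- j)
      lemma₁ = ℤ-solve-∀
      lemma₂ : ∀ j m k → j ℤ.+ m ℤ.* (+ 32 ℤ.* k) ≡ j ℤ.+ + 32 ℤ.* (m ℤ.* k)
      lemma₂ = ℤ-solve-∀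

  -- Conjugating w ^ N ≈ t ^ (N * i) by the involution a gives t ^ N ≈ w ^ (N * i).
  abstract
    exchange : ∀ N M .{{_ : ℕ.NonZero M}} → Q ≡ N ℕ.* M → T (w ^ + N) →
               ∃ λ i → w ^ + N ≈ t ^ (+ N ℤ.* i) × t ^ + N ≈ w ^ (+ N ℤ.* i)
    exchange N M Q≡NM (k , e) with order-divides order (k ℤ.* + M) (begin
      t ^ (k ℤ.* + M)       ≈⟨ ^-homo-* t k (+ M) ⟨
      (t ^ k) ^ + M         ≈⟨ ^-cong (+ M) e ⟨
      (w ^ + N) ^ + M       ≈⟨ ^-homo-* w (+ N) (+ M) ⟩
      w ^ (+ N ℤ.* + M)     ≈⟨ ^-≡ w (≡.trans (≡.sym (ℤ.pos-* N M)) (≡.cong +_ (≡.sym Q≡NM))) ⟩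
      w ^ + Q               ≈⟨ w^ (+ Q) ⟨
      conj a (t ^ + Q)      ≈⟨ conj-cong refl t^Q ⟩
      conj a ε              ≈⟨ conj-ε a ⟩
      ε                     ∎)
    ... | i , eq = i , trans e (^-≡ t k≡Ni) ,
          trans (sym (t^ (+ N))) (trans (conj-cong refl e) (trans (w^ k) (^-≡ w k≡Ni)))
      where
      lemma : ∀ i n m → i ℤ.* (n ℤ.* m) ≡ n ℤ.* i ℤ.* m
      lemma = ℤ-solve-∀
      k≡Ni : k ≡ + N ℤ.* i
      k≡Ni = ℤ.*-cancelʳ-≡ k (+ N ℤ.* i) (+ M) (≡.trans eq (≡.trans (≡.cong (i ℤ.*_)
               (≡.trans (≡.cong +_ Q≡NM) (ℤ.pos-* N M))) (lemma i (+ N) (+ M))))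

  -- By `exchange`, `t^N` is itself a power of `w`.
  exchange-commutes : ∀ N M .{{_ : ℕ.NonZero M}} → Q ≡ N ℕ.* M → T (w ^ + N) → Commutes w (t ^ + N)
  exchange-commutes N M Q≡NM w∈ =
    let i , _ , e = exchange N M Q≡NM w∈ in commutes-resp refl (sym e) (commutes-^ (+ N ℤ.* i) refl)

  commutes-w⇒z : ∀ {x} → T x → Commutes w x → Commutes z x
  commutes-w⇒z x∈ wx = sym (commutes-tw⇒z (sym (commutes-Cyclic refl x∈)) (sym wx))

  -- From `2k = mQ` follows `k = m (Q/2)`, and the parity of `m` decides. That `⟨t⟩` has a single
  -- involution is the source of the two choices for each commutator relator.
  T-involution : ∀ {x} → T x → x ∙ x ≈ ε → x ≈ ε ⊎ x ≈ gpow G t half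
  T-involution {x} (k , e) x² with order-divides order (k ℤ.+ k) (trans (^-homo-+ t k k) (trans (sym
          (∙-cong e e)) x²))
  ... | m , eq = [ inj₁ ∘ even , inj₂ ∘ odd ]′ (proj₂ (parity m))
    where
    lemma₁ : ∀ k → + 2 ℤ.* k ≡ k ℤ.+ k
    lemma₁ = ℤ-solve-∀
    lemma₂ : ∀ m h → m ℤ.* (+ 2 ℤ.* h) ≡ + 2 ℤ.* (m ℤ.* h)
    lemma₂ = ℤ-solve-∀
    lemma₃ : ∀ j h → (+ 2 ℤ.* j) ℤ.* h ≡ + 2 ℤ.* h ℤ.* j
    lemma₃ = ℤ-solve-∀
    lemma₄ : ∀ j h → (+ 1 ℤ.+ + 2 ℤ.* j) ℤ.* h ≡ h ℤ.+ + 2 ℤ.* h ℤ.* j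
    lemma₄ = ℤ-solve-∀
    j = proj₁ (parity m)
    +Q≡ : + Q ≡ + 2 ℤ.* + half
    +Q≡ = ≡.trans (≡.cong +_ Q≡2half) (ℤ.pos-* 2 half)
    k≡ : k ≡ m ℤ.* + half
    k≡ = ℤ.*-cancelˡ-≡ (+ 2) k (m ℤ.* + half) (≡.trans (lemma₁ k) (≡.trans eq
           (≡.trans (≡.cong (m ℤ.*_) +Q≡) (lemma₂ m (+ half)))))
    t^Qj : t ^ (+ 2 ℤ.* + half ℤ.* j) ≈ ε
    t^Qj = trans (^-≡ t (≡.cong (ℤ._* j) (≡.sym +Q≡)))
             (trans (sym (^-homo-* t (+ Q) j)) (trans (^-cong j t^Q) (ε^ j)))
    even : m ≡ + 2 ℤ.* j → x ≈ ε
    even m≡ = trans e (trans (^-≡ t (≡.trans k≡ (≡.trans (≡.cong (ℤ._* + half) m≡) (lemma₃ j (+ half))))) t^Qj)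
    odd : m ≡ + 1 ℤ.+ + 2 ℤ.* j → x ≈ gpow G t half
    odd m≡ = trans e (trans (^-≡ t (≡.trans k≡ (≡.trans (≡.cong (ℤ._* + half) m≡) (lemma₄ j (+ half)))))
               (trans (^-homo-+ t (+ half) (+ 2 ℤ.* + half ℤ.* j)) (trans (∙-congˡ t^Qj) (identityʳ _))))

  c∉T : ¬ T c
  c∉T c∈ = t^≉ε 2 (ℕ.s≤s (ℕ.s≤s (ℕ.s≤s ℕ.z≤n))) (begin
    t ∙ (t ∙ ε)          ≈⟨ ∙-congʳ (commutes⇒conj (Cyclic-commutes c∈ t∈T)) ⟨
    conj c t ∙ (t ∙ ε)   ≈⟨ coxeter (𝐜 · 𝐭 · 𝐜 ⁻ · (𝐭 · 𝟏)) 𝟏 ≡.refl ⟩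
    ε                    ∎)

  module _ {N : ℕ} (card : HasCard G N) where
    open TwoGroups G card

    ds : List Carrier
    ds = c ∷ powers t q

    D : Carrier → Set ℓ₂
    D = In Trivial ds

    T⇒D : ∀ {x} → T x → D x
    T⇒D x∈ = inj₁ (Cyclic⇒powers t q t^Q x∈)

    D⇒T : ∀ {x} → D x → T x ⊎ T (x ∙ c ⁻¹)
    D⇒T = [ inj₁ ∘ powers⇒Cyclic t q , inj₂ ∘ powers⇒Cyclic t q ]′

    reflection : ∀ {x} → T (x ∙ c ⁻¹) → x ∙ x ≈ ε
    reflection {x} (k , e) = begin
      x ∙ x                             ≈⟨ ∙-cong x≈ x≈ ⟩
      t ^ k ∙ c ∙ (t ^ k ∙ c)           ≈⟨ rewriting env (involution env 1 c²) (‵ 0 · ‵ 1 · (‵ 0 · ‵ 1))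
              (‵ 0 · (‵ 1 · ‵ 0 · ‵ 1 ⁻)) ≡.refl ⟩
      t ^ k ∙ conj c (t ^ k)            ≈⟨ ∙-congˡ (trans (conj-^ c t k) (^-cong k conj-ct)) ⟩
      t ^ k ∙ (t ⁻¹) ^ k                ≈⟨ ∙-congˡ (trans (^-cong k (⁻¹-cong (sym (identityʳ t)))) (^-homo-* t
              (ℤ.- (+ 1)) k)) ⟩
      t ^ k ∙ t ^ (ℤ.- (+ 1) ℤ.* k)     ≈⟨ ^-homo-+ t k (ℤ.- (+ 1) ℤ.* k) ⟨
      t ^ (k ℤ.+ ℤ.- (+ 1) ℤ.* k)       ≈⟨ ^-≡ t (lemma k) ⟩
      ε                                 ∎
      where
      env = t ^ k ∷ c ∷ []
      x≈ = trans (sym (//-rightDividesˡ c x)) (∙-congʳ e)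
      lemma : ∀ k → k ℤ.+ ℤ.- (+ 1) ℤ.* k ≡ + 0
      lemma = ℤ-solve-∀

    -- The elements of `D` outside `⟨t⟩` are reflections, whose squares are trivial. This is how
    -- each descent into `D` is sharpened to `⟨t⟩`.
    D-nonreflection : ∀ {x} → D x → ¬ x ∙ x ≈ ε → T x
    D-nonreflection x∈ x²≉ with D⇒T x∈
    ... | inj₁ y = y
    ... | inj₂ y = contradiction (reflection y) x²≉

    D-strict : Strict ds
    D-strict = (extends (powers-resp t q (sym c²) (Cyclic⇒powers t q t^Q T.ε∈))
                 (λ x∈ → Cyclic⇒powers t q t^Q
                   (Cyclic-conj (Cyclic-isSubgroup t) (T.resp (sym conj-ct) (T.⁻¹∈ t∈T)) (powers⇒Cyclic t q x∈)))
               , c∉T ∘ powers⇒Cyclic t q) ∷ powers-strict card t q order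

    module D = IsSubgroup (strict-isSubgroup D-strict)

    D-tower : ∀ k → N ≡ 2 ℕ.^ (k ℕ.+ suc q) → Tower k D
    D-tower k N≡ = tower k D-strict (≡.trans N≡ (≡.cong (λ l → 2 ℕ.^ (k ℕ.+ suc l)) (≡.sym (length-powers t q))))

    t∈D : D t
    t∈D = T⇒D t∈T

    w∈ : ∀ {P₁ P₂} → IndexTwo P₁ P₂ → P₁ t → P₂ a → P₁ w
    w∈ i t∈ a∈ = IsSubgroup.resp (IndexTwo.isSubgroup i) conj-at (IndexTwo.normal i a∈ t∈)

    D-power∈T : ∀ m {x} → x ≈ w ^ + m → .{{_ : ℕ.NonZero m}} → m ℕ.+ m ℕ.< 32 → D x → T x
    D-power∈T m@(suc _) {x} x≈ 2m<32 x∈ = D-nonreflection x∈ λ e → w^≉ε (m ℕ.+ m) 2m<32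
      (trans (^-homo-+ w (+ m) (+ m)) (trans (sym (∙-cong x≈ x≈)) e))

    divisor : ∀ k m → 32 ≡ k ℕ.* m → Q ≡ k ℕ.* (m ℕ.* P)
    divisor k m e = ≡.trans Q≡32P (≡.trans (≡.cong (ℕ._* P) e) (ℕ.*-assoc k m P))

    -- With two steps, `w ∈ D₁` and `u = w² ∈ D`, hence `u ∈ ⟨t⟩`. Then `z c z c = t u⁻¹ t` lies in
    -- `⟨t⟩`, and it squares to `ε` because `u t⁻¹ = z t z` and `z` commutes with `t²`.
    case₁ : Tower 2 D → z ∙ c ∙ z ∙ c ≈ ε ⊎ z ∙ c ∙ z ∙ c ≈ gpow G t half
    case₁ (step {P′ = D₁} i₁ (step i₂ (top full))) =
      T-involution (T.resp (sym zczc) (T.∙∈ (T.∙∈ t∈T (T.⁻¹∈ u∈T)) t∈T)) (trans (∙-cong zczc zczc) square)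
      where
      zczc : z ∙ c ∙ z ∙ c ≈ t ∙ u ⁻¹ ∙ t
      zczc = coxeter (𝐳 · 𝐜 · 𝐳 · 𝐜) (𝐭 · 𝐮 ⁻ · 𝐭) ≡.refl
      u≈ : u ≈ w ^ + 2
      u≈ = ∙-congˡ (sym (identityʳ w))
      u∈T : T u
      u∈T = D-power∈T 2 u≈ (ℕ.m≤m+n 5 27) (IndexTwo.square i₁ (w∈ i₂ (IndexTwo.included i₁ t∈D) (full a)))
      zt² : Commutes z (t ^ + 2)
      zt² = commutes-w⇒z (T.gpow∈ 2 t∈T)
              (exchange-commutes 2 (16 ℕ.* P) {{ℕ.m*n≢0 16 P}} (divisor 2 16 ≡.refl) (T.resp u≈ u∈T))
      env = t ∷ z ∷ u ∷ []
      square : t ∙ u ⁻¹ ∙ t ∙ (t ∙ u ⁻¹ ∙ t) ≈ ε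
      square = begin
        t ∙ u ⁻¹ ∙ t ∙ (t ∙ u ⁻¹ ∙ t)             ≈⟨ rewriting env (commuting env 2 0
                (Cyclic-commutes u∈T t∈T)) (𝐭 · ‵ 2 ⁻ · 𝐭 · (𝐭 · ‵ 2 ⁻ · 𝐭)) (pow 𝐭 2 · (‵ 2 · 𝐭 ⁻ ·
                (‵ 2 · 𝐭 ⁻)) ⁻) ≡.refl ⟩
        t ^ + 2 ∙ (u ∙ t ⁻¹ ∙ (u ∙ t ⁻¹)) ⁻¹      ≈⟨ ∙-congˡ (⁻¹-cong (coxeter (𝐮 · 𝐭 ⁻ · (𝐮 · 𝐭 ⁻))
                (𝐳 · pow 𝐭 2 · 𝐳 ⁻) ≡.refl)) ⟩
        t ^ + 2 ∙ conj z (t ^ + 2) ⁻¹             ≈⟨ ∙-congˡ (⁻¹-cong (commutes⇒conj zt²)) ⟩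
        t ^ + 2 ∙ (t ^ + 2) ⁻¹                    ≈⟨ inverseʳ _ ⟩
        ε                                         ∎

    -- With three steps `u` reaches only `D₁`, so it normalises `D`, and both `u²` and `u t u⁻¹`
    -- fall into `⟨t⟩`. The element `z t⁻² z` is a product of these, `t` and their inverses. The
    -- commutator squares to `ε` because `z` commutes with `t⁴`.
    case₂ : Tower 3 D → let x = z ∙ (t ∙ t) ⁻¹ ∙ z ∙ (t ∙ t) in x ≈ ε ⊎ x ≈ gpow G t half
    case₂ (step {P′ = D₁} i₁ (step i₂ (step i₃ (top full)))) = T-involution x∈T x²
      where
      u∈D₁ : D₁ u
      u∈D₁ = IndexTwo.square i₂ (w∈ i₃ (IndexTwo.included i₂ (IndexTwo.included i₁ t∈D)) (full a))
      u²≈ : u ∙ u ≈ w ^ + 4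
      u²≈ = free tzac (𝐮 · 𝐮) (pow 𝐰 4) ≡.refl
      u²∈T : T (u ∙ u)
      u²∈T = D-power∈T 4 u²≈ (ℕ.m≤m+n 9 23) (IndexTwo.square i₁ u∈D₁)
      ut∈T : T (conj u t)
      ut∈T = D-nonreflection (IndexTwo.normal i₁ u∈D₁ t∈D) λ e →
        conj-≉ε u (t^≉ε 2 (ℕ.m≤m+n 3 29)) (trans (conj-gpow u t 2) (trans (∙-congˡ (identityʳ _)) e))
      zt⁴ : Commutes z (t ^ + 4)
      zt⁴ = commutes-w⇒z (T.gpow∈ 4 t∈T)
              (exchange-commutes 4 (8 ℕ.* P) {{ℕ.m*n≢0 8 P}} (divisor 4 8 ≡.refl) (T.resp u²≈ u²∈T))
      y = z ∙ (t ∙ t) ⁻¹ ∙ z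
      y∈T : T y
      y∈T = T.resp (coxeter (((𝐮 · 𝐭 · 𝐮 ⁻) ⁻ · (𝐮 · 𝐮) · 𝐭 ⁻) ⁻) (𝐳 · (𝐭 · 𝐭) ⁻ · 𝐳) ≡.refl)
              (T.⁻¹∈ (T.∙∈ (T.∙∈ (T.⁻¹∈ ut∈T) u²∈T) (T.⁻¹∈ t∈T)))
      x∈T : T (y ∙ (t ∙ t))
      x∈T = T.∙∈ y∈T (T.∙∈ t∈T t∈T)
      x² : y ∙ (t ∙ t) ∙ (y ∙ (t ∙ t)) ≈ ε
      x² = begin
        y ∙ (t ∙ t) ∙ (y ∙ (t ∙ t))     ≈⟨ rewriting env (commuting env 1 0 (Cyclic-commutes y∈T t∈T)) (‵ 1 ·
                (𝐭 · 𝐭) · (‵ 1 · (𝐭 · 𝐭))) (‵ 1 · ‵ 1 · pow 𝐭 4) ≡.refl ⟩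
        y ∙ y ∙ t ^ + 4                 ≈⟨ coxeter (𝐳 · (𝐭 · 𝐭) ⁻ · 𝐳 · (𝐳 · (𝐭 · 𝐭) ⁻ · 𝐳) · pow 𝐭 4)
                ((𝐳 · pow 𝐭 4 · 𝐳 ⁻) ⁻ · pow 𝐭 4) ≡.refl ⟩
        conj z (t ^ + 4) ⁻¹ ∙ t ^ + 4   ≈⟨ ∙-congʳ (⁻¹-cong (commutes⇒conj zt⁴)) ⟩
        (t ^ + 4) ⁻¹ ∙ t ^ + 4          ≈⟨ inverseˡ _ ⟩
        ε                               ∎
        where env = t ∷ y ∷ []

    -- This is where n ≥ 10 is needed: the exponents of t are compared modulo 32.
    module Impossible {D₁ : Carrier → Set ℓ₂} (i₁ : IndexTwo D D₁) (u²∈D₁ : D₁ (u ∙ u))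
                      (ut∈D₁ : D₁ (conj u t)) (u²∉D : ¬ D (u ∙ u)) where

      u²∉T : ¬ T (u ∙ u)
      u²∉T = u²∉D ∘ T⇒D

      u⁴ : Carrier
      u⁴ = u ∙ u ∙ (u ∙ u)
      u⁴≈w⁸ : u⁴ ≈ w ^ + 8
      u⁴≈w⁸ = free tzac (𝐮 · 𝐮 · (𝐮 · 𝐮)) (pow 𝐰 8) ≡.refl
      u⁴∈T : T u⁴
      u⁴∈T = D-power∈T 8 u⁴≈w⁸ (ℕ.m≤m+n 17 15) (IndexTwo.square i₁ u²∈D₁)

      abstract
        w⁸-t⁸ : ∃ λ i → w ^ + 8 ≈ t ^ (+ 8 ℤ.* i) × t ^ + 8 ≈ w ^ (+ 8 ℤ.* i)
        w⁸-t⁸ = exchange 8 (4 ℕ.* P) {{ℕ.m*n≢0 4 P}} (divisor 8 4 ≡.refl) (T.resp u⁴≈w⁸ u⁴∈T)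
      i : ℤ
      i = proj₁ w⁸-t⁸
      u⁴≈ : u⁴ ≈ t ^ (+ 8 ℤ.* i)
      u⁴≈ = trans u⁴≈w⁸ (proj₁ (proj₂ w⁸-t⁸))
      wt⁸ : Commutes w (t ^ + 8)
      wt⁸ = commutes-resp refl (sym (proj₂ (proj₂ w⁸-t⁸))) (commutes-^ (+ 8 ℤ.* i) refl)
      ut⁸ : Commutes u (t ^ + 8)
      ut⁸ = sym (commutes-∙ (sym wt⁸) (sym wt⁸))
      u²t⁸ : Commutes (u ∙ u) (t ^ + 8)
      u²t⁸ = sym (commutes-∙ (sym ut⁸) (sym ut⁸))

      -- Using both equations of `exchange` in turn gives `t⁸ = t^(8 i²)`, which an even `i` would
      -- contradict modulo 32.
      i-odd : ∃ λ j → i ≡ + 1 ℤ.+ + 2 ℤ.* j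
      i-odd with parity i
      ... | j , inj₂ e = j , e
      ... | j , inj₁ e with exponents (+ 8) (+ 8 ℤ.* i ℤ.* i) (begin
          t ^ + 8                     ≈⟨ proj₂ (proj₂ w⁸-t⁸) ⟩
          w ^ (+ 8 ℤ.* i)             ≈⟨ ^-homo-* w (+ 8) i ⟨
          (w ^ + 8) ^ i               ≈⟨ ^-cong i (proj₁ (proj₂ w⁸-t⁸)) ⟩
          (t ^ (+ 8 ℤ.* i)) ^ i       ≈⟨ ^-homo-* t (+ 8 ℤ.* i) i ⟩
          t ^ (+ 8 ℤ.* i ℤ.* i)       ∎)
      ...   | m , eq = ⊥-elim (8≢8i[2j]+32m i j m (≡.trans eq (≡.cong (λ l → + 8 ℤ.* i ℤ.* l ℤ.+ + 32 ℤ.* m) e)))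

      conj-t^ : ∀ {g} m → conj g t ≈ t ^ m → ∀ k → conj g (t ^ k) ≈ t ^ (m ℤ.* k)
      conj-t^ {g} m e k = trans (conj-^ g t k) (trans (^-cong k e) (^-homo-* t m k))

      conj-t²^ : ∀ {g} m → conj g (t ∙ t) ≈ t ^ m → ∀ k → conj g (t ^ (+ 2 ℤ.* k)) ≈ t ^ (m ℤ.* k)
      conj-t²^ {g} m e k = trans (conj-cong refl (sym (square-^ t k))) (trans (conj-^ g (t ∙ t) k) (trans
              (^-cong k e) (^-homo-* t m k)))

      -- An automorphism of ⟨t⟩ fixing t⁸ is 1 modulo 4, because t has order divisible by 32.
      1-mod-4 : ∀ {g} m → Commutes g (t ^ + 8) → conj g t ≈ t ^ m → ∃ λ k → m ≡ + 1 ℤ.+ + 4 ℤ.* k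
      1-mod-4 {g} m gt⁸ e with exponents (m ℤ.* + 8) (+ 8) (trans (sym (conj-t^ m e (+ 8))) (commutes⇒conj gt⁸))
      ... | k , eq = k , ℤ.*-cancelʳ-≡ m _ (+ 8) (≡.trans eq (lemma k))
        where
        lemma : ∀ k → + 8 ℤ.+ + 32 ℤ.* k ≡ (+ 1 ℤ.+ + 4 ℤ.* k) ℤ.* + 8
        lemma = ℤ-solve-∀

      2-mod-8 : ∀ {g} m → Commutes g (t ^ + 8) → conj g (t ∙ t) ≈ t ^ m → ∃ λ k → m ≡ + 2 ℤ.+ + 8 ℤ.* k
      2-mod-8 {g} m gt⁸ e with exponents (m ℤ.* + 4) (+ 8) (trans (sym (conj-t²^ m e (+ 4))) (commutes⇒conj gt⁸))
      ... | k , eq = k , ℤ.*-cancelʳ-≡ m _ (+ 4) (≡.trans eq (lemma k))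
        where
        lemma : ∀ k → + 8 ℤ.+ + 32 ℤ.* k ≡ (+ 2 ℤ.+ + 8 ℤ.* k) ℤ.* + 4
        lemma = ℤ-solve-∀

      abstract
        u²t : ∃ λ m → conj (u ∙ u) t ≈ t ^ (+ 1 ℤ.+ + 4 ℤ.* m)
        u²t with D-nonreflection (IndexTwo.normal i₁ u²∈D₁ t∈D) (λ e →
                   conj-≉ε (u ∙ u) (t^≉ε 2 (ℕ.m≤m+n 3 29)) (trans (conj-gpow (u ∙ u) t 2) (trans (∙-congˡ
                           (identityʳ _)) e)))
        ... | m , e = let k , eq = 1-mod-4 m u²t⁸ e in k , trans e (^-≡ t eq)
      m : ℤ
      m = + 1 ℤ.+ + 4 ℤ.* proj₁ u²t

      -- Here u normalises ⟨t⟩, so t² normalises ⟨w⟩, with the same exponent.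
      rotation-exponent : ∀ n d → conj u t ≈ t ^ n → n ≢ + 1 ℤ.+ + 4 ℤ.* d
      rotation-exponent n d e n≡ = [ even , odd ]′ (proj₂ (parity d))
        where
        j = proj₁ (parity d)
        U = (u ∙ u) ^ d
        ttw : t ∙ t ∙ w ≈ w ∙ U ∙ (t ∙ t)
        ttw = conj⇒commutes (begin
          conj (t ∙ t) w                          ≈⟨ conj-cong conj-au conj-at ⟨
          conj (conj a u) (conj a t)              ≈⟨ free (a ∷ u ∷ t ∷ []) (‵ 0 · ‵ 1 · ‵ 0 ⁻ ·
                  (‵ 0 · ‵ 2 · ‵ 0 ⁻) · (‵ 0 · ‵ 1 · ‵ 0 ⁻) ⁻) (‵ 0 · (‵ 1 · ‵ 2 · ‵ 1 ⁻) · ‵ 0 ⁻) ≡.refl ⟩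
          conj a (conj u t)                       ≈⟨ conj-cong refl e ⟩
          conj a (t ^ n)                          ≈⟨ w^ n ⟩
          w ^ n                                   ≈⟨ ^-≡ w n≡ ⟩
          w ^ ℤ.suc (+ 4 ℤ.* d)                   ≈⟨ ^-suc w (+ 4 ℤ.* d) ⟩
          w ∙ w ^ (+ 4 ℤ.* d)                     ≈⟨ ∙-congˡ (^-homo-* w (+ 4) d) ⟨
          w ∙ (w ^ + 4) ^ d                       ≈⟨ ∙-congˡ (^-cong d (free tzac (pow 𝐰 4) (𝐮 · 𝐮) ≡.refl)) ⟩
          w ∙ U                                   ∎)
        -- The element `u t⁻¹ u` in two ways: through the action of `u` on `t`, and as `t w⁻¹ t² w`
        -- through the action of `t²` on `w`.
        key : t ^ (n ℤ.* ℤ.- (+ 1)) ∙ (u ∙ u) ≈ t ∙ U ∙ (t ∙ t)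
        key = begin
          t ^ (n ℤ.* ℤ.- (+ 1)) ∙ (u ∙ u)     ≈⟨ ∙-congʳ (trans (sym (conj-t^ n e (ℤ.- (+ 1))))
                  (conj-cong refl (⁻¹-cong (identityʳ t)))) ⟩
          conj u (t ⁻¹) ∙ (u ∙ u)             ≈⟨ coxeter (𝐮 · 𝐭 ⁻ · 𝐮 ⁻ · (𝐮 · 𝐮)) (𝐭 · 𝐰 ⁻ · (𝐭 · 𝐭 · 𝐰)) ≡.refl ⟩
          t ∙ w ⁻¹ ∙ (t ∙ t ∙ w)              ≈⟨ ∙-congˡ ttw ⟩
          t ∙ w ⁻¹ ∙ (w ∙ U ∙ (t ∙ t))        ≈⟨ free (t ∷ w ∷ U ∷ []) (𝐭 · ‵ 1 ⁻ · (‵ 1 · ‵ 2 · (𝐭 · 𝐭)))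
                  (𝐭 · ‵ 2 · (𝐭 · 𝐭)) ≡.refl ⟩
          t ∙ U ∙ (t ∙ t)                     ∎
        -- For even `d` the factor `U` is a power of `u⁴ ∈ ⟨t⟩`, so `key` would put `u²` into `⟨t⟩`.
        even : d ≢ + 2 ℤ.* j
        even d≡ = u²∉T (T.resp (\\-leftDividesʳ (t ^ (n ℤ.* ℤ.- (+ 1))) (u ∙ u)) (T.∙∈ (T.⁻¹∈ (n ℤ.* ℤ.-
                (+ 1) , refl)) (T.resp (sym key)
                    (T.∙∈ (T.∙∈ t∈T (T.resp U≈ (T.^∈ j u⁴∈T))) (T.∙∈ t∈T t∈T)))))
          where
          U≈ : u⁴ ^ j ≈ U
          U≈ = trans (square-^ (u ∙ u) j) (^-≡ (u ∙ u) (≡.sym d≡))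
        -- For odd `d`, `U` is `u²` times a power of `t`. Conjugation by `u²`, which acts on `⟨t⟩`
        -- with exponent `n²`, moves `u²` to the right end, where it cancels and leaves an equation
        -- between powers of `t`.
        odd : d ≢ + 1 ℤ.+ + 2 ℤ.* j
        odd d≡ = arith (exponents (n ℤ.* ℤ.- (+ 1)) (+ 1 ℤ.+ n ℤ.* n ℤ.* K) (∙-cancelʳ (u ∙ u) _ _ (begin
            t ^ (n ℤ.* ℤ.- (+ 1)) ∙ (u ∙ u)                 ≈⟨ key ⟩
            t ∙ U ∙ (t ∙ t)                                 ≈⟨ ∙-congʳ (∙-congˡ U≈) ⟩
            t ∙ (u ∙ u ∙ t ^ (+ 8 ℤ.* i ℤ.* j)) ∙ (t ∙ t)   ≈⟨ free (t ∷ u ∷ t ^ (+ 8 ℤ.* i ℤ.* j) ∷ []) (𝐭 ·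
                    (‵ 1 · ‵ 1 · ‵ 2) · (𝐭 · 𝐭)) (𝐭 · (‵ 1 · ‵ 1 · (‵ 2 · pow 𝐭 2) · (‵ 1 · ‵ 1) ⁻) ·
                    (‵ 1 · ‵ 1)) ≡.refl ⟩
            t ∙ conj (u ∙ u) (t ^ (+ 8 ℤ.* i ℤ.* j) ∙ t ^ + 2) ∙ (u ∙ u)  ≈⟨ ∙-congʳ (∙-congˡ (conj-cong refl
                    (^-homo-+ t (+ 8 ℤ.* i ℤ.* j) (+ 2)))) ⟨
            t ∙ conj (u ∙ u) (t ^ K) ∙ (u ∙ u)              ≈⟨ ∙-congʳ (∙-congˡ (conj-t^ (n ℤ.* n) conj-u²t K)) ⟩
            t ∙ t ^ (n ℤ.* n ℤ.* K) ∙ (u ∙ u)               ≈⟨ ∙-congʳ (^-suc t (n ℤ.* n ℤ.* K)) ⟨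
            t ^ (+ 1 ℤ.+ n ℤ.* n ℤ.* K) ∙ (u ∙ u)           ∎)))
          where
          K = + 8 ℤ.* i ℤ.* j ℤ.+ + 2
          U≈ : U ≈ u ∙ u ∙ t ^ (+ 8 ℤ.* i ℤ.* j)
          U≈ = begin
            (u ∙ u) ^ d                         ≈⟨ ^-≡ (u ∙ u) d≡ ⟩
            (u ∙ u) ^ ℤ.suc (+ 2 ℤ.* j)         ≈⟨ ^-suc (u ∙ u) (+ 2 ℤ.* j) ⟩
            u ∙ u ∙ (u ∙ u) ^ (+ 2 ℤ.* j)       ≈⟨ ∙-congˡ (square-^ (u ∙ u) j) ⟨
            u ∙ u ∙ u⁴ ^ j                      ≈⟨ ∙-congˡ (trans (^-cong j u⁴≈) (^-homo-* t (+ 8 ℤ.* i) j)) ⟩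
            u ∙ u ∙ t ^ (+ 8 ℤ.* i ℤ.* j)       ∎
          conj-u²t : conj (u ∙ u) t ≈ t ^ (n ℤ.* n)
          conj-u²t = begin
            conj (u ∙ u) t      ≈⟨ free (u ∷ t ∷ []) (‵ 0 · ‵ 0 · ‵ 1 · (‵ 0 · ‵ 0) ⁻) (‵ 0 ·
                    (‵ 0 · ‵ 1 · ‵ 0 ⁻) · ‵ 0 ⁻) ≡.refl ⟩
            conj u (conj u t)   ≈⟨ conj-cong refl e ⟩
            conj u (t ^ n)      ≈⟨ conj-t^ n e n ⟩
            t ^ (n ℤ.* n)       ∎
          arith : ¬ (∃ λ s → n ℤ.* ℤ.- (+ 1) ≡ + 1 ℤ.+ n ℤ.* n ℤ.* K ℤ.+ + 32 ℤ.* s)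
          arith (s , eq) = -n≢1+n²[8ij+2]+32s j (proj₁ i-odd) s
            (≡.trans n≡ (≡.cong (λ d → + 1 ℤ.+ + 4 ℤ.* d) d≡)) (proj₂ i-odd) eq

      rotation : ¬ T (conj u t)
      rotation (n , e) = let d , n≡ = 1-mod-4 n ut⁸ e in rotation-exponent n d e n≡

      -- From `u t u⁻¹ = t^x u²`, squaring puts `u t² u⁻¹` into `⟨t⟩`, and its exponent must be 2
      -- modulo 8; this forces `x` to be odd. Then `t⁻¹ t^x` is a power of `t²`, so `w t² w⁻¹` also
      -- lies in `⟨t⟩`. Conjugated by `a`, this says that `t u t⁻¹` is `u` times a power of `u⁴`.
      -- Hence `u t u⁻¹ ∈ ⟨t⟩`, and so `u² ∈ ⟨t⟩`, a contradiction.
      twisted-rotation : ¬ T (conj u t ∙ (u ∙ u) ⁻¹)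
      twisted-rotation (x , e) = finish (x-odd (proj₂ (parity x)))
        where
        y = proj₁ (parity x)
        X = x ℤ.+ m ℤ.* x ℤ.+ + 8 ℤ.* i
        ut : conj u t ≈ t ^ x ∙ (u ∙ u)
        ut = trans (sym (//-rightDividesˡ (u ∙ u) (conj u t))) (∙-congʳ e)
        utt : conj u (t ∙ t) ≈ t ^ X
        utt = begin
          conj u (t ∙ t)                                ≈⟨ conj-∙ u t t ⟩
          conj u t ∙ conj u t                           ≈⟨ ∙-cong ut ut ⟩
          t ^ x ∙ (u ∙ u) ∙ (t ^ x ∙ (u ∙ u))           ≈⟨ free (t ^ x ∷ u ∷ []) (‵ 0 · (‵ 1 · ‵ 1) · (‵ 0 ·
                  (‵ 1 · ‵ 1))) (‵ 0 · (‵ 1 · ‵ 1 · ‵ 0 · (‵ 1 · ‵ 1) ⁻) · (‵ 1 · ‵ 1 · (‵ 1 · ‵ 1))) ≡.refl ⟩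
          t ^ x ∙ conj (u ∙ u) (t ^ x) ∙ u⁴             ≈⟨ ∙-cong (∙-congˡ (conj-t^ m (proj₂ u²t) x)) u⁴≈ ⟩
          t ^ x ∙ t ^ (m ℤ.* x) ∙ t ^ (+ 8 ℤ.* i)       ≈⟨ ∙-congʳ (^-homo-+ t x (m ℤ.* x)) ⟨
          t ^ (x ℤ.+ m ℤ.* x) ∙ t ^ (+ 8 ℤ.* i)         ≈⟨ ^-homo-+ t (x ℤ.+ m ℤ.* x) (+ 8 ℤ.* i) ⟨
          t ^ X                                         ∎
        x-odd : x ≡ + 2 ℤ.* y ⊎ x ≡ + 1 ℤ.+ + 2 ℤ.* y → x ≡ + 1 ℤ.+ + 2 ℤ.* y
        x-odd (inj₂ x≡) = x≡
        x-odd (inj₁ x≡) = let k , eq = 2-mod-8 X ut⁸ utt in ⊥-elim (x+mx+8i≢2+8k y (proj₁ u²t) i k x≡ eq)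
        module _ (x≡ : x ≡ + 1 ℤ.+ + 2 ℤ.* y) where
          K = X ℤ.* y ℤ.+ + 8 ℤ.* i ℤ.+ -[1+ 1 ]
          wtt : conj w (t ∙ t) ≈ t ^ K
          wtt = begin
            conj w (t ∙ t)                                                   ≈⟨ coxeter (𝐰 · (𝐭 · 𝐭) · 𝐰 ⁻)
                    (𝐮 · (𝐭 ⁻ · (𝐮 · 𝐭 · 𝐮 ⁻) · 𝐮) · pow 𝐭 2 ⁻) ≡.refl ⟩
            u ∙ (t ⁻¹ ∙ conj u t ∙ u) ∙ t ^ -[1+ 1 ]                         ≈⟨ ∙-congʳ (∙-congˡ (∙-congʳ
                    (∙-congˡ (trans ut (∙-congʳ (trans (^-≡ t x≡) (^-suc t (+ 2 ℤ.* y)))))))) ⟩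
            u ∙ (t ⁻¹ ∙ (t ∙ t ^ (+ 2 ℤ.* y) ∙ (u ∙ u)) ∙ u) ∙ t ^ -[1+ 1 ]  ≈⟨ free (t ∷ u ∷ t ^
                    (+ 2 ℤ.* y) ∷ []) (‵ 1 · (𝐭 ⁻ · (𝐭 · ‵ 2 · (‵ 1 · ‵ 1)) · ‵ 1) · pow 𝐭 2 ⁻)
                    (‵ 1 · ‵ 2 · ‵ 1 ⁻ · (‵ 1 · ‵ 1 · (‵ 1 · ‵ 1)) · pow 𝐭 2 ⁻) ≡.refl ⟩
            conj u (t ^ (+ 2 ℤ.* y)) ∙ u⁴ ∙ t ^ -[1+ 1 ]                     ≈⟨ ∙-congʳ (∙-cong
                    (conj-t²^ X utt y) u⁴≈) ⟩
            t ^ (X ℤ.* y) ∙ t ^ (+ 8 ℤ.* i) ∙ t ^ -[1+ 1 ]                   ≈⟨ ∙-congʳ (^-homo-+ t (X ℤ.* y)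
                    (+ 8 ℤ.* i)) ⟨
            t ^ (X ℤ.* y ℤ.+ + 8 ℤ.* i) ∙ t ^ -[1+ 1 ]                       ≈⟨ ^-homo-+ t
                    (X ℤ.* y ℤ.+ + 8 ℤ.* i) -[1+ 1 ] ⟨
            t ^ K                                                            ∎
          module _ (k : ℤ) (K≡ : K ≡ + 2 ℤ.+ + 8 ℤ.* k) where
            s = u⁴ ^ k
            tu : conj t u ≈ u ∙ s
            tu = begin
              conj t u                              ≈⟨ conj-cong conj-aw (coxeter (𝐚 · (𝐭 · 𝐭) · 𝐚 ⁻) 𝐮 ≡.refl) ⟨
              conj (conj a w) (conj a (t ∙ t))      ≈⟨ free (a ∷ w ∷ t ∙ t ∷ []) (‵ 0 · ‵ 1 · ‵ 0 ⁻ ·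
                      (‵ 0 · ‵ 2 · ‵ 0 ⁻) · (‵ 0 · ‵ 1 · ‵ 0 ⁻) ⁻) (‵ 0 · (‵ 1 · ‵ 2 · ‵ 1 ⁻) · ‵ 0 ⁻) ≡.refl ⟩
              conj a (conj w (t ∙ t))               ≈⟨ conj-cong refl (trans wtt (^-≡ t K≡)) ⟩
              conj a (t ^ (+ 2 ℤ.+ + 8 ℤ.* k))      ≈⟨ w^ (+ 2 ℤ.+ + 8 ℤ.* k) ⟩
              w ^ (+ 2 ℤ.+ + 8 ℤ.* k)               ≈⟨ ^-homo-+ w (+ 2) (+ 8 ℤ.* k) ⟩
              w ^ + 2 ∙ w ^ (+ 8 ℤ.* k)             ≈⟨ ∙-cong (∙-congˡ (sym (identityʳ w))) (trans
                      (^-cong k u⁴≈w⁸) (^-homo-* w (+ 8) k)) ⟨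
              u ∙ s                                 ∎
            us : Commutes u s
            us = commutes-^ k (free (u ∷ []) (‵ 0 · (‵ 0 · ‵ 0 · (‵ 0 · ‵ 0))) (‵ 0 · ‵ 0 ·
                    (‵ 0 · ‵ 0) · ‵ 0) ≡.refl)
            ut∈T : T (conj u t)
            ut∈T = T.resp (begin
              s ⁻¹ ∙ t                          ≈⟨ free (t ∷ u ∷ s ∷ []) (‵ 2 ⁻ · 𝐭) (‵ 2 ⁻ ·
                      (𝐭 · ‵ 1 · 𝐭 ⁻) · 𝐭 · ‵ 1 ⁻) ≡.refl ⟩
              s ⁻¹ ∙ conj t u ∙ t ∙ u ⁻¹        ≈⟨ ∙-congʳ (∙-congʳ (∙-congˡ (trans tu us))) ⟩
              s ⁻¹ ∙ (s ∙ u) ∙ t ∙ u ⁻¹         ≈⟨ free (t ∷ u ∷ s ∷ []) (‵ 2 ⁻ · (‵ 2 · ‵ 1) · 𝐭 · ‵ 1 ⁻)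
                      (‵ 1 · 𝐭 · ‵ 1 ⁻) ≡.refl ⟩
              conj u t                          ∎) (T.∙∈ (T.⁻¹∈ (T.^∈ k u⁴∈T)) t∈T)
        finish : x ≡ + 1 ℤ.+ + 2 ℤ.* y → ⊥
        finish x≡ = let k , K≡ = 2-mod-8 (K x≡) wt⁸ (wtt x≡) in
          u²∉T (T.resp (\\-leftDividesʳ (t ^ x) (u ∙ u)) (T.∙∈ (T.⁻¹∈ (x , refl)) (T.resp ut (ut∈T x≡ k K≡))))

      -- Squaring `u t u⁻¹ = t^x c u²` makes the twists cancel, because `c` inverts `u²`. The
      -- exponent left for `u t² u⁻¹` is `x - m x`, a multiple of 4 since `m` is 1 modulo 4, whereas
      -- it has to be 2 modulo 8.
      twisted-reflection : ¬ T (conj u t ∙ (u ∙ u) ⁻¹ ∙ c ⁻¹)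
      twisted-reflection (x , e) = let k , eq = 2-mod-8 X ut⁸ utt in x-mx≢2+8k x (proj₁ u²t) k eq
        where
        X = x ℤ.+ ℤ.- (+ 1) ℤ.* (m ℤ.* x)
        ut : conj u t ≈ t ^ x ∙ c ∙ (u ∙ u)
        ut = trans (free (conj u t ∷ u ∷ c ∷ []) (‵ 0) (‵ 0 · (‵ 1 · ‵ 1) ⁻ · ‵ 2 ⁻ · ‵ 2 ·
                (‵ 1 · ‵ 1)) ≡.refl) (∙-congʳ (∙-congʳ e))
        utt : conj u (t ∙ t) ≈ t ^ X
        utt = begin
          conj u (t ∙ t)                                           ≈⟨ conj-∙ u t t ⟩
          conj u t ∙ conj u t                                      ≈⟨ ∙-cong ut ut ⟩
          t ^ x ∙ c ∙ (u ∙ u) ∙ (t ^ x ∙ c ∙ (u ∙ u))              ≈⟨ free (t ^ x ∷ u ∷ c ∷ []) (‵ 0 · ‵ 2 ·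
                  (‵ 1 · ‵ 1) · (‵ 0 · ‵ 2 · (‵ 1 · ‵ 1)))
            (‵ 0 · (‵ 2 · (‵ 1 · ‵ 1 · ‵ 0 · (‵ 1 · ‵ 1) ⁻) · ‵ 2 ⁻) · (‵ 2 · (‵ 1 · ‵ 1) · ‵ 2 ·
                    (‵ 1 · ‵ 1))) ≡.refl ⟩
          t ^ x ∙ conj c (conj (u ∙ u) (t ^ x)) ∙ (c ∙ (u ∙ u) ∙ c ∙ (u ∙ u))
            ≈⟨ ∙-cong (∙-congˡ (trans (conj-cong refl (conj-t^ m (proj₂ u²t) x)) (conj-t^ (ℤ.- (+ 1))
                    (trans conj-ct (⁻¹-cong (sym (identityʳ t)))) (m ℤ.* x))))
                      (coxeter (𝐜 · (𝐮 · 𝐮) · 𝐜 · (𝐮 · 𝐮)) 𝟏 ≡.refl) ⟩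
          t ^ x ∙ t ^ (ℤ.- (+ 1) ℤ.* (m ℤ.* x)) ∙ ε                ≈⟨ identityʳ _ ⟩
          t ^ x ∙ t ^ (ℤ.- (+ 1) ℤ.* (m ℤ.* x))                    ≈⟨ ^-homo-+ t x (ℤ.- (+ 1) ℤ.* (m ℤ.* x)) ⟨
          t ^ X                                                    ∎

      -- As `u² ∉ D`, the subgroup `D₁` is `D ∪ D u²`. In the first coset `u t u⁻¹` must be a
      -- rotation since its square is nontrivial; in the second both kinds of elements of `D` can
      -- occur.
      impossible : ⊥
      impossible = [ rotation ∘ (λ ut∈D → D-nonreflection ut∈D λ e →
                       conj-≉ε u (t^≉ε 2 (ℕ.m≤m+n 3 29)) (trans (conj-gpow u t 2) (trans (∙-congˡ
                               (identityʳ _)) e)))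
                   , [ twisted-rotation , twisted-reflection ]′ ∘ D⇒T ]′ (IndexTwo.index2 i₁ u²∈D₁ ut∈D₁ u²∉D)

    module Possible {D₁ D₂ : Carrier → Set ℓ₂} (i₁ : IndexTwo D D₁) (i₂ : IndexTwo D₁ D₂)
                    (u⁻¹∈D₂ : D₂ (u ⁻¹)) (u²∈D : D (u ∙ u)) where

      u²≈w⁴ : u ∙ u ≈ w ^ + 4
      u²≈w⁴ = free tzac (𝐮 · 𝐮) (pow 𝐰 4) ≡.refl
      u²∈T : T (u ∙ u)
      u²∈T = D-power∈T 4 u²≈w⁴ (ℕ.m≤m+n 9 23) u²∈D
      tu² : Commutes t (u ∙ u)
      tu² = Cyclic-commutes t∈T u²∈T
      wt⁴ : Commutes w (t ^ + 4)
      wt⁴ = exchange-commutes 4 (8 ℕ.* P) {{ℕ.m*n≢0 8 P}} (divisor 4 8 ≡.refl) (T.resp u²≈w⁴ u²∈T)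
      zt⁴ : Commutes z (t ^ + 4)
      zt⁴ = commutes-w⇒z (T.gpow∈ 4 t∈T) wt⁴
      ut⁴ : Commutes u (t ^ + 4)
      ut⁴ = sym (commutes-∙ (sym wt⁴) (sym wt⁴))

      r⁴ : r ∙ r ∙ (r ∙ r) ≈ t ^ + 4
      r⁴ = begin
        r ∙ r ∙ (r ∙ r)            ≈⟨ free (t ∷ u ∷ []) ((‵ 1 ⁻ · 𝐭 · ‵ 1) · (‵ 1 ⁻ · 𝐭 · ‵ 1) ·
                ((‵ 1 ⁻ · 𝐭 · ‵ 1) · (‵ 1 ⁻ · 𝐭 · ‵ 1))) (‵ 1 ⁻ · (pow 𝐭 4 · ‵ 1)) ≡.refl ⟩
        u ⁻¹ ∙ (t ^ + 4 ∙ u)       ≈⟨ ∙-congˡ ut⁴ ⟨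
        u ⁻¹ ∙ (u ∙ t ^ + 4)       ≈⟨ \\-leftDividesʳ u (t ^ + 4) ⟩
        t ^ + 4                    ∎
      r∈D₁ : D₁ r
      r∈D₁ = IsSubgroup.resp (IndexTwo.isSubgroup i₂) (∙-congˡ (⁻¹-involutive u))
               (IndexTwo.normal i₂ u⁻¹∈D₂ (IndexTwo.included i₁ t∈D))
      -- Since `u⁻¹ ∈ D₂` normalises `D₁`, its conjugate `r` of `t` lies in `D₁`, but perhaps not in
      -- `D`; its square does. A reflection is excluded by `r⁴ = t⁴`, which is not `ε`.
      r²∈T : T (r ∙ r)
      r²∈T = D-nonreflection (IndexTwo.square i₁ r∈D₁) λ e → t^≉ε 4 (ℕ.m≤m+n 5 27) (trans (sym r⁴) e)

      x : Carrier
      x = r ∙ r ∙ (t ∙ t) ⁻¹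
      x∈T : T x
      x∈T = T.∙∈ r²∈T (T.⁻¹∈ (T.∙∈ t∈T t∈T))
      x² : x ∙ x ≈ ε
      x² = begin
        x ∙ x                                     ≈⟨ rewriting env (commuting env 1 0
                (Cyclic-commutes r²∈T t∈T)) (‵ 1 · (𝐭 · 𝐭) ⁻ · (‵ 1 · (𝐭 · 𝐭) ⁻)) (‵ 1 · ‵ 1 · pow 𝐭 4 ⁻) ≡.refl ⟩
        r ∙ r ∙ (r ∙ r) ∙ (t ^ + 4) ⁻¹            ≈⟨ ∙-congʳ r⁴ ⟩
        t ^ + 4 ∙ (t ^ + 4) ⁻¹                    ≈⟨ inverseʳ _ ⟩
        ε                                         ∎
        where env = t ∷ r ∙ r ∷ []
      tx : Commutes t x
      tx = Cyclic-commutes t∈T x∈T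
      half≡ : + half ≡ + 4 ℤ.* + (4 ℕ.* P)
      half≡ = ≡.trans (≡.cong +_ (ℕ.*-assoc 4 4 P)) (ℤ.pos-* 4 (4 ℕ.* P))
      -- `x` is `ε` or `t^half`; as 4 divides `half`, commutation of `z` with `t⁴` is enough.
      zx : Commutes z x
      zx = [ (λ e → commutes-resp refl (sym e) (trans (identityʳ z) (sym (identityˡ z))))
           , (λ e → commutes-resp refl (trans (^-homo-* t (+ 4) (+ (4 ℕ.* P))) (trans (^-≡ t (≡.sym half≡))
                   (sym e)))
                      (commutes-^ (+ (4 ℕ.* P)) zt⁴)) ]′ (T-involution x∈T x²)
      ttu : t ∙ t ∙ u ≈ u ∙ t ∙ t ∙ x
      ttu = begin
        t ∙ t ∙ u              ≈⟨ free (t ∷ u ∷ []) (𝐭 · 𝐭 · ‵ 1) (‵ 1 · ((‵ 1 ⁻ · 𝐭 · ‵ 1) ·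
                (‵ 1 ⁻ · 𝐭 · ‵ 1) · (𝐭 · 𝐭) ⁻) · 𝐭 · 𝐭) ≡.refl ⟩
        u ∙ x ∙ t ∙ t          ≈⟨ rewriting env (commuting env 2 0 (sym tx)) (‵ 1 · ‵ 2 · 𝐭 · 𝐭)
                (‵ 1 · 𝐭 · 𝐭 · ‵ 2) ≡.refl ⟩
        u ∙ t ∙ t ∙ x          ∎
        where env = t ∷ u ∷ x ∷ []
      rt : r ∙ t ≈ t ∙ x ∙ r
      rt = r-t-commutator tx zx x² tu² ttu
      r²≈ : r ∙ r ≈ x ∙ (t ∙ t)
      r²≈ = sym (//-rightDividesˡ (t ∙ t) (r ∙ r))
      trtr : t ∙ r ∙ (t ∙ r) ≈ t ^ + 4
      trtr = begin
        t ∙ r ∙ (t ∙ r)                 ≈⟨ free (t ∷ r ∷ []) (𝐭 · ‵ 1 · (𝐭 · ‵ 1)) (𝐭 · (‵ 1 · 𝐭) · ‵ 1) ≡.refl ⟩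
        t ∙ (r ∙ t) ∙ r                 ≈⟨ ∙-congʳ (∙-congˡ rt) ⟩
        t ∙ (t ∙ x ∙ r) ∙ r             ≈⟨ free env (𝐭 · (𝐭 · ‵ 1 · ‵ 2) · ‵ 2) (𝐭 · (𝐭 · ‵ 1) ·
                (‵ 2 · ‵ 2)) ≡.refl ⟩
        t ∙ (t ∙ x) ∙ (r ∙ r)           ≈⟨ ∙-congˡ r²≈ ⟩
        t ∙ (t ∙ x) ∙ (x ∙ (t ∙ t))     ≈⟨ rewriting env (involution env 1 x²) (𝐭 · (𝐭 · ‵ 1) · (‵ 1 ·
                (𝐭 · 𝐭))) (pow 𝐭 4) ≡.refl ⟩
        t ^ + 4                         ∎
        where env = t ∷ x ∷ r ∷ []

      -- Since `u² r⁻¹ t⁻¹ = (u t⁻¹)² = z t² z` and `u²` commutes with `t` and `r`, one gets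
      -- `u⁴ = (z t² z)² (t r)²`, where both factors are `t⁴`.
      u⁴≈t⁸ : u ∙ u ∙ (u ∙ u) ≈ t ^ + 8
      u⁴≈t⁸ = begin
        u ∙ u ∙ (u ∙ u)                                     ≈⟨ rewriting env (commuting env 1 0
                (sym tu²) ++ commuting env 1 2 (sym ru²)) (‵ 1 · ‵ 1) (‵ 1 · ‵ 2 ⁻ · 𝐭 ⁻ ·
                (‵ 1 · ‵ 2 ⁻ · 𝐭 ⁻) · (𝐭 · ‵ 2 · (𝐭 · ‵ 2))) ≡.refl ⟩
        y ∙ y ∙ (t ∙ r ∙ (t ∙ r))                           ≈⟨ ∙-cong (coxeter (𝐮 · 𝐮 · 𝐫 ⁻ · 𝐭 ⁻ ·
                (𝐮 · 𝐮 · 𝐫 ⁻ · 𝐭 ⁻)) (𝐳 · pow 𝐭 4 · 𝐳 ⁻) ≡.refl) trtr ⟩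
        conj z (t ^ + 4) ∙ t ^ + 4                          ≈⟨ ∙-congʳ (commutes⇒conj zt⁴) ⟩
        t ^ + 4 ∙ t ^ + 4                                   ≈⟨ ^-homo-+ t (+ 4) (+ 4) ⟨
        t ^ + 8                                             ∎
        where
        env = t ∷ u ∙ u ∷ r ∷ []
        y = u ∙ u ∙ r ⁻¹ ∙ t ⁻¹
        uu² : Commutes u (u ∙ u)
        uu² = free (u ∷ []) (‵ 0 · (‵ 0 · ‵ 0)) (‵ 0 · ‵ 0 · ‵ 0) ≡.refl
        ru² : Commutes r (u ∙ u)
        ru² = sym (commutes-∙ (commutes-∙ (commutes-inverseʳ (sym uu²)) (sym tu²)) (sym uu²))

      e₂ : let y = (u ∙ u) ⁻¹ ∙ t ^ + 4 in y ≈ ε ⊎ y ≈ gpow G t half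
      e₂ = T-involution (T.∙∈ (T.⁻¹∈ u²∈T) (T.gpow∈ 4 t∈T)) (begin
        (u ∙ u) ⁻¹ ∙ t ^ + 4 ∙ ((u ∙ u) ⁻¹ ∙ t ^ + 4)    ≈⟨ rewriting env (commuting env 1 0 (sym tu²))
                (‵ 1 ⁻ · pow 𝐭 4 · (‵ 1 ⁻ · pow 𝐭 4)) ((‵ 1 · ‵ 1) ⁻ · pow 𝐭 8) ≡.refl ⟩
        (u ∙ u ∙ (u ∙ u)) ⁻¹ ∙ t ^ + 8                   ≈⟨ ∙-congʳ (⁻¹-cong u⁴≈t⁸) ⟩
        (t ^ + 8) ⁻¹ ∙ t ^ + 8                           ≈⟨ inverseˡ _ ⟩
        ε                                                ∎)
        where env = t ∷ u ∙ u ∷ []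

      -- `u⁻¹ t² u = r²` rewrites `(u⁻¹ t²)²` as `r² u⁻² t²`, a product inside `⟨t⟩`.
      e₁ : let y = u ⁻¹ ∙ (t ∙ t) ∙ (u ⁻¹ ∙ (t ∙ t)) in y ≈ ε ⊎ y ≈ gpow G t half
      e₁ = T-involution (T.resp (sym y≈) (T.∙∈ (T.∙∈ (T.∙∈ x∈T t²) (T.⁻¹∈ u²∈T)) t²)) (trans (∙-cong y≈ y≈) (begin
        y ∙ y                                            ≈⟨ rewriting env (commuting env 2 0
                (sym tx) ++ commuting env 1 0 (sym tu²) ++ commuting env 2 1
                (Cyclic-commutes x∈T u²∈T) ++ involution env 2 x²)
          (‵ 2 · (𝐭 · 𝐭) · ‵ 1 ⁻ · (𝐭 · 𝐭) · (‵ 2 · (𝐭 · 𝐭) · ‵ 1 ⁻ · (𝐭 · 𝐭))) ((‵ 1 · ‵ 1) ⁻ · pow 𝐭 8) ≡.refl ⟩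
        (u ∙ u ∙ (u ∙ u)) ⁻¹ ∙ t ^ + 8                   ≈⟨ ∙-congʳ (⁻¹-cong u⁴≈t⁸) ⟩
        (t ^ + 8) ⁻¹ ∙ t ^ + 8                           ≈⟨ inverseˡ _ ⟩
        ε                                                ∎))
        where
        env = t ∷ u ∙ u ∷ x ∷ []
        y = x ∙ (t ∙ t) ∙ (u ∙ u) ⁻¹ ∙ (t ∙ t)
        t² = T.∙∈ t∈T t∈T
        y≈ : u ⁻¹ ∙ (t ∙ t) ∙ (u ⁻¹ ∙ (t ∙ t)) ≈ y
        y≈ = free (t ∷ u ∷ []) (‵ 1 ⁻ · (𝐭 · 𝐭) · (‵ 1 ⁻ · (𝐭 · 𝐭)))
          (((‵ 1 ⁻ · 𝐭 · ‵ 1) · (‵ 1 ⁻ · 𝐭 · ‵ 1) · (𝐭 · 𝐭) ⁻) · (𝐭 · 𝐭) · (‵ 1 · ‵ 1) ⁻ · (𝐭 · 𝐭)) ≡.refl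

    case₃ : Tower 4 D → let y₁ = u ⁻¹ ∙ (t ∙ t) ∙ (u ⁻¹ ∙ (t ∙ t)); y₂ = (u ∙ u) ⁻¹ ∙ t ^ + 4 in
            (y₁ ≈ ε ⊎ y₁ ≈ gpow G t half) × (y₂ ≈ ε ⊎ y₂ ≈ gpow G t half)
    -- Two squarings bring `u²` into `D₁` only. Whether it lies in `D` is decidable because `D` has
    -- a strict chain over the trivial subgroup.
    case₃ (step i₁ (step {P′ = D₂} i₂ (step i₃ (step i₄ (top full))))) = decide (In? ds (u ∙ u))
      where
      t∈D₁ = IndexTwo.included i₁ t∈D
      u∈D₂ : D₂ u
      u∈D₂ = IndexTwo.square i₃ (w∈ i₄ (IndexTwo.included i₃ (IndexTwo.included i₂ t∈D₁)) (full a))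
      decide : Dec (D (u ∙ u)) → _
      decide (yes u²∈D) = Possible.e₁ i₁ i₂ u⁻¹∈D₂ u²∈D , Possible.e₂ i₁ i₂ u⁻¹∈D₂ u²∈D
        where u⁻¹∈D₂ = IsSubgroup.⁻¹∈ (IndexTwo.isSubgroup i₃) u∈D₂
      decide (no  u²∉D) = ⊥-elim (Impossible.impossible i₁ (IndexTwo.square i₂ u∈D₂)
              (IndexTwo.normal i₂ u∈D₂ t∈D₁) u²∉D)

open import Data.Nat using (_≤_; _∸_; _^_)

-- The groups presented by generators and relators

module _ (R : List Word) where

  winv-inverseʳ : ∀ w → R ⊢ (w ++ winv w) ~ []
  winv-inverseʳ []      = ~refl
  winv-inverseʳ (l ∷ w) = ≡.subst (R ⊢_~ []) eq
      (~trans (~app (~app (~refl {u = l ∷ []}) (winv-inverseʳ w)) ~refl) (~cancel l))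
    where
    eq : (l ∷ (w ++ winv w)) ++ (invLetter l ∷ []) ≡ (l ∷ w) ++ winv (l ∷ w)
    eq = ≡.cong (l ∷_) (≡.trans (List.++-assoc w (winv w) _) (≡.cong (w ++_) (≡.sym (List.unfold-reverse
            (invLetter l) (map invLetter w)))))

  winv-involutive : ∀ w → winv (winv w) ≡ w
  winv-involutive w = ≡.trans (≡.cong reverse (List.reverse-map invLetter (map invLetter w)))
    (≡.trans (List.reverse-involutive _) (≡.trans (≡.sym (List.map-∘ w)) (≡.trans
            (List.map-cong invLetter-involutive w) (List.map-id w))))
    where
    invLetter-involutive : ∀ l → invLetter (invLetter l) ≡ l
    invLetter-involutive (i , false) = ≡.refl
    invLetter-involutive (i , true)  = ≡.refl

  winv-inverseˡ : ∀ w → R ⊢ (winv w ++ w) ~ []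
  winv-inverseˡ w = ≡.subst (λ v → R ⊢ (winv w ++ v) ~ []) (winv-involutive w) (winv-inverseʳ (winv w))

  winv-unique : ∀ {u v} → R ⊢ (u ++ v) ~ [] → R ⊢ v ~ winv u
  winv-unique {u} {v} p =
    ~trans (≡.subst (λ x → R ⊢ v ~ x) (List.++-assoc (winv u) u v) (~app (~sym (winv-inverseˡ u)) ~refl))
      (≡.subst (λ x → R ⊢ (winv u ++ (u ++ v)) ~ x) (List.++-identityʳ (winv u)) (~app ~refl p))

  Presented : Group 0ℓ 0ℓ
  Presented = record
    { Carrier = Word ; _≈_ = R ⊢_~_ ; _∙_ = _++_ ; ε = [] ; _⁻¹ = winv
    ; isGroup = record
      { isMonoid = record
        { isSemigroup = record
          { isMagma = record { isEquivalence = record { refl = ~refl ; sym = ~sym ; trans = ~trans } ; ∙-cong =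
                  ~app }
          ; assoc = λ u v w → ≡.subst (λ x → R ⊢ ((u ++ v) ++ w) ~ x) (List.++-assoc u v w) ~refl }
        ; identity = (λ _ → ~refl) , (λ w → ≡.subst (λ x → R ⊢ x ~ w) (≡.sym (List.++-identityʳ w)) ~refl) }
      ; inverse = winv-inverseˡ , winv-inverseʳ
      ; ⁻¹-cong = λ {u} {v} p → winv-unique {v} (~trans (~app (~sym p) ~refl) (winv-inverseʳ u)) } }

  eval-Presented : ∀ w → eval Presented gen w ≡ w
  eval-Presented []                = ≡.refl
  eval-Presented ((i , false) ∷ w) = ≡.cong ((i , false) ∷_) (eval-Presented w)
  eval-Presented ((i , true) ∷ w)  = ≡.cong ((i , true) ∷_) (eval-Presented w)

  presented-satisfies′ : ∀ {r} → r ∈ R → R ⊢ eval Presented gen r ~ []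
  presented-satisfies′ {r} r∈ = ≡.subst (λ w → R ⊢ w ~ []) (≡.sym (eval-Presented r)) (~rel r∈)

-- Relators twisted by an optional power of ρ₁ρ₂

twist : Bool → ℕ → Word → Word
twist false h X = X
twist true  h X = X ++ wpow r₁₂ h

X₁ X₂ X₃ X₄ : Word
X₁ = wcomm (wpow (r₀ ++ r₁) 2) r₂
X₂ = wcomm (wpow (r₀ ++ r₁) 2) (wpow r₁₂ 2)
X₃ = wpow (wcomm r₀ (wpow r₁₂ 2)) 2
X₄ = wcomm r₀ (wpow r₁₂ 4)

wordExpr : Word → Expr
wordExpr []                = 𝟏
wordExpr ((i , false) ∷ w) = ‵ Fin.toℕ i · wordExpr w
wordExpr ((i , true)  ∷ w) = ‵ Fin.toℕ i ⁻ · wordExpr w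

-- Evaluation of relators, and the covers by normal forms

module Generated {ℓ₁ ℓ₂ : Level} (G : Group ℓ₁ ℓ₂) (ρ : Fin 3 → Group.Carrier G) where
  open Group G
  open GroupProperties G
  open SetoidReasoning setoid
  open Rewriting G
  open Powers G renaming (_^_ to _^ℤ_)
  open Subgroups G

  a b c : Carrier
  a = ρ f0
  b = ρ (fs f0)
  c = ρ (fs (fs f0))

  open Coxeter G a b c

  ev : Word → Carrier
  ev = eval G ρ

  eval-++ : ∀ v w → ev (v ++ w) ≈ ev v ∙ ev w
  eval-++ []      w = sym (identityˡ _)
  eval-++ (l ∷ v) w = trans (∙-congˡ (eval-++ v w)) (sym (assoc _ _ _))

  eval-wpow : ∀ w k → ev (wpow w k) ≈ gpow G (ev w) k
  eval-wpow w zero    = refl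
  eval-wpow w (suc k) = trans (eval-++ w _) (∙-congˡ (eval-wpow w k))

  eval-r₁₂ : ∀ k → ev (wpow r₁₂ k) ≈ gpow G t k
  eval-r₁₂ k = trans (eval-wpow r₁₂ k) (gpow-cong k (∙-congˡ (identityʳ c)))

  Satisfies : List Word → Set ℓ₂
  Satisfies = All (λ r → ev r ≈ ε)

  eval-sound : ∀ {R} → Satisfies R → ∀ {u v} → R ⊢ u ~ v → ev u ≈ ev v
  eval-sound sat ~refl        = refl
  eval-sound sat (~sym p)     = sym (eval-sound sat p)
  eval-sound sat (~trans p q) = trans (eval-sound sat p) (eval-sound sat q)
  eval-sound sat (~app {u} {u′} {v} {v′} p q) =
    trans (eval-++ u v) (trans (∙-cong (eval-sound sat p) (eval-sound sat q)) (sym (eval-++ u′ v′)))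
  eval-sound sat (~cancel (i , false)) = trans (∙-congˡ (identityʳ _)) (inverseʳ _)
  eval-sound sat (~cancel (i , true))  = trans (∙-congˡ (identityʳ _)) (inverseˡ _)
  eval-sound sat (~rel r∈)    = All.lookup sat r∈

  Presents⇒Satisfies : ∀ {R} → Presents G ρ R → Satisfies R
  Presents⇒Satisfies (sound , _) = All.tabulate λ r∈ → sound _ [] (~rel r∈)

  base⁻ : ∀ q {xs} → Satisfies (base q ++ xs) → CoxeterRelations × gpow G t q ≈ ε × Satisfies xs
  base⁻ q (aa ∷ bb ∷ cc ∷ abab ∷ bc^q ∷ acac ∷ sat) = record
    { a² = a²′ ; b² = trans (∙-congˡ (sym (identityʳ b))) bb ; c² = c²′
    ; ab⁴ = trans (free (a ∷ b ∷ []) (pow (‵ 0 · ‵ 1) 4) (‵ 0 · (‵ 1 · (‵ 0 · (‵ 1 · (‵ 0 · (‵ 1 · (‵ 0 ·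
            (‵ 1 · 𝟏)))))))) ≡.refl) abab
    ; ac = begin
        a ∙ c                                     ≈⟨ rewriting env (involution env 0 a²′ ++ involution env 1 c²′)
          (‵ 0 · ‵ 1) ((‵ 0 · (‵ 1 · (‵ 0 · (‵ 1 · 𝟏)))) · (‵ 1 · ‵ 0)) ≡.refl ⟩
        a ∙ (c ∙ (a ∙ (c ∙ ε))) ∙ (c ∙ a)         ≈⟨ ∙-congʳ acac ⟩
        ε ∙ (c ∙ a)                               ≈⟨ identityˡ _ ⟩
        c ∙ a                                     ∎
    } , trans (sym (eval-r₁₂ q)) bc^q , sat
    where
    a²′ = trans (∙-congˡ (sym (identityʳ a))) aa
    c²′ = trans (∙-congˡ (sym (identityʳ c))) cc
    env = a ∷ c ∷ []

  base⁺ : CoxeterRelations → ∀ q → gpow G t q ≈ ε → ∀ {xs} → Satisfies xs → Satisfies (base q ++ xs)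
  base⁺ rels q t^q sat = trans (∙-congˡ (identityʳ a)) a² ∷ trans (∙-congˡ (identityʳ b)) b² ∷ trans (∙-congˡ
          (identityʳ c)) c²
    ∷ trans (free (a ∷ b ∷ []) (‵ 0 · (‵ 1 · (‵ 0 · (‵ 1 · (‵ 0 · (‵ 1 · (‵ 0 · (‵ 1 · 𝟏)))))))) (pow
            (‵ 0 · ‵ 1) 4) ≡.refl) ab⁴
    ∷ trans (eval-r₁₂ q) t^q ∷ coxeter (𝐚 · (𝐜 · (𝐚 · (𝐜 · 𝟏)))) 𝟏 ≡.refl ∷ sat
    where
    open CoxeterRelations rels
    open Relations rels

  twisted : Bool → ℕ → Carrier
  twisted false h = ε
  twisted true  h = gpow G t h

  twist⁺ : ∀ f h {X y} → gpow G t h ∙ gpow G t h ≈ ε → ev X ≈ y → y ≈ twisted f h → ev (twist f h X) ≈ ε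
  twist⁺ false h         t²ʰ e e′ = trans e e′
  twist⁺ true  h {X} {y} t²ʰ e e′ = trans (eval-++ X (wpow r₁₂ h)) (trans (∙-cong (trans e e′) (eval-r₁₂ h)) t²ʰ)

  twist⁻ : ∀ f h {X y} → gpow G t h ∙ gpow G t h ≈ ε → ev X ≈ y → ev (twist f h X) ≈ ε → y ≈ twisted f h
  twist⁻ false h         t²ʰ e e′ = trans (sym e) e′
  twist⁻ true  h {X} {y} t²ʰ e e′ = ∙-cancelʳ (gpow G t h) _ _ (trans (trans (sym (∙-cong e (eval-r₁₂ h)))
    (trans (sym (eval-++ X (wpow r₁₂ h))) e′)) (sym t²ʰ))

  module Commutators (rels : CoxeterRelations) where
    open Relations rels

    private
      𝕥 𝕫 𝕦 : Expr
      𝕥 = ‵ 1 · ‵ 2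
      𝕫 = (‵ 0 · ‵ 1) · (‵ 0 · ‵ 1)
      𝕦 = (𝕫 · 𝕥) · (𝕫 · 𝕥)

    value₁ : ev X₁ ≈ z ∙ c ∙ z ∙ c
    value₁ = rewriting abc rules-abc (wordExpr X₁) (𝕫 · ‵ 2 · 𝕫 · ‵ 2) ≡.refl

    value₂ : ev X₂ ≈ z ∙ (t ∙ t) ⁻¹ ∙ z ∙ (t ∙ t)
    value₂ = rewriting abc rules-abc (wordExpr X₂) (𝕫 · (𝕥 · 𝕥) ⁻ · 𝕫 · (𝕥 · 𝕥)) ≡.refl

    -- `[a, t²] = (a t² a)⁻¹ t² = w⁻² t² = u⁻¹ t²`, because `a` carries `t` to `w`.
    value₃ : ev X₃ ≈ u ⁻¹ ∙ (t ∙ t) ∙ (u ⁻¹ ∙ (t ∙ t))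
    value₃ = rewriting abc rules-abc (wordExpr X₃) (𝕦 ⁻ · (𝕥 · 𝕥) · (𝕦 ⁻ · (𝕥 · 𝕥))) ≡.refl

    value₄ : ev X₄ ≈ (u ∙ u) ⁻¹ ∙ t ^ℤ + 4
    value₄ = rewriting abc rules-abc (wordExpr X₄) ((𝕦 · 𝕦) ⁻ · pow 𝕥 4) ≡.refl

  -- Instantiated both for `G`, where counting yields the type, and for the presented group, where
  -- it bounds the number of elements. The last two links `z` and `a` are common to all cases, hence
  -- `s` counts the others only.
  record Cover (s q : ℕ) : Set (ℓ₁ ⊔ ℓ₂) where
    field
      rels     : CoxeterRelations
      t^q      : gpow G t q ≈ ε
      links    : List Carrier
      length≡  : length links ≡ s
      contains : Relations.Contains rels (In (Cyclic t) (a ∷ z ∷ links))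

    private gs = a ∷ z ∷ links

    eval∈ : ∀ w → In (Cyclic t) gs (ev w)
    eval∈ w = go w
      where
      open IsSubgroup (proj₁ contains)
      ρ∈ : ∀ i → In (Cyclic t) gs (ρ i)
      ρ∈ f0           = proj₁ (proj₂ contains)
      ρ∈ (fs f0)      = proj₁ (proj₂ (proj₂ contains))
      ρ∈ (fs (fs f0)) = proj₂ (proj₂ (proj₂ contains))
      go : ∀ w → In (Cyclic t) gs (ev w)
      go []                = ε∈
      go ((i , false) ∷ w) = ∙∈ (ρ∈ i) (go w)
      go ((i , true)  ∷ w) = ∙∈ (⁻¹∈ (ρ∈ i)) (go w)

    covers : .{{_ : ℕ.NonZero q}} → ∀ w → ∃ λ i → enumerate q t gs i ≈ ev w
    covers w = enumerate-surjective q t gs t^q (eval∈ w)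

  module _ (j : ℕ) {q h : ℕ} (q≡h+h : q ≡ h ℕ.+ h) (h≡8j : h ≡ 8 ℕ.* j) where

    half² : gpow G t q ≈ ε → gpow G t h ∙ gpow G t h ≈ ε
    half² t^q = trans (sym (^-homo-+ t (+ h) (+ h))) (trans (reflexive (≡.cong (gpow G t) (≡.sym q≡h+h))) t^q)

    -- A power of `t⁸` covers the relators with and without a twist at once, and commutation of `z`
    -- with `t⁴` or `t⁸` passes to it directly.
    twisted-t⁸ : ∀ f → ∃ λ K → twisted f h ≈ (t ^ℤ + 8) ^ℤ K
    twisted-t⁸ false = + 0 , refl
    twisted-t⁸ true  = + j , sym (trans (^-homo-* t (+ 8) (+ j)) (^-≡ t (≡.trans (≡.sym (ℤ.pos-* 8 j))
            (≡.cong +_ (≡.sym h≡8j)))))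

    twisted² : ∀ f → gpow G t q ≈ ε → twisted f h ∙ twisted f h ≈ ε
    twisted² false t^q = identityˡ ε
    twisted² true  t^q = half² t^q

    coverG₁₂ : ∀ f → Satisfies (base q ++ twist f h X₁ ∷ []) → Cover 1 q
    coverG₁₂ f sat with base⁻ q sat
    ... | rels , t^q , e ∷ [] = record
      { rels = rels ; t^q = t^q ; links = c ∷ [] ; length≡ = ≡.refl
      ; contains = cover₁ (IsSubgroup.resp (Cyclic-isSubgroup t) (sym (trans (twist⁻ f h (half² t^q) value₁ e)
              (proj₂ (twisted-t⁸ f)))) (t⁸ᴷ∈ (proj₁ (twisted-t⁸ f)))) }
      where
      open Relations rels
      open Commutators rels

    coverG₃₄ : ∀ f → Satisfies (base q ++ twist f h X₂ ∷ []) → Cover 2 q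
    coverG₃₄ f sat with base⁻ q sat
    ... | rels , t^q , e ∷ [] = record
      { rels = rels ; t^q = t^q ; links = u ∷ c ∷ [] ; length≡ = ≡.refl ; contains = cover₂ K x² ztt }
      where
      open Relations rels
      open Commutators rels
      K = proj₁ (twisted-t⁸ f)
      x = (t ^ℤ + 8) ^ℤ K
      x≈ : z ∙ (t ∙ t) ⁻¹ ∙ z ∙ (t ∙ t) ≈ x
      x≈ = trans (twist⁻ f h (half² t^q) value₂ e) (proj₂ (twisted-t⁸ f))
      x² : x ∙ x ≈ ε
      x² = trans (sym (∙-cong (proj₂ (twisted-t⁸ f)) (proj₂ (twisted-t⁸ f)))) (twisted² f t^q)
      ztt : z ∙ t ∙ t ≈ t ∙ t ∙ x ∙ z
      ztt = begin
        z ∙ t ∙ t                                        ≈⟨ coxeter (𝐳 · 𝐭 · 𝐭) (𝐭 · 𝐭 · (𝐳 · (𝐭 · 𝐭) ⁻ · 𝐳 ·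
                (𝐭 · 𝐭)) ⁻ · 𝐳) ≡.refl ⟩
        t ∙ t ∙ (z ∙ (t ∙ t) ⁻¹ ∙ z ∙ (t ∙ t)) ⁻¹ ∙ z    ≈⟨ ∙-congʳ (∙-congˡ (trans (⁻¹-cong x≈) (sym
                (inverseˡ-unique x x x²)))) ⟩
        t ∙ t ∙ x ∙ z                                    ∎

    coverG₅₋₈ : ∀ f g → Satisfies (base q ++ twist f h X₃ ∷ twist g h X₄ ∷ []) → Cover 3 q
    coverG₅₋₈ f g sat with base⁻ q sat
    ... | rels , t^q , e ∷ e′ ∷ [] = record
      { rels = rels ; t^q = t^q ; links = u ∷ r ∷ c ∷ [] ; length≡ = ≡.refl
      ; contains = cover₃ (K f) (K g) (x² f) (x² g)
          (trans (free (t ∷ u ∷ []) (‵ 1 ⁻ · 𝐭 · 𝐭 · (‵ 1 ⁻ · 𝐭 · 𝐭)) (‵ 1 ⁻ · (𝐭 · 𝐭) · (‵ 1 ⁻ · (𝐭 · 𝐭))) ≡.refl)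
                 (trans (twist⁻ f h (half² t^q) value₃ e) (proj₂ (twisted-t⁸ f))))
          u² }
      where
      open Relations rels
      open Commutators rels
      K : Bool → ℤ
      K f = proj₁ (twisted-t⁸ f)
      x² : ∀ f → (t ^ℤ + 8) ^ℤ K f ∙ (t ^ℤ + 8) ^ℤ K f ≈ ε
      x² f = trans (sym (∙-cong (proj₂ (twisted-t⁸ f)) (proj₂ (twisted-t⁸ f)))) (twisted² f t^q)
      x = (t ^ℤ + 8) ^ℤ K g
      u² : u ∙ u ≈ t ^ℤ + 4 ∙ x
      u² = begin
        u ∙ u                                          ≈⟨ free (t ∷ u ∷ []) (‵ 1 · ‵ 1) (pow 𝐭 4 ·
                ((‵ 1 · ‵ 1) ⁻ · pow 𝐭 4) ⁻) ≡.refl ⟩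
        t ^ℤ + 4 ∙ ((u ∙ u) ⁻¹ ∙ t ^ℤ + 4) ⁻¹          ≈⟨ ∙-congˡ (⁻¹-cong (trans (twist⁻ g h
                (half² t^q) value₄ e′) (proj₂ (twisted-t⁸ g)))) ⟩
        t ^ℤ + 4 ∙ x ⁻¹                                ≈⟨ ∙-congˡ (inverseˡ-unique x x (x² g)) ⟨
        t ^ℤ + 4 ∙ x                                   ∎

presented-satisfies : ∀ R → Generated.Satisfies (Presented R) gen R
presented-satisfies R = All.tabulate (presented-satisfies′ R)

-- Counting normal forms

module Counting {ℓ₁ ℓ₂ : Level} (G : Group ℓ₁ ℓ₂) (ρ : Fin 3 → Group.Carrier G)
  {s q : ℕ} .{{_ : ℕ.NonZero q}} {n : ℕ} (size : 2 ^ (2 ℕ.+ s) ℕ.* q ≡ n) (card : HasCard G n) where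
  open Group G
  open Subgroups G
  open Generated G ρ
  open Coxeter G a b c

  -- `k` is kept apart from `s` so that the length of a list of links, equal to `s` only
  -- propositionally, can be substituted for it.
  index-injective : ∀ {k} → k ≡ s → (f : Index q (2 ℕ.+ k) → Carrier) →
          (∀ g → ∃ λ i → f i ≈ g) → ∀ i j → f i ≈ f j → i ≡ j
  index-injective ≡.refl f f-surj i j e = ≡.trans (≡.sym (strictlyInverseʳ i)) (≡.trans (≡.cong from
      (card-surjective⇒injective G card′ (f ∘ from) surj (to i) (to j)
        (trans (reflexive (≡.cong f (strictlyInverseʳ i))) (trans e (reflexive (≡.cong f (≡.sym
                (strictlyInverseʳ j))))))))
      (strictlyInverseʳ j))
    where
    open Inverse (Index-size q (2 ℕ.+ s))
    card′ : HasCard G (2 ^ (2 ℕ.+ s) ℕ.* q)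
    card′ = ≡.subst (HasCard G) (≡.sym size) card
    surj : ∀ g → ∃ λ i → f (from i) ≈ g
    surj g = let i , e = f-surj g in to i , trans (reflexive (≡.cong f (strictlyInverseʳ i))) e

  module _ (generated : ∀ g → Σ Word λ w → ev w ≈ g) where

    -- At most n normal forms of the presented group are mapped onto the n elements of G.
    presents : ∀ {R} → Satisfies R → Generated.Cover (Presented R) gen s q → Presents G ρ R
    presents {R} sat cov = (λ _ _ → eval-sound sat) , complete , generated
      where
      module H = Generated (Presented R) gen
      open H.Cover cov using (links; length≡) renaming (covers to covers′)
      nf = Subgroups.enumerate (Presented R) q (Coxeter.t (Presented R) H.a H.b H.c) (H.a ∷ Coxeter.z
              (Presented R) H.a H.b H.c ∷ links)
      sameNormalForm : ∀ i j → ev (nf i) ≈ ev (nf j) → i ≡ j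
      sameNormalForm = index-injective length≡ (ev ∘ nf) λ g →
        let w , e = generated g
            i , p = covers′ w
        in i , trans (eval-sound sat (≡.subst (R ⊢ nf i ~_) (eval-Presented R w) p)) e
      complete : ∀ v w → ev v ≈ ev w → R ⊢ v ~ w
      complete v w e =
        let i , p = covers′ v
            j , p′ = covers′ w
            nf-v = ≡.subst (R ⊢ nf i ~_) (eval-Presented R v) p
            nf-w = ≡.subst (R ⊢ nf j ~_) (eval-Presented R w) p′
        in ~trans (~sym nf-v) (≡.subst (λ k → R ⊢ nf k ~ w)
             (sameNormalForm j i (trans (eval-sound sat nf-w) (trans (sym e) (sym (eval-sound sat nf-v))))) nf-w)

    hasType : Cover s q → HasType G ρ 4 q
    hasType cov = (ℕ.s≤s ℕ.z≤n , CoxeterRelations.ab⁴ rels , ab-minimal)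
                , (ℕ.>-nonZero⁻¹ q , t^q , t-minimal)
      where
      open Cover cov
      enum = enumerate q t (a ∷ z ∷ links)
      base-index : ∀ k → Fin q → Index q k
      base-index zero    i = i
      base-index (suc k) i = inj₁ (base-index k i)
      base-index-injective : ∀ k {i j} → base-index k i ≡ base-index k j → i ≡ j
      base-index-injective zero    e = e
      base-index-injective (suc k) e = base-index-injective k (inj₁-injective e)
      enum-base : ∀ gs i → enumerate q t gs (base-index (length gs) i) ≡ gpow G t (Fin.toℕ i)
      enum-base []       i = ≡.refl
      enum-base (g ∷ gs) i = enum-base gs i
      enum-injective : ∀ i j → enum i ≈ enum j → i ≡ j
      enum-injective = index-injective length≡ enum λ g →
        let w , e = generated g
            i , p = covers w
        in i , trans p e
      0<q = ℕ.>-nonZero⁻¹ q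
      -- The exponent 0: `q` is not syntactically a successor, so the zero of `Fin q` comes from
      -- `0 < q`.
      i₀ : Fin q
      i₀ = Fin.fromℕ< 0<q
      t^i₀ : enumerate q t links (base-index (length links) i₀) ≈ ε
      t^i₀ = trans (reflexive (enum-base links i₀)) (reflexive (≡.cong (gpow G t) (Fin.toℕ-fromℕ< 0<q)))
      z≉ε : ¬ z ≈ ε
      -- The normal forms `t⁰ z` and `t⁰` carry different indices, `inj₂` against `inj₁` at the
      -- place of `z`.
      z≉ε e with enum-injective (inj₁ (inj₂ (base-index (length links) i₀))) (inj₁ (inj₁ (base-index
              (length links) i₀)))
                   (trans (∙-congˡ e) (identityʳ _))
      ... | ()
      t-minimal : ∀ m → 0 ℕ.< m → m ℕ.< q → ¬ gpow G t m ≈ ε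
      t-minimal m 0<m m<q e = ℕ.<⇒≢ 0<m (≡.trans (≡.sym (Fin.toℕ-fromℕ< 0<q)) (≡.trans (≡.cong Fin.toℕ
        (base-index-injective (length links) (inj₁-injective (inj₁-injective (enum-injective
          (inj₁ (inj₁ (base-index (length links) i₀))) (inj₁ (inj₁ (base-index (length links) (Fin.fromℕ< m<q))))
          (trans t^i₀ (sym (trans (reflexive (≡.trans (enum-base links (Fin.fromℕ< m<q)) (≡.cong (gpow G t)
                  (Fin.toℕ-fromℕ< m<q)))) e)))))))) (Fin.toℕ-fromℕ< m<q)))
      ab-minimal : ∀ m → 0 ℕ.< m → m ℕ.< 4 → ¬ gpow G (a ∙ b) m ≈ ε
      -- Exponents 1 and 3 make `ab` itself trivial, the latter through `(ab)⁴ = ε`; in every case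
      -- `z = (ab)²` would be trivial.
      ab-minimal 1 _ _ e = z≉ε (trans (∙-cong ab ab) (identityˡ ε))
        where ab = trans (sym (identityʳ _)) e
      ab-minimal 2 _ _ e = z≉ε (trans (∙-congˡ (sym (identityʳ _))) e)
      ab-minimal 3 _ _ e = z≉ε (trans (∙-cong ab ab) (identityˡ ε))
        where ab = trans (sym (identityʳ _)) (trans (∙-congˡ (sym e)) (CoxeterRelations.ab⁴ rels))
      ab-minimal (suc (suc (suc (suc m)))) _ (ℕ.s≤s (ℕ.s≤s (ℕ.s≤s (ℕ.s≤s ())))) e

-- The three equivalences

module Parts {ℓ₁ ℓ₂ : Level} (G : Group ℓ₁ ℓ₂) (ρ : Fin 3 → Group.Carrier G)
  (stringC : IsStringCGroup G ρ) (n : ℕ) (card : HasCard G (2 ^ n)) (k : ℕ) where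
  open Group G
  open Generated G ρ
  open Coxeter G a b c

  q h : ℕ
  q = 2 ^ (5 ℕ.+ k)
  h = 2 ^ (4 ℕ.+ k)

  j : ℕ
  j = 2 ^ (1 ℕ.+ k)

  q≡h+h : q ≡ h ℕ.+ h
  q≡h+h = ≡.cong (h ℕ.+_) (ℕ.+-identityʳ h)

  h≡8j : h ≡ 8 ℕ.* j
  h≡8j = lemma j
    where
    lemma : ∀ m → 2 ℕ.* (2 ℕ.* (2 ℕ.* m)) ≡ 8 ℕ.* m
    lemma = ℕ-solve-∀

  q≡32P : q ≡ 32 ℕ.* 2 ^ k
  q≡32P = ℕ.^-distribˡ-+-* 2 5 k

  h≡16P : 16 ℕ.* 2 ^ k ≡ h
  h≡16P = ≡.sym (ℕ.^-distribˡ-+-* 2 4 k)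

  instance
    q≢0 : ℕ.NonZero q
    q≢0 = ℕ.m^n≢0 2 (5 ℕ.+ k)
    2^k≢0 : ℕ.NonZero (2 ^ k)
    2^k≢0 = ℕ.m^n≢0 2 k

  generated : ∀ g → Σ Word λ w → eval G ρ w ≈ g
  generated = proj₁ (proj₂ stringC)

  type⇒rels : HasType G ρ 4 q → CoxeterRelations
  type⇒rels ((_ , ab⁴ , _) , _) = record
    { a² = proj₁ (proj₁ stringC f0) ; b² = proj₁ (proj₁ stringC (fs f0)) ; c² = proj₁ (proj₁ stringC (fs (fs f0)))
    ; ab⁴ = ab⁴ ; ac = proj₁ (proj₂ (proj₂ stringC)) }

  type⇒t^q : HasType G ρ 4 q → gpow G t q ≈ ε
  type⇒t^q (_ , (_ , t^q , _)) = t^q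

  twisted-value : ∀ {y} → y ≈ ε ⊎ y ≈ gpow G t (16 ℕ.* 2 ^ k) → ∃ λ f → y ≈ twisted f h
  twisted-value (inj₁ e) = false , e
  twisted-value (inj₂ e) = true , trans e (reflexive (≡.cong (gpow G t) h≡16P))

  part₁ : 2 ^ 3 ℕ.* q ≡ 2 ^ n → 2 ^ n ≡ 2 ^ (2 ℕ.+ suc (5 ℕ.+ k)) →
    HasType G ρ 4 q ⇔ (Presents G ρ (base q ++ X₁ ∷ []) ⊎ Presents G ρ (base q ++ (X₁ ++ wpow r₁₂ h) ∷ []))
  part₁ size N≡ = mk⇔ forward [ backward false , backward true ]′
    where
    open Counting G ρ {s = 1} size card
    backward : ∀ f → Presents G ρ (base q ++ twist f h X₁ ∷ []) → HasType G ρ 4 q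
    backward f pres = hasType generated (coverG₁₂ j q≡h+h h≡8j f (Presents⇒Satisfies pres))
    forward : HasType G ρ 4 q → Presents G ρ (base q ++ X₁ ∷ []) ⊎ Presents G ρ (base q ++ (X₁ ++ wpow r₁₂ h) ∷ [])
    forward type = select (twisted-value (C.case₁ card (C.D-tower card 2 N≡)))
      where
      rels = type⇒rels type
      module C = Classification G a b c rels (5 ℕ.+ k) (2 ^ k) q≡32P (proj₂ type)
      pres : ∀ f → z ∙ c ∙ z ∙ c ≈ twisted f h → Presents G ρ (base q ++ twist f h X₁ ∷ [])
      pres f e = presents generated
        (base⁺ rels q (type⇒t^q type) (twist⁺ f h (half² j q≡h+h h≡8j (type⇒t^q type))
                (Commutators.value₁ rels) e ∷ []))
        (Generated.coverG₁₂ (Presented _) gen j q≡h+h h≡8j f (presented-satisfies _))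
      select : ∃ (λ f → z ∙ c ∙ z ∙ c ≈ twisted f h) → _
      select (false , e) = inj₁ (pres false e)
      select (true  , e) = inj₂ (pres true e)

  part₂ : 2 ^ 4 ℕ.* q ≡ 2 ^ n → 2 ^ n ≡ 2 ^ (3 ℕ.+ suc (5 ℕ.+ k)) →
    HasType G ρ 4 q ⇔ (Presents G ρ (base q ++ X₂ ∷ []) ⊎ Presents G ρ (base q ++ (X₂ ++ wpow r₁₂ h) ∷ []))
  part₂ size N≡ = mk⇔ forward [ backward false , backward true ]′
    where
    open Counting G ρ {s = 2} size card
    backward : ∀ f → Presents G ρ (base q ++ twist f h X₂ ∷ []) → HasType G ρ 4 q
    backward f pres = hasType generated (coverG₃₄ j q≡h+h h≡8j f (Presents⇒Satisfies pres))
    forward : HasType G ρ 4 q → Presents G ρ (base q ++ X₂ ∷ []) ⊎ Presents G ρ (base q ++ (X₂ ++ wpow r₁₂ h) ∷ [])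
    forward type = select (twisted-value (C.case₂ card (C.D-tower card 3 N≡)))
      where
      rels = type⇒rels type
      module C = Classification G a b c rels (5 ℕ.+ k) (2 ^ k) q≡32P (proj₂ type)
      y = z ∙ (t ∙ t) ⁻¹ ∙ z ∙ (t ∙ t)
      pres : ∀ f → y ≈ twisted f h → Presents G ρ (base q ++ twist f h X₂ ∷ [])
      pres f e = presents generated
        (base⁺ rels q (type⇒t^q type) (twist⁺ f h (half² j q≡h+h h≡8j (type⇒t^q type))
                (Commutators.value₂ rels) e ∷ []))
        (Generated.coverG₃₄ (Presented _) gen j q≡h+h h≡8j f (presented-satisfies _))
      select : ∃ (λ f → y ≈ twisted f h) → _
      select (false , e) = inj₁ (pres false e)
      select (true  , e) = inj₂ (pres true e)

  part₃ : 2 ^ 5 ℕ.* q ≡ 2 ^ n → 2 ^ n ≡ 2 ^ (4 ℕ.+ suc (5 ℕ.+ k)) →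
    HasType G ρ 4 q ⇔ ((Presents G ρ (base q ++ X₃ ∷ X₄ ∷ []) ⊎ Presents G ρ (base q ++
            (X₃ ++ wpow r₁₂ h) ∷ X₄ ∷ []))
      ⊎ (Presents G ρ (base q ++ X₃ ∷ (X₄ ++ wpow r₁₂ h) ∷ []) ⊎ Presents G ρ (base q ++ (X₃ ++ wpow r₁₂ h) ∷
              (X₄ ++ wpow r₁₂ h) ∷ [])))
  part₃ size N≡ = mk⇔ forward
      [ [ backward false false , backward true false ]′ , [ backward false true , backward true true ]′ ]′
    where
    open Counting G ρ {s = 3} size card
    backward : ∀ f g → Presents G ρ (base q ++ twist f h X₃ ∷ twist g h X₄ ∷ []) → HasType G ρ 4 q
    backward f g pres = hasType generated (coverG₅₋₈ j q≡h+h h≡8j f g (Presents⇒Satisfies pres))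
    forward : HasType G ρ 4 q → _
    forward type = let e₁ , e₂ = C.case₃ card (C.D-tower card 4 N≡) in select (twisted-value e₁) (twisted-value e₂)
      where
      rels = type⇒rels type
      module C = Classification G a b c rels (5 ℕ.+ k) (2 ^ k) q≡32P (proj₂ type)
      y₁ = u ⁻¹ ∙ (t ∙ t) ∙ (u ⁻¹ ∙ (t ∙ t))
      y₂ = (u ∙ u) ⁻¹ ∙ gpow G t 4
      t²ʰ = half² j q≡h+h h≡8j (type⇒t^q type)
      pres : ∀ f g → y₁ ≈ twisted f h → y₂ ≈ twisted g h → Presents G ρ (base q ++ twist f h X₃ ∷ twist g h X₄ ∷ [])
      pres f g e₁ e₂ = presents generated
        (base⁺ rels q (type⇒t^q type) (twist⁺ f h t²ʰ (Commutators.value₃ rels) e₁ ∷ twist⁺ g h t²ʰ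
                (Commutators.value₄ rels) e₂ ∷ []))
        (Generated.coverG₅₋₈ (Presented _) gen j q≡h+h h≡8j f g (presented-satisfies _))
      select : ∃ (λ f → y₁ ≈ twisted f h) → ∃ (λ g → y₂ ≈ twisted g h) → _
      select (false , e₁) (false , e₂) = inj₁ (inj₁ (pres false false e₁ e₂))
      select (true  , e₁) (false , e₂) = inj₁ (inj₂ (pres true false e₁ e₂))
      select (false , e₁) (true  , e₂) = inj₂ (inj₁ (pres false true e₁ e₂))
      select (true  , e₁) (true  , e₂) = inj₂ (inj₂ (pres true true e₁ e₂))

theorem1p2 : ∀ {c ℓ : Level} (n : ℕ) → 10 ≤ n →
    (G : Group c ℓ) (ρ : Fin 3 → Group.Carrier G) →
    IsStringCGroup G ρ → HasCard G (2 ^ n) →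
    (HasType G ρ 4 (2 ^ (n ∸ 3)) ⇔ (Presents G ρ (G₁ n) ⊎ Presents G ρ (G₂ n)))
    × (HasType G ρ 4 (2 ^ (n ∸ 4)) ⇔ (Presents G ρ (G₃ n) ⊎ Presents G ρ (G₄ n)))
    × (HasType G ρ 4 (2 ^ (n ∸ 5)) ⇔ ((Presents G ρ (G₅ n) ⊎ Presents G ρ (G₆ n))
    ⊎ (Presents G ρ (G₇ n) ⊎ Presents G ρ (G₈ n))))
theorem1p2 n 10≤n G ρ stringC card with ℕ.m≤n⇒∃[o]m+o≡n 10≤n
... | m , ≡.refl =
    -- With `n = 10 + m` the exponents `n - 3`, `n - 4`, `n - 5` are `5 + k` for `k = 2 + m`,
    -- `1 + m`, `m`. Thus `n ≥ 10` is what makes the order of `t` a multiple of 32 in the last part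
    -- too.
    Parts.part₁ G ρ stringC (10 ℕ.+ m) card (2 ℕ.+ m) (≡.sym (ℕ.^-distribˡ-+-* 2 3 (7 ℕ.+ m))) ≡.refl
  , Parts.part₂ G ρ stringC (10 ℕ.+ m) card (1 ℕ.+ m) (≡.sym (ℕ.^-distribˡ-+-* 2 4 (6 ℕ.+ m))) ≡.refl
  , Parts.part₃ G ρ stringC (10 ℕ.+ m) card m (≡.sym (ℕ.^-distribˡ-+-* 2 5 (5 ℕ.+ m))) ≡.refl
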